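{- Let $r\geq 2$ be an integer, $0<\epsilon<\frac{1}{e\,r!}$, $\alpha=\frac{1}{e\,r!}-\epsilon$, and $n_0=\max\left\{\frac{12}{\alpha^2}\log\left(\frac{6}{\alpha^2}\right), \frac{4r}{\alpha}\log\left(\frac{2r}{\alpha}\right)\right\}$. If $G$ is a graph on $n\geq n_0$ vertices with minimum degree $\delta(G)\geq (1-\epsilon)n$, then in every $r$-coloring of the edges of $G$ there exists either a $(1,l,n)$-absorbing tree partition with $l\geq n-\frac{2}{\alpha}\log n$ (i.e. a monochromatic spanning tree with at least $n-\frac{2}{\alpha}\log n$ leaves) or a $(k,l,n)$-absorbing tree partition with $2\leq k\leq r$ and $l\geq \alpha n/2$.
   Context: Graphs are finite and simple; $\log$ is the natural logarithm with base $e$. An $r$-coloring is an arbitrary assignment of colors from $[r]=\{1,\dots,r\}$ to the edges. In an edge-colored graph $G$, a $(k,l,n)$-absorbing tree partition is a collection of trees $T_1,\dots,T_k$ (subgraphs of $G$) together with a common leaf set $L$ of size $l$ such that, after possibly renaming the colors: (i) $\left|\bigcup_{i\in[k]}V(T_i)\right|=n$; (ii) all edges of $T_i$ have color $i$ for all $i\in[k]$ (so the trees have distinct colors); (iii) every vertex in $L$ is a leaf of $T_i$ for all $i\in[k]$; (iv) $V(T_i)\cap V(T_j)=L$ for all $i\neq j$. -}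

module Defs where

open import Data.Fin.Base using (Fin)
open import Data.Integer.Base as ℤ using (+_)
import Data.Integer.Properties as ℤ
open import Data.List.Base as List using (_∷_; _∷ʳ_)
open import Data.List.Extrema.Nat using (min)
open import Data.List.Relation.Unary.Linked using (Linked)
open import Data.List.Relation.Unary.Unique.Propositional using (Unique)
open import Data.Nat.Base as ℕ using (ℕ; zero; suc; NonZero; _!)
import Data.Nat.Properties as ℕ
open import Data.Product.Base using (∃; _×_; _,_)
open import Data.Rational.Base as ℚ using (ℚ; mkℚ; 0ℚ; 1ℚ)
import Data.Rational.Properties as ℚ
open import Data.Rational.Solver using (module +-*-Solver)
import Data.Rational.Unnormalised.Base as ℚᵘ
import Data.Rational.Unnormalised.Properties as ℚᵘ
open import Data.Sum.Base using (inj₁; inj₂)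
import Data.Vec.Base as Vec
open import Function.Base using (_∘_)
open import Function.Definitions using (Injective)
open import Level using (0ℓ)
open import Relation.Binary.Construct.Closure.ReflexiveTransitive using (Star)
open import Relation.Binary.Core using (Rel)
open import Relation.Binary.Definitions using (Decidable; Irreflexive; Symmetric)
open import Relation.Binary.PropositionalEquality using (_≡_; _≢_; refl; sym; trans; cong; cong₂; subst; subst₂)
open import Relation.Nullary using (¬_; yes; no; contradiction)

module Rationals where
  open import Data.Rational.Base hiding (NonZero)
  open ℚ.≤-Reasoning
  open +-*-Solver

  ι : ℕ → ℚ
  ι n = + n / 1

  -- Reciprocal, with the convention inv 0 = 0.
  inv : ℚ → ℚ
  inv q with q ℚ.≟ 0ℚ
  ... | yes _  = 0ℚ
  ... | no q≢0 = (1/ q) {{≢-nonZero q≢0}}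

  sumBelow : ℕ → (ℕ → ℚ) → ℚ
  sumBelow zero    f = 0ℚ
  sumBelow (suc n) f = sumBelow n f + f n

  ι-homo-+ : ∀ m n → ι (m ℕ.+ n) ≡ ι m + ι n
  ι-homo-+ m n = ℚ.toℚᵘ-injective (ℚᵘ.≃-trans (ℚ.toℚᵘ-fromℚᵘ (ℚᵘ.mkℚᵘ (+ (m ℕ.+ n)) 0)) (ℚᵘ.≃-sym (ℚᵘ.≃-trans (ℚ.toℚᵘ-homo-+ (ι m) (ι n)) (ℚᵘ.≃-trans (ℚᵘ.+-cong (ℚ.toℚᵘ-fromℚᵘ (ℚᵘ.mkℚᵘ (+ m) 0)) (ℚ.toℚᵘ-fromℚᵘ (ℚᵘ.mkℚᵘ (+ n) 0))) (ℚᵘ.*≡* (cong (ℤ._* (+ 1)) (cong₂ ℤ._+_ (ℤ.*-identityʳ (+ m)) (ℤ.*-identityʳ (+ n)))))))))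

  ι-homo-* : ∀ m n → ι (m ℕ.* n) ≡ ι m * ι n
  ι-homo-* zero    n = sym (ℚ.*-zeroˡ (ι n))
  ι-homo-* (suc m) n = trans (ι-homo-+ n (m ℕ.* n)) (trans (cong (λ t → ι n + t) (ι-homo-* m n)) (trans (solve 2 (λ a b → b :+ a :* b := (con 1ℚ :+ a) :* b) refl (ι m) (ι n)) (cong (_* ι n) (sym (ι-homo-+ 1 m)))))

  ≤⇒0≤ : ∀ {p q} → p ≤ q → 0ℚ ≤ q - p
  ≤⇒0≤ {p} {q} le = subst (_≤ q - p) (ℚ.+-inverseʳ p) (ℚ.+-monoˡ-≤ (- p) le)

  0≤⇒≤ : ∀ {p q} → 0ℚ ≤ q - p → p ≤ q
  0≤⇒≤ {p} {q} le = subst₂ _≤_ (ℚ.+-identityʳ p) (solve 2 (λ a b → a :+ (b :- a) := b) refl p q) (ℚ.+-monoʳ-≤ p le)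

  *-nonNeg : ∀ {p q} → 0ℚ ≤ p → 0ℚ ≤ q → 0ℚ ≤ p * q
  *-nonNeg {p} {q} 0≤p 0≤q = ℚ.nonNegative⁻¹ (p * q) {{ℚ.nonNeg*nonNeg⇒nonNeg p {{nonNegative 0≤p}} q {{nonNegative 0≤q}}}}

  *-pos : ∀ {p q} → 0ℚ < p → 0ℚ < q → 0ℚ < p * q
  *-pos {p} {q} 0<p 0<q = ℚ.positive⁻¹ (p * q) {{ℚ.pos*pos⇒pos p {{positive 0<p}} q {{positive 0<q}}}}

  *-monoˡ : ∀ {p q r} → 0ℚ ≤ r → p ≤ q → r * p ≤ r * q
  *-monoˡ {r = r} 0≤r p≤q = ℚ.*-monoˡ-≤-nonNeg r {{nonNegative 0≤r}} p≤q

  *-mono : ∀ {p q r s} → 0ℚ ≤ q → 0ℚ ≤ r → p ≤ q → r ≤ s → p * r ≤ q * s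
  *-mono {p} {q} {r} {s} 0≤q 0≤r p≤q r≤s = ℚ.≤-trans (ℚ.*-monoʳ-≤-nonNeg r {{nonNegative 0≤r}} p≤q) (*-monoˡ 0≤q r≤s)

  p≤p+q : ∀ {p q} → 0ℚ ≤ q → p ≤ p + q
  p≤p+q {p} {q} 0≤q = subst (_≤ p + q) (ℚ.+-identityʳ p) (ℚ.+-monoʳ-≤ p 0≤q)

  p≤q+p : ∀ {p q} → 0ℚ ≤ q → p ≤ q + p
  p≤q+p {p} {q} 0≤q = subst (_≤ q + p) (ℚ.+-identityˡ p) (ℚ.+-monoˡ-≤ p 0≤q)

  +-nonNeg : ∀ {p q} → 0ℚ ≤ p → 0ℚ ≤ q → 0ℚ ≤ p + q
  +-nonNeg {p} {q} 0≤p 0≤q = ℚ.≤-trans 0≤p (p≤p+q 0≤q)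

  inv-inverse : ∀ {q} → 0ℚ < q → q * inv q ≡ 1ℚ
  inv-inverse {q} 0<q with q ℚ.≟ 0ℚ
  ... | yes q≡0 = contradiction (sym q≡0) (ℚ.<⇒≢ 0<q)
  ... | no  q≢0 = ℚ.*-inverseʳ q {{≢-nonZero q≢0}}

  inv-pos : ∀ {q} → 0ℚ < q → 0ℚ < inv q
  inv-pos {q} 0<q = ℚ.*-cancelˡ-<-nonNeg q {{nonNegative (ℚ.<⇒≤ 0<q)}}
    (subst₂ _<_ (sym (ℚ.*-zeroʳ q)) (sym (inv-inverse 0<q)) (ℚ.positive⁻¹ 1ℚ))

  inv-unique : ∀ {p q} → 0ℚ < q → q * p ≡ 1ℚ → p ≡ inv q
  inv-unique {p} {q} 0<q e = begin-equality
    p               ≡⟨ ℚ.*-identityʳ p ⟨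
    p * 1ℚ          ≡⟨ cong (p *_) (inv-inverse 0<q) ⟨
    p * (q * inv q) ≡⟨ solve 3 (λ p q i → p :* (q :* i) := (q :* p) :* i) refl p q (inv q) ⟩
    (q * p) * inv q ≡⟨ cong (_* inv q) e ⟩
    1ℚ * inv q      ≡⟨ ℚ.*-identityˡ (inv q) ⟩
    inv q ∎

  inv-homo-* : ∀ {p q} → 0ℚ < p → 0ℚ < q → inv (p * q) ≡ inv p * inv q
  inv-homo-* {p} {q} 0<p 0<q = sym (inv-unique (*-pos 0<p 0<q) (begin-equality
    (p * q) * (inv p * inv q) ≡⟨ solve 4 (λ p q i j → (p :* q) :* (i :* j) := (p :* i) :* (q :* j)) refl p q (inv p) (inv q) ⟩
    (p * inv p) * (q * inv q) ≡⟨ cong₂ _*_ (inv-inverse 0<p) (inv-inverse 0<q) ⟩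
    1ℚ ∎))

  inv-sub : ∀ {p q} → 0ℚ < p → 0ℚ < q → inv p - inv q ≡ (q - p) * (inv p * inv q)
  inv-sub {p} {q} 0<p 0<q = begin-equality
    inv p - inv q
      ≡⟨ cong₂ _-_ (sym (ℚ.*-identityʳ (inv p))) (sym (ℚ.*-identityʳ (inv q))) ⟩
    inv p * 1ℚ - inv q * 1ℚ
      ≡⟨ cong₂ (λ a b → inv p * a - inv q * b) (sym (inv-inverse 0<q)) (sym (inv-inverse 0<p)) ⟩
    inv p * (q * inv q) - inv q * (p * inv p)
      ≡⟨ solve 4 (λ p q i j → i :* (q :* j) :- j :* (p :* i) := (q :- p) :* (i :* j)) refl p q (inv p) (inv q) ⟩
    (q - p) * (inv p * inv q) ∎

  inv-anti : ∀ {p q} → 0ℚ < p → p ≤ q → inv q ≤ inv p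
  inv-anti {p} {q} 0<p p≤q = 0≤⇒≤ (subst (0ℚ ≤_) (sym (inv-sub 0<p 0<q))
    (*-nonNeg (≤⇒0≤ p≤q) (*-nonNeg (ℚ.<⇒≤ (inv-pos 0<p)) (ℚ.<⇒≤ (inv-pos 0<q)))))
    where 0<q = ℚ.<-≤-trans 0<p p≤q

  ι-mono : ∀ {m n} → m ℕ.≤ n → ι m ≤ ι n
  ι-mono {m} m≤n with ℕ.m≤n⇒∃[o]m+o≡n m≤n
  ... | k , refl = subst₂ _≤_ (ℚ.+-identityʳ (ι m)) (sym (ι-homo-+ m k))
        (ℚ.+-monoʳ-≤ (ι m) (ℚ.nonNegative⁻¹ (ι k) {{ℚ.normalize-nonNeg k 1}}))

  ι-pos : ∀ n .{{_ : NonZero n}} → 0ℚ < ι n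
  ι-pos (suc n) = ℚ.positive⁻¹ (ι (suc n)) {{ℚ.normalize-pos (suc n) 1}}

  ι-nonNeg : ∀ n → 0ℚ ≤ ι n
  ι-nonNeg n = ι-mono {0} {n} ℕ.z≤n

  ι-cofinal : ∀ q → ∃ λ n → q ≤ ι n
  ι-cofinal q@(mkℚ a d _) = ℤ.∣ a ∣ , ℚ.toℚᵘ-cancel-≤ (ℚᵘ.≤-respʳ-≃ (ℚᵘ.≃-sym (ℚ.toℚᵘ-fromℚᵘ (ℚᵘ.mkℚᵘ (+ ℤ.∣ a ∣) 0)))
    (ℚᵘ.*≤* (subst (ℤ._≤ (+ ℤ.∣ a ∣ ℤ.* + suc d)) (sym (ℤ.*-identityʳ a))
      (ℤ.≤-trans (a≤ a) (subst ((+ ℤ.∣ a ∣) ℤ.≤_) (ℤ.pos-* ℤ.∣ a ∣ (suc d)) (ℤ.+≤+ (ℕ.m≤m*n ℤ.∣ a ∣ (suc d))))))))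
    where
    a≤ : ∀ a → a ℤ.≤ + ℤ.∣ a ∣
    a≤ (+ n)       = ℤ.≤-refl
    a≤ (ℤ.-[1+ n ]) = ℤ.-≤+

  Σ-cong : ∀ n {f g} → (∀ i → f i ≡ g i) → sumBelow n f ≡ sumBelow n g
  Σ-cong zero    e = refl
  Σ-cong (suc n) e = cong₂ _+_ (Σ-cong n e) (e n)

  Σ-sub : ∀ n f g → sumBelow n f - sumBelow n g ≡ sumBelow n (λ i → f i - g i)
  Σ-sub zero    f g = refl
  Σ-sub (suc n) f g = trans
    (solve 4 (λ s a t b → (s :+ a) :- (t :+ b) := (s :- t) :+ (a :- b)) refl (sumBelow n f) (f n) (sumBelow n g) (g n))
    (cong (_+ (f n - g n)) (Σ-sub n f g))

  Σ-bound : ∀ n f c → (∀ i → i ℕ.< n → ∣ f i ∣ ≤ c) → ∣ sumBelow n f ∣ ≤ ι n * c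
  Σ-bound zero    f c h = ℚ.≤-reflexive (sym (ℚ.*-zeroˡ c))
  Σ-bound (suc n) f c h = begin
    ∣ sumBelow n f + f n ∣     ≤⟨ ℚ.∣p+q∣≤∣p∣+∣q∣ (sumBelow n f) (f n) ⟩
    ∣ sumBelow n f ∣ + ∣ f n ∣ ≤⟨ ℚ.+-mono-≤ (Σ-bound n f c (λ i i<n → h i (ℕ.m<n⇒m<1+n i<n))) (h n ℕ.≤-refl) ⟩
    ι n * c + c               ≡⟨ solve 2 (λ a c → a :* c :+ c := (con 1ℚ :+ a) :* c) refl (ι n) c ⟩
    (1ℚ + ι n) * c            ≡⟨ cong (_* c) (ι-homo-+ 1 n) ⟨
    ι (suc n) * c             ∎

  Σ-++ : ∀ m n f → sumBelow (m ℕ.+ n) f ≡ sumBelow m f + sumBelow n (λ j → f (m ℕ.+ j))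
  Σ-++ m zero    f rewrite ℕ.+-identityʳ m = sym (ℚ.+-identityʳ _)
  Σ-++ m (suc n) f rewrite ℕ.+-suc m n = trans (cong (_+ f (m ℕ.+ n)) (Σ-++ m n f)) (ℚ.+-assoc (sumBelow m f) (sumBelow n (λ j → f (m ℕ.+ j))) (f (m ℕ.+ n)))

  Σ-blocks : ∀ m n f → sumBelow (m ℕ.* n) f ≡ sumBelow m (λ i → sumBelow n (λ j → f (i ℕ.* n ℕ.+ j)))
  Σ-blocks zero    n f = refl
  Σ-blocks (suc m) n f rewrite ℕ.+-comm n (m ℕ.* n) = trans (Σ-++ (m ℕ.* n) n f) (cong (_+ sumBelow n (λ j → f (m ℕ.* n ℕ.+ j))) (Σ-blocks m n f))

  Σ-const : ∀ n c → sumBelow n (λ _ → c) ≡ ι n * c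
  Σ-const zero    c = sym (ℚ.*-zeroˡ c)
  Σ-const (suc n) c = trans (cong (_+ c) (Σ-const n c)) (trans (solve 2 (λ a c → a :* c :+ c := (con 1ℚ :+ a) :* c) refl (ι n) c) (cong (_* c) (sym (ι-homo-+ 1 n))))

  -- D m n tends to 0 as m and n tend to infinity.
  Null : (ℕ → ℕ → ℚ) → Set
  Null D = ∀ ε → 0ℚ < ε → ∃ λ N → ∀ m n → N ℕ.≤ m → N ℕ.≤ n → D m n < ε

  Cauchy : (ℕ → ℚ) → Set
  Cauchy s = Null (λ m n → ∣ s m - s n ∣)

  Null-≤ : ∀ {D E} N → (∀ m n → N ℕ.≤ m → N ℕ.≤ n → D m n ≤ E m n) → Null E → Null D
  Null-≤ N le e ε 0<ε with e ε 0<ε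
  ... | M , h = N ℕ.⊔ M , λ m n p q → ℚ.≤-<-trans
    (le m n (ℕ.m⊔n≤o⇒m≤o N M p) (ℕ.m⊔n≤o⇒m≤o N M q))
    (h m n (ℕ.m⊔n≤o⇒n≤o N M p) (ℕ.m⊔n≤o⇒n≤o N M q))

  Null-+ : ∀ {D E} → Null D → Null E → Null (λ m n → D m n + E m n)
  Null-+ d e ε 0<ε with d (½ * ε) (*-pos {½} (ℚ.positive⁻¹ ½) 0<ε) | e (½ * ε) (*-pos {½} (ℚ.positive⁻¹ ½) 0<ε)
  ... | N , g | M , h = N ℕ.⊔ M , λ m n p q → subst (_ <_)
    (solve 1 (λ x → con ½ :* x :+ con ½ :* x := x) refl ε)
    (ℚ.+-mono-< (g m n (ℕ.m⊔n≤o⇒m≤o N M p) (ℕ.m⊔n≤o⇒m≤o N M q))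
                (h m n (ℕ.m⊔n≤o⇒n≤o N M p) (ℕ.m⊔n≤o⇒n≤o N M q)))

  Null-* : ∀ {D} c → 0ℚ < c → Null D → Null (λ m n → c * D m n)
  Null-* {D} c 0<c d ε 0<ε with d (inv c * ε) (*-pos (inv-pos 0<c) 0<ε)
  ... | N , h = N , λ m n p q → subst (c * D m n <_)
    (trans (sym (ℚ.*-assoc c (inv c) ε)) (trans (cong (_* ε) (inv-inverse 0<c)) (ℚ.*-identityˡ ε)))
    (ℚ.*-monoʳ-<-pos c {{positive 0<c}} (h m n p q))

  inv-null : ∀ ε → 0ℚ < ε → ∃ λ N → ∀ n → N ℕ.≤ n → inv (ι (suc n)) < ε
  inv-null ε 0<ε with ι-cofinal (inv ε)
  ... | N , le = N , λ n N≤n →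
    ℚ.*-cancelˡ-<-nonNeg (ι (suc n)) {{nonNegative (ι-nonNeg (suc n))}} (begin-strict
      ι (suc n) * inv (ι (suc n)) ≡⟨ inv-inverse (ι-pos (suc n)) ⟩
      1ℚ                          ≡⟨ inv-inverse 0<ε ⟨
      ε * inv ε                   ≤⟨ *-monoˡ (ℚ.<⇒≤ 0<ε) (ℚ.≤-trans le (ι-mono N≤n)) ⟩
      ε * ι n                     <⟨ ℚ.*-monoʳ-<-pos ε {{positive 0<ε}} (subst₂ _<_ (ℚ.+-identityˡ (ι n)) (sym (ι-homo-+ 1 n)) (ℚ.+-monoˡ-< (ι n) (ℚ.positive⁻¹ 1ℚ))) ⟩
      ε * ι (suc n)               ≡⟨ ℚ.*-comm ε (ι (suc n)) ⟩
      ι (suc n) * ε               ∎)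

  ∣∣-≤ : ∀ {p c} → p ≤ c → - p ≤ c → ∣ p ∣ ≤ c
  ∣∣-≤ {p} p≤c -p≤c with ℚ.∣p∣≡p∨∣p∣≡-p p
  ... | inj₁ e = subst (_≤ _) (sym e) p≤c
  ... | inj₂ e = subst (_≤ _) (sym e) -p≤c

  p≤∣p∣ : ∀ p → p ≤ ∣ p ∣
  p≤∣p∣ p with ℚ.≤-total 0ℚ p
  ... | inj₁ 0≤p = ℚ.≤-reflexive (sym (ℚ.0≤p⇒∣p∣≡p 0≤p))
  ... | inj₂ p≤0 = ℚ.≤-trans p≤0 (ℚ.0≤∣p∣ p)

  ∣p-q∣-comm : ∀ p q → ∣ p - q ∣ ≡ ∣ q - p ∣
  ∣p-q∣-comm p q = trans (sym (ℚ.∣-p∣≡∣p∣ (p - q))) (cong ∣_∣ (solve 2 (λ p q → :- (p :- q) := q :- p) refl p q))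

  p≤q+∣p-q∣ : ∀ p q → p ≤ q + ∣ p - q ∣
  p≤q+∣p-q∣ p q = begin
    p             ≡⟨ solve 2 (λ p q → p := q :+ (p :- q)) refl p q ⟩
    q + (p - q)   ≤⟨ ℚ.+-monoʳ-≤ q (p≤∣p∣ (p - q)) ⟩
    q + ∣ p - q ∣ ∎

  ∣p-r∣≤ : ∀ p q r → ∣ p - r ∣ ≤ ∣ p - q ∣ + ∣ q - r ∣
  ∣p-r∣≤ p q r = subst (λ t → ∣ t ∣ ≤ ∣ p - q ∣ + ∣ q - r ∣)
    (solve 3 (λ p q r → (p :- q) :+ (q :- r) := p :- r) refl p q r)
    (ℚ.∣p+q∣≤∣p∣+∣q∣ (p - q) (q - r))

  +-lipschitz : ∀ a b c d → ∣ (a + b) - (c + d) ∣ ≤ ∣ a - c ∣ + ∣ b - d ∣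
  +-lipschitz a b c d = subst (λ t → ∣ t ∣ ≤ ∣ a - c ∣ + ∣ b - d ∣)
    (solve 4 (λ a b c d → (a :- c) :+ (b :- d) := (a :+ b) :- (c :+ d)) refl a b c d)
    (ℚ.∣p+q∣≤∣p∣+∣q∣ (a - c) (b - d))

  neg-isometry : ∀ a b → ∣ - a - - b ∣ ≡ ∣ a - b ∣
  neg-isometry a b = trans (cong ∣_∣ (solve 2 (λ a b → :- a :- :- b := b :- a) refl a b)) (∣p-q∣-comm b a)

  ⊔-close : ∀ a b c d → (a ⊔ b) - (c ⊔ d) ≤ ∣ a - c ∣ + ∣ b - d ∣
  ⊔-close a b c d = 0≤⇒≤ (subst (0ℚ ≤_)
    (solve 3 (λ x y z → (x :+ y) :- z := y :- (z :- x)) refl (c ⊔ d) (∣ a - c ∣ + ∣ b - d ∣) (a ⊔ b))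
    (≤⇒0≤ (ℚ.⊔-lub
      (ℚ.≤-trans (p≤q+∣p-q∣ a c) (ℚ.+-mono-≤ (ℚ.p≤p⊔q c d) (p≤p+q (ℚ.0≤∣p∣ (b - d)))))
      (ℚ.≤-trans (p≤q+∣p-q∣ b d) (ℚ.+-mono-≤ (ℚ.p≤q⊔p c d) (p≤q+p (ℚ.0≤∣p∣ (a - c))))))))

  ⊔-lipschitz : ∀ a b c d → ∣ (a ⊔ b) - (c ⊔ d) ∣ ≤ ∣ a - c ∣ + ∣ b - d ∣
  ⊔-lipschitz a b c d = ∣∣-≤ (⊔-close a b c d)
    (subst₂ _≤_ (solve 2 (λ x y → y :- x := :- (x :- y)) refl (a ⊔ b) (c ⊔ d))
      (cong₂ _+_ (∣p-q∣-comm c a) (∣p-q∣-comm d b)) (⊔-close c d a b))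

  *-difference : ∀ {A B} a b c d → 0ℚ ≤ A → 0ℚ ≤ B → ∣ a ∣ ≤ A → ∣ d ∣ ≤ B →
                 ∣ a * b - c * d ∣ ≤ A * ∣ b - d ∣ + B * ∣ a - c ∣
  *-difference {A} {B} a b c d 0≤A 0≤B a≤A d≤B = begin
    ∣ a * b - c * d ∣                   ≡⟨ cong ∣_∣ (solve 4 (λ a b c d → a :* b :- c :* d := a :* (b :- d) :+ d :* (a :- c)) refl a b c d) ⟩
    ∣ a * (b - d) + d * (a - c) ∣       ≤⟨ ℚ.∣p+q∣≤∣p∣+∣q∣ (a * (b - d)) (d * (a - c)) ⟩
    ∣ a * (b - d) ∣ + ∣ d * (a - c) ∣   ≡⟨ cong₂ _+_ (ℚ.∣p*q∣≡∣p∣*∣q∣ a (b - d)) (ℚ.∣p*q∣≡∣p∣*∣q∣ d (a - c)) ⟩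
    ∣ a ∣ * ∣ b - d ∣ + ∣ d ∣ * ∣ a - c ∣ ≤⟨ ℚ.+-mono-≤ (*-mono 0≤A (ℚ.0≤∣p∣ (b - d)) a≤A ℚ.≤-refl) (*-mono 0≤B (ℚ.0≤∣p∣ (a - c)) d≤B ℚ.≤-refl) ⟩
    A * ∣ b - d ∣ + B * ∣ a - c ∣       ∎

  Bounded : (ℕ → ℚ) → Set
  Bounded s = ∃ λ B → 0ℚ < B × ∃ λ N → ∀ n → N ℕ.≤ n → ∣ s n ∣ ≤ B

  bounded : ∀ {s} → Cauchy s → Bounded s
  bounded {s} c with c 1ℚ (ℚ.positive⁻¹ 1ℚ)
  ... | N , h = ∣ s N ∣ + 1ℚ , ℚ.<-≤-trans (ℚ.positive⁻¹ 1ℚ) (p≤q+p (ℚ.0≤∣p∣ (s N))) , N , λ n N≤n → begin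
    ∣ s n ∣                       ≡⟨ cong ∣_∣ (solve 2 (λ x y → x := y :+ (x :- y)) refl (s n) (s N)) ⟩
    ∣ s N + (s n - s N) ∣         ≤⟨ ℚ.∣p+q∣≤∣p∣+∣q∣ (s N) (s n - s N) ⟩
    ∣ s N ∣ + ∣ s n - s N ∣       ≤⟨ ℚ.+-monoʳ-≤ ∣ s N ∣ (ℚ.<⇒≤ (h n N N≤n ℕ.≤-refl)) ⟩
    ∣ s N ∣ + 1ℚ                  ∎

  +-cauchy : ∀ {s t} → Cauchy s → Cauchy t → Cauchy (λ n → s n + t n)
  +-cauchy {s} {t} cs ct = Null-≤ 0 (λ m n _ _ → +-lipschitz (s m) (t m) (s n) (t n)) (Null-+ cs ct)

  neg-cauchy : ∀ {s} → Cauchy s → Cauchy (λ n → - s n)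
  neg-cauchy {s} cs = Null-≤ 0 (λ m n _ _ → ℚ.≤-reflexive (neg-isometry (s m) (s n))) cs

  ⊔-cauchy : ∀ {s t} → Cauchy s → Cauchy t → Cauchy (λ n → s n ⊔ t n)
  ⊔-cauchy {s} {t} cs ct = Null-≤ 0 (λ m n _ _ → ⊔-lipschitz (s m) (t m) (s n) (t n)) (Null-+ cs ct)

  *-cauchy : ∀ {s t} → Cauchy s → Cauchy t → Cauchy (λ n → s n * t n)
  *-cauchy {s} {t} cs ct = combine (bounded cs) (bounded ct)
    where
    combine : Bounded s → Bounded t → Cauchy (λ n → s n * t n)
    combine (A , 0<A , M , hs) (B , 0<B , N , ht) = Null-≤ (M ℕ.⊔ N)
      (λ m n p q → *-difference (s m) (t m) (s n) (t n) (ℚ.<⇒≤ 0<A) (ℚ.<⇒≤ 0<B)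
        (hs m (ℕ.m⊔n≤o⇒m≤o M N p)) (ht n (ℕ.m⊔n≤o⇒n≤o M N q)))
      (Null-+ (Null-* A 0<A ct) (Null-* B 0<B cs))

  inv-cauchy : ∀ {s δ} N → 0ℚ < δ → (∀ n → N ℕ.≤ n → δ ≤ s n) → Cauchy s → Cauchy (λ n → inv (s n))
  inv-cauchy {s} {δ} N 0<δ h cs = Null-≤ N bound (Null-* (inv δ * inv δ) (*-pos (inv-pos 0<δ) (inv-pos 0<δ)) cs)
    where
    bound : ∀ m n → N ℕ.≤ m → N ℕ.≤ n → ∣ inv (s m) - inv (s n) ∣ ≤ (inv δ * inv δ) * ∣ s m - s n ∣
    bound m n p q = begin
      ∣ inv (s m) - inv (s n) ∣                       ≡⟨ cong ∣_∣ (inv-sub 0<x 0<y) ⟩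
      ∣ (s n - s m) * (inv (s m) * inv (s n)) ∣       ≡⟨ ℚ.∣p*q∣≡∣p∣*∣q∣ (s n - s m) _ ⟩
      ∣ s n - s m ∣ * ∣ inv (s m) * inv (s n) ∣       ≡⟨ cong₂ _*_ (∣p-q∣-comm (s n) (s m)) (ℚ.0≤p⇒∣p∣≡p (*-nonNeg (ℚ.<⇒≤ (inv-pos 0<x)) (ℚ.<⇒≤ (inv-pos 0<y)))) ⟩
      ∣ s m - s n ∣ * (inv (s m) * inv (s n))         ≤⟨ *-monoˡ (ℚ.0≤∣p∣ (s m - s n)) (*-mono (ℚ.<⇒≤ (inv-pos 0<δ)) (ℚ.<⇒≤ (inv-pos 0<y)) (inv-anti 0<δ (h m p)) (inv-anti 0<δ (h n q))) ⟩
      ∣ s m - s n ∣ * (inv δ * inv δ)                 ≡⟨ ℚ.*-comm ∣ s m - s n ∣ _ ⟩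
      (inv δ * inv δ) * ∣ s m - s n ∣                 ∎
      where
      0<x = ℚ.<-≤-trans 0<δ (h m p)
      0<y = ℚ.<-≤-trans 0<δ (h n q)

  expSum : ℕ → ℚ
  expSum n = sumBelow n (λ i → inv (ι (i !)))

  !-pos : ∀ n → 0ℚ < ι (n !)
  !-pos n = ι-pos (n !) {{n ℕ.!≢0}}

  expUpper : ℕ → ℚ
  expUpper n = expSum n + (inv (ι (n !)) + inv (ι (n !)))

  expUpper-step : ∀ l → 1 ℕ.≤ l → expUpper (suc l) ≤ expUpper l
  expUpper-step l 1≤l = begin
      (expSum l + f) + (g + g)        ≡⟨ solve 3 (λ s f g → (s :+ f) :+ (g :+ g) := (s :+ f) :+ (con 1ℚ :+ con 1ℚ) :* g) refl (expSum l) f g ⟩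
      (expSum l + f) + (1ℚ + 1ℚ) * g  ≤⟨ ℚ.+-monoʳ-≤ (expSum l + f) 2g≤f ⟩
      (expSum l + f) + f              ≡⟨ ℚ.+-assoc (expSum l) f f ⟩
      expSum l + (f + f)              ∎
    where
    f = inv (ι (l !))
    g = inv (ι (suc l !))
    0≤w : 0ℚ ≤ inv (ι (suc l))
    0≤w = ℚ.<⇒≤ (inv-pos (ι-pos (suc l)))
    2w≤1 : (1ℚ + 1ℚ) * inv (ι (suc l)) ≤ 1ℚ
    2w≤1 = begin
      (1ℚ + 1ℚ) * inv (ι (suc l)) ≤⟨ *-mono (ι-nonNeg (suc l)) 0≤w (ι-mono {2} {suc l} (ℕ.s≤s 1≤l)) ℚ.≤-refl ⟩
      ι (suc l) * inv (ι (suc l)) ≡⟨ inv-inverse (ι-pos (suc l)) ⟩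
      1ℚ                          ∎
    2g≤f : (1ℚ + 1ℚ) * g ≤ f
    2g≤f = begin
      (1ℚ + 1ℚ) * g                     ≡⟨ cong ((1ℚ + 1ℚ) *_) (trans (cong inv (ι-homo-* (suc l) (l !))) (inv-homo-* (ι-pos (suc l)) (!-pos l))) ⟩
      (1ℚ + 1ℚ) * (inv (ι (suc l)) * f) ≡⟨ ℚ.*-assoc (1ℚ + 1ℚ) (inv (ι (suc l))) f ⟨
      (1ℚ + 1ℚ) * inv (ι (suc l)) * f   ≤⟨ *-mono (ℚ.nonNegative⁻¹ 1ℚ) (ℚ.<⇒≤ (inv-pos (!-pos l))) 2w≤1 ℚ.≤-refl ⟩
      1ℚ * f                            ≡⟨ ℚ.*-identityˡ f ⟩
      f                                 ∎

  expUpper-anti : ∀ k l → 1 ℕ.≤ l → expUpper (k ℕ.+ l) ≤ expUpper l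
  expUpper-anti zero    l 1≤l = ℚ.≤-refl
  expUpper-anti (suc k) l 1≤l =
    ℚ.≤-trans (expUpper-step (k ℕ.+ l) (ℕ.≤-trans 1≤l (ℕ.m≤n+m l k))) (expUpper-anti k l 1≤l)

  expSum-mono : ∀ k l → expSum l ≤ expSum (k ℕ.+ l)
  expSum-mono zero    l = ℚ.≤-refl
  expSum-mono (suc k) l = ℚ.≤-trans (expSum-mono k l) (p≤p+q (ℚ.<⇒≤ (inv-pos (!-pos (k ℕ.+ l)))))

  expSum-tail : ∀ k n → ∣ expSum (k ℕ.+ suc n) - expSum (suc n) ∣ ≤ (1ℚ + 1ℚ) * inv (ι (suc n))
  expSum-tail k n = begin
      ∣ A - B ∣           ≡⟨ ℚ.0≤p⇒∣p∣≡p (≤⇒0≤ (expSum-mono k (suc n))) ⟩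
      A - B               ≤⟨ 0≤⇒≤ (subst (0ℚ ≤_)
                               (solve 4 (λ a b g f → ((b :+ (f :+ f)) :- (a :+ (g :+ g))) :+ (g :+ g) := (f :+ f) :- (a :- b)) refl A B g f)
                               (+-nonNeg (≤⇒0≤ (expUpper-anti k (suc n) (ℕ.s≤s ℕ.z≤n))) (+-nonNeg 0≤g 0≤g))) ⟩
      f + f               ≤⟨ ℚ.+-mono-≤ f≤w f≤w ⟩
      w + w               ≡⟨ solve 1 (λ x → x :+ x := (con 1ℚ :+ con 1ℚ) :* x) refl w ⟩
      (1ℚ + 1ℚ) * w       ∎
    where
    A = expSum (k ℕ.+ suc n)
    B = expSum (suc n)
    f = inv (ι (suc n !))
    g = inv (ι ((k ℕ.+ suc n) !))
    w = inv (ι (suc n))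
    0≤g : 0ℚ ≤ g
    0≤g = ℚ.<⇒≤ (inv-pos (!-pos (k ℕ.+ suc n)))
    f≤w : f ≤ w
    f≤w = inv-anti (ι-pos (suc n)) (ι-mono (ℕ.m≤m*n (suc n) (n !) {{n ℕ.!≢0}}))

  invˡ-null : Null (λ m n → inv (ι (suc m)))
  invˡ-null ε 0<ε = let (N , h) = inv-null ε 0<ε in N , λ m n p q → h m p

  invʳ-null : Null (λ m n → inv (ι (suc n)))
  invʳ-null ε 0<ε = let (N , h) = inv-null ε 0<ε in N , λ m n p q → h n q

  expSum-cauchy : Cauchy (λ n → expSum (suc n))
  expSum-cauchy = Null-≤ 0 (λ m n _ _ → close m n)
      (Null-* (1ℚ + 1ℚ) (ℚ.positive⁻¹ (1ℚ + 1ℚ)) (Null-+ invˡ-null invʳ-null))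
    where
    0≤2 : 0ℚ ≤ 1ℚ + 1ℚ
    0≤2 = ℚ.nonNegative⁻¹ (1ℚ + 1ℚ)
    w : ℕ → ℚ
    w n = inv (ι (suc n))
    0≤w : ∀ n → 0ℚ ≤ w n
    0≤w n = ℚ.<⇒≤ (inv-pos (ι-pos (suc n)))
    tail : ∀ m n → n ℕ.≤ m → ∣ expSum (suc m) - expSum (suc n) ∣ ≤ (1ℚ + 1ℚ) * w n
    tail m n n≤m = subst (λ l → ∣ expSum l - expSum (suc n) ∣ ≤ (1ℚ + 1ℚ) * w n)
      (ℕ.m∸n+n≡m (ℕ.s≤s n≤m)) (expSum-tail (suc m ℕ.∸ suc n) n)
    close : ∀ m n → ∣ expSum (suc m) - expSum (suc n) ∣ ≤ (1ℚ + 1ℚ) * (w m + w n)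
    close m n with ℕ.≤-total n m
    ... | inj₁ n≤m = ℚ.≤-trans (tail m n n≤m) (*-monoˡ {w n} {w m + w n} {1ℚ + 1ℚ} 0≤2 (p≤q+p {w n} {w m} (0≤w m)))
    ... | inj₂ m≤n = ℚ.≤-trans (ℚ.≤-reflexive (∣p-q∣-comm (expSum (suc m)) (expSum (suc n))))
                       (ℚ.≤-trans (tail n m m≤n) (*-monoˡ {w m} {w m + w n} {1ℚ + 1ℚ} 0≤2 (p≤p+q {w m} {w n} (0≤w n))))

  -- Left Riemann sum of 1/t from 1 to x with N equal steps of signed width h.
  leftSum : ℕ → ℚ → ℚ
  leftSum N x = sumBelow N (λ i → h * inv (1ℚ + ι i * h))
    where h = (x - 1ℚ) * inv (ι N)

  base≥ : ∀ {m x} N i .{{_ : NonZero N}} → i ℕ.≤ N → m ≤ 1ℚ → m ≤ x → m ≤ 1ℚ + ι i * ((x - 1ℚ) * inv (ι N))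
  base≥ {m} {x} N i i≤N m≤1 m≤x = 0≤⇒≤ (subst (0ℚ ≤_)
      (solve 4 (λ m x k u → (con 1ℚ :- k :* u) :* (con 1ℚ :- m) :+ (k :* u) :* (x :- m) := (con 1ℚ :+ k :* ((x :- con 1ℚ) :* u)) :- m) refl m x (ι i) u)
      (+-nonNeg (*-nonNeg (≤⇒0≤ s≤1) (≤⇒0≤ m≤1)) (*-nonNeg (*-nonNeg (ι-nonNeg i) 0≤u) (≤⇒0≤ m≤x))))
    where
    u = inv (ι N)
    0≤u = ℚ.<⇒≤ (inv-pos (ι-pos N))
    s≤1 : ι i * u ≤ 1ℚ
    s≤1 = ℚ.≤-trans (*-mono (ι-nonNeg N) 0≤u (ι-mono i≤N) ℚ.≤-refl) (ℚ.≤-reflexive (inv-inverse (ι-pos N)))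

  inv²-bound : ∀ {m a b} → 0ℚ < m → m ≤ a → m ≤ b → inv a * inv b ≤ inv m * inv m
  inv²-bound 0<m m≤a m≤b = *-mono (ℚ.<⇒≤ (inv-pos 0<m)) (ℚ.<⇒≤ (inv-pos (ℚ.<-≤-trans 0<m m≤b))) (inv-anti 0<m m≤a) (inv-anti 0<m m≤b)

  inv²-nonNeg : ∀ {m a b} → 0ℚ < m → m ≤ a → m ≤ b → 0ℚ ≤ inv a * inv b
  inv²-nonNeg 0<m m≤a m≤b = *-nonNeg (ℚ.<⇒≤ (inv-pos (ℚ.<-≤-trans 0<m m≤a))) (ℚ.<⇒≤ (inv-pos (ℚ.<-≤-trans 0<m m≤b)))

  leftSum-lipschitz : ∀ {m x y} N .{{_ : NonZero N}} → 0ℚ < m → m ≤ 1ℚ → m ≤ x → m ≤ y →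
                      ∣ leftSum N x - leftSum N y ∣ ≤ (inv m * inv m) * ∣ x - y ∣
  leftSum-lipschitz {m} {x} {y} N 0<m m≤1 m≤x m≤y = begin
      ∣ leftSum N x - leftSum N y ∣            ≡⟨ cong ∣_∣ (Σ-sub N _ _) ⟩
      ∣ sumBelow N _ ∣                         ≤⟨ Σ-bound N _ (u * (∣ x - y ∣ * (inv m * inv m))) term ⟩
      ι N * (u * (∣ x - y ∣ * (inv m * inv m))) ≡⟨ solve 4 (λ n u d c → n :* (u :* (d :* c)) := (n :* u) :* (c :* d)) refl (ι N) u ∣ x - y ∣ (inv m * inv m) ⟩
      (ι N * u) * ((inv m * inv m) * ∣ x - y ∣) ≡⟨ cong (_* ((inv m * inv m) * ∣ x - y ∣)) (inv-inverse (ι-pos N)) ⟩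
      1ℚ * ((inv m * inv m) * ∣ x - y ∣)       ≡⟨ ℚ.*-identityˡ _ ⟩
      (inv m * inv m) * ∣ x - y ∣              ∎
    where
    u = inv (ι N)
    0≤u = ℚ.<⇒≤ (inv-pos (ι-pos N))
    g = (x - 1ℚ) * u
    h = (y - 1ℚ) * u
    term : ∀ i → i ℕ.< N → ∣ g * inv (1ℚ + ι i * g) - h * inv (1ℚ + ι i * h) ∣ ≤ u * (∣ x - y ∣ * (inv m * inv m))
    term i i<N = begin
        ∣ g * I - h * J ∣                       ≡⟨ cong₂ (λ p q → ∣ p - q ∣) (sym (ℚ.*-identityʳ (g * I))) (sym (ℚ.*-identityʳ (h * J))) ⟩
        ∣ g * I * 1ℚ - h * J * 1ℚ ∣             ≡⟨ cong₂ (λ p q → ∣ g * I * p - h * J * q ∣) (sym (inv-inverse 0<b)) (sym (inv-inverse 0<a)) ⟩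
        ∣ g * I * (b * J) - h * J * (a * I) ∣   ≡⟨ cong ∣_∣ (solve 6 (λ x y u k I J →
                let g = (x :- con 1ℚ) :* u ; h = (y :- con 1ℚ) :* u in
                g :* I :* ((con 1ℚ :+ k :* h) :* J) :- h :* J :* ((con 1ℚ :+ k :* g) :* I) := u :* ((x :- y) :* (I :* J))) refl x y u (ι i) I J) ⟩
        ∣ u * ((x - y) * (I * J)) ∣             ≡⟨ ℚ.∣p*q∣≡∣p∣*∣q∣ u _ ⟩
        ∣ u ∣ * ∣ (x - y) * (I * J) ∣           ≡⟨ cong₂ _*_ (ℚ.0≤p⇒∣p∣≡p 0≤u) (ℚ.∣p*q∣≡∣p∣*∣q∣ (x - y) (I * J)) ⟩
        u * (∣ x - y ∣ * ∣ I * J ∣)             ≡⟨ cong (λ t → u * (∣ x - y ∣ * t)) (ℚ.0≤p⇒∣p∣≡p (inv²-nonNeg 0<m m≤a m≤b)) ⟩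
        u * (∣ x - y ∣ * (I * J))               ≤⟨ *-monoˡ 0≤u (*-monoˡ (ℚ.0≤∣p∣ (x - y)) (inv²-bound 0<m m≤a m≤b)) ⟩
        u * (∣ x - y ∣ * (inv m * inv m))       ∎
      where
      a = 1ℚ + ι i * g
      b = 1ℚ + ι i * h
      I = inv a
      J = inv b
      m≤a = base≥ N i (ℕ.<⇒≤ i<N) m≤1 m≤x
      m≤b = base≥ N i (ℕ.<⇒≤ i<N) m≤1 m≤y
      0<a = ℚ.<-≤-trans 0<m m≤a
      0<b = ℚ.<-≤-trans 0<m m≤b

  leftSum-refine : ∀ {m x} N M .{{_ : NonZero N}} .{{_ : NonZero M}} → 0ℚ < m → m ≤ 1ℚ → m ≤ x →
                   ∣ leftSum N x - leftSum (N ℕ.* M) x ∣ ≤ (∣ x - 1ℚ ∣ * ∣ x - 1ℚ ∣) * (inv m * inv m) * inv (ι N)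
  leftSum-refine {m} {x} N M 0<m m≤1 m≤x = begin
      ∣ leftSum N x - leftSum (N ℕ.* M) x ∣      ≡⟨ cong₂ (λ p q → ∣ p - q ∣) coarse (Σ-blocks N M _) ⟩
      ∣ sumBelow N (λ i → sumBelow M (λ j → G i)) - sumBelow N (λ i → sumBelow M (λ j → H (i ℕ.* M ℕ.+ j))) ∣ ≡⟨ cong ∣_∣ (trans (Σ-sub N _ _) (Σ-cong N (λ i → Σ-sub M _ _))) ⟩
      ∣ sumBelow N (λ i → sumBelow M (λ j → G i - H (i ℕ.* M ℕ.+ j))) ∣ ≤⟨ Σ-bound N _ (ι M * c) (λ i i<N → Σ-bound M _ c (λ j j<M → term i j i<N j<M)) ⟩
      ι N * (ι M * c)             ≡⟨ solve 6 (λ n k D C u v → n :* (k :* ((D :* C) :* (u :* (u :* v)))) := (n :* u) :* (k :* v) :* (D :* C :* u)) refl (ι N) (ι M) D C u v ⟩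
      (ι N * u) * (ι M * v) * (D * C * u) ≡⟨ cong₂ (λ p q → p * q * (D * C * u)) (inv-inverse (ι-pos N)) (inv-inverse (ι-pos M)) ⟩
      1ℚ * (D * C * u)            ≡⟨ ℚ.*-identityˡ _ ⟩
      D * C * u                   ∎
    where
    instance _ = ℕ.m*n≢0 N M
    d = x - 1ℚ
    u = inv (ι N)
    v = inv (ι M)
    w = inv (ι (N ℕ.* M))
    D = ∣ d ∣ * ∣ d ∣
    C = inv m * inv m
    c = (D * C) * (u * (u * v))
    0≤u = ℚ.<⇒≤ (inv-pos (ι-pos N))
    0≤v = ℚ.<⇒≤ (inv-pos (ι-pos M))
    a : ℕ → ℚ
    a i = 1ℚ + ι i * (d * u)
    b : ℕ → ℚ
    b k = 1ℚ + ι k * (d * w)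
    G H : ℕ → ℚ
    G i = (d * u) * v * inv (a i)
    H k = d * w * inv (b k)
    w≡ : w ≡ u * v
    w≡ = trans (cong inv (ι-homo-* N M)) (inv-homo-* (ι-pos N) (ι-pos M))
    coarse : leftSum N x ≡ sumBelow N (λ i → sumBelow M (λ j → G i))
    coarse = Σ-cong N (λ i → sym (begin-equality
      sumBelow M (λ j → G i)             ≡⟨ Σ-const M (G i) ⟩
      ι M * ((d * u) * v * inv (a i))    ≡⟨ solve 4 (λ k h v I → k :* (h :* v :* I) := (k :* v) :* (h :* I)) refl (ι M) (d * u) v (inv (a i)) ⟩
      (ι M * v) * (d * u * inv (a i))    ≡⟨ cong (_* (d * u * inv (a i))) (inv-inverse (ι-pos M)) ⟩
      1ℚ * (d * u * inv (a i))           ≡⟨ ℚ.*-identityˡ _ ⟩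
      d * u * inv (a i)                  ∎))
    gap : ∀ i j → b (i ℕ.* M ℕ.+ j) - a i ≡ ι j * (d * (u * v))
    gap i j = begin-equality
      (1ℚ + ι (i ℕ.* M ℕ.+ j) * (d * w)) - (1ℚ + ι i * (d * u))
        ≡⟨ cong₂ (λ p q → (1ℚ + p * (d * q)) - (1ℚ + ι i * (d * u))) (trans (ι-homo-+ (i ℕ.* M) j) (cong (_+ ι j) (ι-homo-* i M))) w≡ ⟩
      (1ℚ + (ι i * ι M + ι j) * (d * (u * v))) - (1ℚ + ι i * (d * u))
        ≡⟨ solve 6 (λ i k j d u v → (con 1ℚ :+ (i :* k :+ j) :* (d :* (u :* v))) :- (con 1ℚ :+ i :* (d :* u)) := (k :* v :- con 1ℚ) :* (i :* (d :* u)) :+ j :* (d :* (u :* v))) refl (ι i) (ι M) (ι j) d u v ⟩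
      (ι M * v - 1ℚ) * (ι i * (d * u)) + ι j * (d * (u * v))
        ≡⟨ cong (λ t → (t - 1ℚ) * (ι i * (d * u)) + ι j * (d * (u * v))) (inv-inverse (ι-pos M)) ⟩
      0ℚ * (ι i * (d * u)) + ι j * (d * (u * v))
        ≡⟨ solve 2 (λ p q → con 0ℚ :* p :+ q := q) refl (ι i * (d * u)) (ι j * (d * (u * v))) ⟩
      ι j * (d * (u * v)) ∎
    term : ∀ i j → i ℕ.< N → j ℕ.< M → ∣ G i - H (i ℕ.* M ℕ.+ j) ∣ ≤ c
    term i j i<N j<M = begin
        ∣ (d * u) * v * I - d * w * J ∣   ≡⟨ cong (λ t → ∣ (d * u) * v * I - d * t * J ∣) w≡ ⟩
        ∣ (d * u) * v * I - d * (u * v) * J ∣ ≡⟨ cong ∣_∣ (solve 5 (λ d u v I J → (d :* u) :* v :* I :- d :* (u :* v) :* J := d :* (u :* v) :* (I :- J)) refl d u v I J) ⟩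
        ∣ d * (u * v) * (I - J) ∣         ≡⟨ cong (λ t → ∣ d * (u * v) * t ∣) (trans (inv-sub 0<a 0<b) (cong (_* (I * J)) (gap i j))) ⟩
        ∣ d * (u * v) * (ι j * (d * (u * v)) * (I * J)) ∣ ≡⟨ cong ∣_∣ (solve 5 (λ d u v j P → d :* (u :* v) :* (j :* (d :* (u :* v)) :* P) := (d :* d) :* (P :* ((j :* v) :* (u :* (u :* v))))) refl d u v (ι j) (I * J)) ⟩
        ∣ (d * d) * R ∣                   ≡⟨ ℚ.∣p*q∣≡∣p∣*∣q∣ (d * d) R ⟩
        ∣ d * d ∣ * ∣ R ∣                 ≡⟨ cong₂ _*_ (ℚ.∣p*q∣≡∣p∣*∣q∣ d d) (ℚ.0≤p⇒∣p∣≡p 0≤R) ⟩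
        D * R                             ≤⟨ *-monoˡ 0≤D (*-mono 0≤C (*-nonNeg (*-nonNeg (ι-nonNeg j) 0≤v) 0≤uuv) (inv²-bound 0<m m≤a m≤b) (*-mono (ℚ.nonNegative⁻¹ 1ℚ) 0≤uuv jv≤1 ℚ.≤-refl)) ⟩
        D * (C * (1ℚ * (u * (u * v))))    ≡⟨ solve 3 (λ D C z → D :* (C :* (con 1ℚ :* z)) := (D :* C) :* z) refl D C (u * (u * v)) ⟩
        c                                 ∎
      where
      k = i ℕ.* M ℕ.+ j
      k≤ : k ℕ.≤ N ℕ.* M
      k≤ = ℕ.≤-trans (ℕ.+-monoʳ-≤ (i ℕ.* M) (ℕ.<⇒≤ j<M)) (subst (ℕ._≤ N ℕ.* M) (ℕ.+-comm M (i ℕ.* M)) (ℕ.*-monoˡ-≤ M i<N))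
      I = inv (a i)
      J = inv (b k)
      R = (I * J) * ((ι j * v) * (u * (u * v)))
      m≤a = base≥ N i (ℕ.<⇒≤ i<N) m≤1 m≤x
      m≤b = base≥ (N ℕ.* M) k k≤ m≤1 m≤x
      0<a = ℚ.<-≤-trans 0<m m≤a
      0<b = ℚ.<-≤-trans 0<m m≤b
      0≤uuv = *-nonNeg 0≤u (*-nonNeg 0≤u 0≤v)
      0≤D = *-nonNeg (ℚ.0≤∣p∣ d) (ℚ.0≤∣p∣ d)
      0≤C = *-nonNeg (ℚ.<⇒≤ (inv-pos 0<m)) (ℚ.<⇒≤ (inv-pos 0<m))
      0≤R = *-nonNeg (inv²-nonNeg 0<m m≤a m≤b) (*-nonNeg (*-nonNeg (ι-nonNeg j) 0≤v) 0≤uuv)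
      jv≤1 : ι j * v ≤ 1ℚ
      jv≤1 = ℚ.≤-trans (*-mono (ι-nonNeg M) 0≤v (ι-mono (ℕ.<⇒≤ j<M)) ℚ.≤-refl) (ℚ.≤-reflexive (inv-inverse (ι-pos M)))

  log-cauchy : ∀ {s δ} N → 0ℚ < δ → (∀ n → N ℕ.≤ n → δ ≤ s n) → Cauchy s → Cauchy (λ n → leftSum (suc n) (s n))
  log-cauchy {s} {δ} N 0<δ h cs = proof (bounded cs)
    where
    proof : Bounded s → Cauchy (λ n → leftSum (suc n) (s n))
    proof (B , 0<B , N′ , hB) = Null-≤ (N ℕ.⊔ N′) close
        (Null-+ (Null-* C 0<C cs) (Null-* (A * C) (*-pos (*-pos 0<B+1 0<B+1) 0<C) (Null-+ invˡ-null invʳ-null)))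
      where
      m = 1ℚ ⊓ δ
      A = (B + 1ℚ) * (B + 1ℚ)
      C = inv m * inv m
      0<B+1 : 0ℚ < B + 1ℚ
      0<B+1 = ℚ.+-mono-< 0<B (ℚ.positive⁻¹ 1ℚ)
      0<m : 0ℚ < m
      0<m with ℚ.⊓-sel 1ℚ δ
      ... | inj₁ e = subst (0ℚ <_) (sym e) (ℚ.positive⁻¹ 1ℚ)
      ... | inj₂ e = subst (0ℚ <_) (sym e) 0<δ
      0<C = *-pos (inv-pos 0<m) (inv-pos 0<m)
      m≤1 = ℚ.p⊓q≤p 1ℚ δ
      m≤ : ∀ n → N ℕ.⊔ N′ ℕ.≤ n → m ≤ s n
      m≤ n p = ℚ.≤-trans (ℚ.p⊓q≤q 1ℚ δ) (h n (ℕ.m⊔n≤o⇒m≤o N N′ p))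
      d≤ : ∀ n → N ℕ.⊔ N′ ℕ.≤ n → ∣ s n - 1ℚ ∣ ≤ B + 1ℚ
      d≤ n p = ℚ.≤-trans (ℚ.∣p-q∣≤∣p∣+∣q∣ (s n) 1ℚ) (ℚ.+-monoˡ-≤ 1ℚ (hB n (ℕ.m⊔n≤o⇒n≤o N N′ p)))
      refine : ∀ k l n → N ℕ.⊔ N′ ℕ.≤ n → ∣ leftSum (suc k) (s n) - leftSum (suc k ℕ.* suc l) (s n) ∣ ≤ A * C * inv (ι (suc k))
      refine k l n p = ℚ.≤-trans (leftSum-refine (suc k) (suc l) 0<m m≤1 (m≤ n p))
        (*-mono (*-nonNeg (*-nonNeg (ℚ.<⇒≤ 0<B+1) (ℚ.<⇒≤ 0<B+1)) (ℚ.<⇒≤ 0<C)) (ℚ.<⇒≤ (inv-pos (ι-pos (suc k))))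
          (*-mono (*-nonNeg (ℚ.<⇒≤ 0<B+1) (ℚ.<⇒≤ 0<B+1)) (ℚ.<⇒≤ 0<C) (*-mono (ℚ.<⇒≤ 0<B+1) (ℚ.0≤∣p∣ (s n - 1ℚ)) (d≤ n p) (d≤ n p)) ℚ.≤-refl) ℚ.≤-refl)
      close : ∀ k l → N ℕ.⊔ N′ ℕ.≤ k → N ℕ.⊔ N′ ℕ.≤ l →
              ∣ leftSum (suc k) (s k) - leftSum (suc l) (s l) ∣ ≤ C * ∣ s k - s l ∣ + A * C * (inv (ι (suc k)) + inv (ι (suc l)))
      close k l p q = begin
        ∣ leftSum (suc k) (s k) - leftSum (suc l) (s l) ∣
          ≤⟨ ∣p-r∣≤ (leftSum (suc k) (s k)) (leftSum (suc k) (s l)) (leftSum (suc l) (s l)) ⟩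
        ∣ leftSum (suc k) (s k) - leftSum (suc k) (s l) ∣ + ∣ leftSum (suc k) (s l) - leftSum (suc l) (s l) ∣
          ≤⟨ ℚ.+-mono-≤ (leftSum-lipschitz (suc k) 0<m m≤1 (m≤ k p) (m≤ l q)) (∣p-r∣≤ (leftSum (suc k) (s l)) (leftSum (suc k ℕ.* suc l) (s l)) (leftSum (suc l) (s l))) ⟩
        C * ∣ s k - s l ∣ + (∣ leftSum (suc k) (s l) - leftSum (suc k ℕ.* suc l) (s l) ∣ + ∣ leftSum (suc k ℕ.* suc l) (s l) - leftSum (suc l) (s l) ∣)
          ≤⟨ ℚ.+-monoʳ-≤ (C * ∣ s k - s l ∣) (ℚ.+-mono-≤ (refine k l l q) (ℚ.≤-trans (ℚ.≤-reflexive (trans (∣p-q∣-comm (leftSum (suc k ℕ.* suc l) (s l)) (leftSum (suc l) (s l))) (cong (λ t → ∣ leftSum (suc l) (s l) - leftSum t (s l) ∣) (ℕ.*-comm (suc k) (suc l))))) (refine l k l q))) ⟩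
        C * ∣ s k - s l ∣ + (A * C * inv (ι (suc k)) + A * C * inv (ι (suc l)))
          ≡⟨ cong (λ t → C * ∣ s k - s l ∣ + t) (sym (ℚ.*-distribˡ-+ (A * C) (inv (ι (suc k))) (inv (ι (suc l))))) ⟩
        C * ∣ s k - s l ∣ + A * C * (inv (ι (suc k)) + inv (ι (suc l))) ∎

open Rationals using (ι; inv; expSum; leftSum; Cauchy)
private module R = Rationals

infix  4 _<_ _≤_
infixl 6 _+_ _-_ _⊔_
infixl 7 _*_ _/_
infix  8 -_
infix  9 _⁻¹

-- Real numbers are Cauchy sequences of rationals; two sequences denote the same
-- real when their difference tends to 0, i.e. when _≤_ holds in both directions.
-- x < y requires a positive rational that eventually separates the two sequences.

record ℝ : Set where
  no-eta-equality
  field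
    seq    : ℕ → ℚ
    cauchy : Cauchy seq

open ℝ

record _<_ (x y : ℝ) : Set where
  no-eta-equality
  field
    gap   : ℚ
    gap>0 : 0ℚ ℚ.< gap
    from  : ℕ
    ahead : ∀ n → from ℕ.≤ n → seq x n ℚ.+ gap ℚ.≤ seq y n

open _<_

_≤_ : ℝ → ℝ → Set
x ≤ y = ∀ δ → 0ℚ ℚ.< δ → ∃ λ N → ∀ n → N ℕ.≤ n → seq x n ℚ.≤ seq y n ℚ.+ δ

fromℕ : ℕ → ℝ
fromℕ k .seq    _ = ι k
fromℕ k .cauchy ε 0<ε = 0 , λ _ _ _ _ → subst (λ q → ℚ.∣ q ∣ ℚ.< ε) (sym (ℚ.+-inverseʳ (ι k))) 0<ε

0ℝ : ℝ
0ℝ = fromℕ 0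

1ℝ : ℝ
1ℝ = fromℕ 1

_+_ : ℝ → ℝ → ℝ
(x + y) .seq    n = seq x n ℚ.+ seq y n
(x + y) .cauchy = R.+-cauchy {seq x} {seq y} (cauchy x) (cauchy y)

-_ : ℝ → ℝ
(- x) .seq    n = ℚ.- seq x n
(- x) .cauchy = R.neg-cauchy {seq x} (cauchy x)

_-_ : ℝ → ℝ → ℝ
x - y = x + - y

_*_ : ℝ → ℝ → ℝ
(x * y) .seq    n = seq x n ℚ.* seq y n
(x * y) .cauchy = R.*-cauchy {seq x} {seq y} (cauchy x) (cauchy y)

_⊔_ : ℝ → ℝ → ℝ
(x ⊔ y) .seq    n = seq x n ℚ.⊔ seq y n
(x ⊔ y) .cauchy = R.⊔-cauchy {seq x} {seq y} (cauchy x) (cauchy y)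

gap≤ : ∀ {x} (p : 0ℝ < x) n → from p ℕ.≤ n → gap p ℚ.≤ seq x n
gap≤ {x} p n le = subst (ℚ._≤ seq x n) (ℚ.+-identityˡ (gap p)) (ahead p n le)

_⁻¹ : (x : ℝ) {{_ : 0ℝ < x}} → ℝ
(x ⁻¹)         .seq    n = inv (seq x n)
(_⁻¹ x {{p}}) .cauchy = R.inv-cauchy {seq x} (from p) (gap>0 p) (gap≤ p) (cauchy x)

_/_ : (x y : ℝ) {{_ : 0ℝ < y}} → ℝ
x / y = x * y ⁻¹

-- e = Σ 1/i!

e : ℝ
e .seq    n = expSum (suc n)
e .cauchy = R.expSum-cauchy

-- log x = ∫₁ˣ dt/t (an oriented integral, so negative for x < 1), the limit of the left
-- Riemann sums with n+1 equal steps; the n-th sum uses the n-th approximation of x.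

log : (x : ℝ) {{_ : 0ℝ < x}} → ℝ
log x         .seq    n = leftSum (suc n) (seq x n)
log x {{p}} .cauchy = R.log-cauchy {seq x} (from p) (gap>0 p) (gap≤ p) (cauchy x)

x<y⇒0<y-x : ∀ {x y} → x < y → 0ℝ < y - x
x<y⇒0<y-x {x} {y} p = record
  { gap   = gap p
  ; gap>0 = gap>0 p
  ; from  = from p
  ; ahead = λ n le → subst₂ ℚ._≤_
      (solve 2 (λ a g → (a :+ g) :- a := con 0ℚ :+ g) refl (seq x n) (gap p)) refl
      (ℚ.+-monoˡ-≤ (ℚ.- seq x n) (ahead p n le))
  }
  where open +-*-Solver

private
  0≤ : ∀ {p} → 0ℚ ℚ.< p → 0ℚ ℚ.≤ p
  0≤ = ℚ.<⇒≤

  positive : ∀ x g N → 0ℚ ℚ.< g → (∀ n → N ℕ.≤ n → g ℚ.≤ seq x n) → 0ℝ < x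
  positive x g N 0<g h = record
    { gap = g ; gap>0 = 0<g ; from = N
    ; ahead = λ n le → subst (ℚ._≤ seq x n) (sym (ℚ.+-identityˡ g)) (h n le) }

instance
  fromℕ-positive : ∀ {k} .{{_ : NonZero k}} → 0ℝ < fromℕ k
  fromℕ-positive {k} = positive (fromℕ k) (ι k) 0 (R.ι-pos k) (λ _ _ → ℚ.≤-refl)

  e-positive : 0ℝ < e
  e-positive = positive e (expSum 1) 0 (ℚ.positive⁻¹ 1ℚ)
    (λ n _ → subst (λ l → expSum 1 ℚ.≤ expSum l) (ℕ.+-comm n 1) (R.expSum-mono n 1))

  *-positive : ∀ {x y} {{_ : 0ℝ < x}} {{_ : 0ℝ < y}} → 0ℝ < x * y
  *-positive {x} {y} {{p}} {{q}} = positive (x * y) (gap p ℚ.* gap q) (from p ℕ.⊔ from q)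
    (R.*-pos (gap>0 p) (gap>0 q))
    (λ n le →
      let g≤x = gap≤ p n (ℕ.m⊔n≤o⇒m≤o (from p) (from q) le)
          g≤y = gap≤ q n (ℕ.m⊔n≤o⇒n≤o (from p) (from q) le)
      in R.*-mono (ℚ.≤-trans (0≤ (gap>0 p)) g≤x) (0≤ (gap>0 q)) g≤x g≤y)

  ⁻¹-positive : ∀ {x} {{_ : 0ℝ < x}} → 0ℝ < x ⁻¹
  ⁻¹-positive {x} {{p}} = bound (R.bounded {seq x} (cauchy x))
    where
    bound : R.Bounded (seq x) → 0ℝ < x ⁻¹
    bound (B , 0<B , N , h) = positive (x ⁻¹) (inv B) (from p ℕ.⊔ N) (R.inv-pos 0<B)
      (λ n le → R.inv-anti (ℚ.<-≤-trans (gap>0 p) (gap≤ p n (ℕ.m⊔n≤o⇒m≤o (from p) N le)))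
                  (ℚ.≤-trans (R.p≤∣p∣ (seq x n)) (h n (ℕ.m⊔n≤o⇒n≤o (from p) N le))))

open import Data.Fin.Subset using (Subset; _∈_; _∩_; ⋃; ∣_∣; Nonempty)

record Graph (n : ℕ) : Set₁ where
  field
    Adj        : Rel (Fin n) 0ℓ
    adj?       : Decidable Adj
    adj-sym    : Symmetric Adj
    adj-irrefl : Irreflexive _≡_ Adj

  degree : Fin n → ℕ
  degree v = Vec.count (adj? v) (Vec.allFin n)

  -- Degrees are below n, so the seed n is only returned when there are no vertices.
  minDegree : ℕ
  minDegree = min n (List.map degree (List.allFin n))

open Graph public

-- An edge is an unordered pair: colour-sym makes the colour independent of the
-- orientation of the edge and of the adjacency proof.

record EdgeColouring {n} (G : Graph n) (r : ℕ) : Set where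
  field
    colour     : ∀ {u v} → Adj G u v → Fin r
    colour-sym : ∀ {u v} (p : Adj G u v) (q : Adj G v u) → colour p ≡ colour q

open EdgeColouring public

record Subgraph {n} (G : Graph n) : Set₁ where
  field
    vertices  : Subset n
    Edge      : Rel (Fin n) 0ℓ
    edge?     : Decidable Edge
    edge-sym  : Symmetric Edge
    edge⇒adj  : ∀ {u v} → Edge u v → Adj G u v
    edge⇒∈    : ∀ {u v} → Edge u v → u ∈ vertices

  Connected : Set
  Connected = ∀ {u v} → u ∈ vertices → v ∈ vertices → Star Edge u v

  -- The cycle u v … w u runs through the distinct vertices u, v, …, w, at least three in number.
  Acyclic : Set
  Acyclic = ∀ u v vs w → let path = u ∷ v ∷ vs ∷ʳ w in
            Unique path → Linked Edge path → ¬ Edge w u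

  IsTree : Set
  IsTree = Nonempty vertices × Connected × Acyclic

  IsLeaf : Fin n → Set
  IsLeaf v = v ∈ vertices × Vec.count (edge? v) (Vec.allFin n) ≡ 1

open Subgraph public

-- "After renaming the colours, Tᵢ has colour i" is expressed by the injection hue,
-- which gives the actual colour of each Tᵢ.

record AbsorbingTreePartition {N r} (G : Graph N) (c : EdgeColouring G r) (k l n : ℕ) : Set₁ where
  field
    T               : Fin k → Subgraph G
    T-tree          : ∀ i → IsTree (T i)
    L               : Subset N
    L-size          : ∣ L ∣ ≡ l
    T-cover         : ∣ ⋃ (List.tabulate (vertices ∘ T)) ∣ ≡ n
    hue             : Fin k → Fin r
    hue-injective   : Injective _≡_ _≡_ hue
    T-monochromatic : ∀ i {u v} (uv : Edge (T i) u v) → colour c (edge⇒adj (T i) uv) ≡ hue i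
    L-leaves        : ∀ i {v} → v ∈ L → IsLeaf (T i) v
    T-meet          : ∀ {i j} → i ≢ j → vertices (T i) ∩ vertices (T j) ≡ L

{-# OPTIONS --safe #-}
module Submission where

-- Call a vertex poor for (x₁, …, x_k; A), where every edge from x_i to A has colour i, if fewer than
-- αn edges from it to A have a colour among 1, …, k.  Some new colour is then frequent at a poor vertex
-- v, and restricting A to the neighbours of v in that colour gives k + 1 stars on a smaller set.  As A
-- loses a factor r - k and an additive (ε + α)n at each step, and n > (ε + α)n · Σ_{j ≤ r} r!/j!, this
-- ends with k ≤ r stars on a set A for which no vertex is poor.
-- A few vertices of A are then used up: each is kept in one tree only, and dominates other vertices in
-- the colour of that tree.  For k ≥ 2 one vertex of each of ⌊|A|/2⌋ pairs is chosen, with a random colour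
-- (derandomised), leaving at least |A|/2 ≥ αn/2 common leaves; for k = 1 a greedy dominating set of
-- about (log n)/α vertices is enough, and all vertices other than these and the centre are leaves.
-- The real parameters enter only through m = ⌈n / Σ_{j ≤ r} r!/j!⌉ - (n - δ(G)) ≥ αn, and logarithms
-- only through y ≤ exp(s) for the Riemann sums s of log y, as y is a telescoping product.

open import Algebra.Bundles using (CommutativeRing)
open import Data.Bool.Base using (Bool; true; false; _∧_; _∨_; not; if_then_else_)
import Data.Bool.Properties as Bool
open import Data.Empty using (⊥; ⊥-elim)
open import Data.Fin.Base using (Fin; zero; suc)
import Data.Fin.Properties as Fin
open import Data.Fin.Subset using (Subset; _∈_; _∩_; ⋃; ∣_∣)
import Data.Fin.Subset.Properties as Subset
import Data.Integer.Base as ℤ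
open import Data.List.Base as List using (List; []; _∷_; _∷ʳ_; length)
import Data.List.Extrema.Nat as Extrema
open import Data.List.Membership.Propositional using () renaming (_∈_ to _∈ₗ_)
import Data.List.Membership.Propositional.Properties as List∈
open import Data.List.Relation.Unary.All as All using ([]; _∷_)
open import Data.List.Relation.Unary.AllPairs using ([]; _∷_)
open import Data.List.Relation.Unary.Any using (here; there)
open import Data.List.Relation.Unary.Linked using (Linked; [-]; _∷_)
open import Data.List.Relation.Unary.Unique.Propositional using (Unique)
import Data.List.Relation.Unary.Unique.Propositional.Properties as Unique
open import Data.Maybe.Base using (Maybe; just; nothing; is-just; maybe′)
import Data.Maybe.Properties as Maybe
open import Data.Nat.Base as ℕ using (ℕ; zero; suc; NonZero; _!)
import Data.Nat.DivMod as ℕ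
import Data.Nat.Properties as ℕ
open import Data.Nat.Tactic.RingSolver using (solve-∀)
open import Data.Product.Base using (_×_; _,_; proj₁; proj₂; ∃-syntax; Σ-syntax)
open import Data.Rational.Base as ℚ using (ℚ; 0ℚ; 1ℚ)
import Data.Rational.Properties as ℚ
open import Data.Sum.Base as Sum using (_⊎_; inj₁; inj₂; [_,_]′)
import Data.Vec.Base as Vec
import Data.Vec.Properties as Vec
open import Function.Base using (_∘_; id)
open import Function.Bundles using (mk⇔)
open import Function.Definitions using (Injective)
open import Relation.Binary.Definitions using (Decidable)
open import Relation.Binary.PropositionalEquality using (_≡_; _≢_; refl; sym; trans; cong; cong₂; subst; subst₂)
open import Relation.Nullary using (¬_; Dec; does; yes; no; contradiction; _×-dec_; _⊎-dec_; ¬?)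
open import Relation.Nullary.Decidable using (does-⇔)
open import Relation.Unary using (Pred) renaming (Decidable to Decidable₁)

open import Defs using (module Rationals; Graph; Adj; adj?; adj-sym; adj-irrefl; degree; minDegree; EdgeColouring; colour; colour-sym; Subgraph; AbsorbingTreePartition)

-- A vertex outside A needs a place in one tree only, so richness counts the colours 1, ..., k
-- together. A vertex of A kept in one tree dominates only in the colour of that tree; hence for k ≥
-- 2 its colour has to be chosen along with it. Pairing caps the used vertices at |A|/2 with
-- certainty and leaves only domination to chance. A vertex u of A joined to v in one of the k
-- colours is chosen with that colour with probability 1/(2k) ≥ 1/(2r), so at least αn such u leave
-- about n(1 - 1/(2r))^(αn) missed vertices. This is below 1 once n ≥ (4r/α) log (2r/α). Reals are
-- Cauchy sequences here: a hypothesis holds up to a tolerance and from some index on, whereas the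
-- graph supplies fixed integers. Two strict inequalities pay for the tolerances: Σ_{j ≤ r} r!/j! <
-- e·r! for the minimum degree, and (3/4)·e > 2 for n ≥ n₀. The bounds on the leaves then hold
-- exactly at each late index.

-- Exponential bounds for left Riemann sums of the logarithm

module Exponential where
  open import Data.Rational.Base hiding (NonZero)
  open import Data.Rational.Solver using (module +-*-Solver)
  open import Algebra.Properties.CommutativeSemiring.Exp (CommutativeRing.commutativeSemiring ℚ.+-*-commutativeRing)
    public using (_^_; ^-distrib-*)
  open Rationals
  open ℚ.≤-Reasoning
  open +-*-Solver

  <⇒≱ : ∀ {p q} → p < q → ¬ q ≤ p
  <⇒≱ p<q q≤p = ℚ.<-irrefl refl (ℚ.<-≤-trans p<q q≤p)

  square-nonNeg : ∀ p → 0ℚ ≤ p * p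
  square-nonNeg p with ℚ.≤-total 0ℚ p
  ... | inj₁ 0≤p = *-nonNeg 0≤p 0≤p
  ... | inj₂ p≤0 = subst (0ℚ ≤_) (solve 1 (λ p → :- p :* :- p := p :* p) refl p)
                     (*-nonNeg (ℚ.neg-antimono-≤ p≤0) (ℚ.neg-antimono-≤ p≤0))

  -- base j s = 1 + s/2ʲ and approx j s = (1 + s/2ʲ)^(2ʲ), which increases to exp s.
  base approx : ℕ → ℚ → ℚ
  base zero    s = 1ℚ + s
  base (suc j) s = base j (½ * s)
  approx zero    s = 1ℚ + s
  approx (suc j) s = approx j (½ * s) * approx j (½ * s)

  approx-nonNeg : ∀ j s → 0ℚ ≤ base j s → 0ℚ ≤ approx j s
  approx-nonNeg zero    s b = b
  approx-nonNeg (suc j) s b = *-nonNeg ih ih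
    where ih = approx-nonNeg j (½ * s) b

  base-suc : ∀ j s → 0ℚ ≤ base j s → 0ℚ ≤ base (suc j) s
  base-suc zero    s b = subst (0ℚ ≤_) (solve 1 (λ s → con ½ :+ con ½ :* (con 1ℚ :+ s) := con 1ℚ :+ con ½ :* s) refl s)
    (+-nonNeg (ℚ.nonNegative⁻¹ ½) (*-nonNeg (ℚ.nonNegative⁻¹ ½) b))
  base-suc (suc j) s b = base-suc j (½ * s) b

  base-+ : ∀ j s t → 0ℚ ≤ base j s → 0ℚ ≤ base j t → 0ℚ ≤ base (suc j) (s + t)
  base-+ zero s t b c = subst (0ℚ ≤_)
    (solve 2 (λ s t → con ½ :* ((con 1ℚ :+ s) :+ (con 1ℚ :+ t)) := con 1ℚ :+ con ½ :* (s :+ t)) refl s t)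
    (*-nonNeg (ℚ.nonNegative⁻¹ ½) (+-nonNeg b c))
  base-+ (suc j) s t b c = subst (λ u → 0ℚ ≤ base (suc j) u) (sym (ℚ.*-distribˡ-+ ½ s t))
    (base-+ j (½ * s) (½ * t) b c)

  -- 1 + s ≤ (1 + s/2)² at the bottom, then squared j times; squaring preserves the inequality
  -- because the bases are nonnegative.
  approx-suc : ∀ j s → 0ℚ ≤ base j s → approx j s ≤ approx (suc j) s
  approx-suc zero s b = 0≤⇒≤ (subst (0ℚ ≤_)
    (solve 1 (λ s → (con ½ :* s) :* (con ½ :* s)
                 := (con 1ℚ :+ con ½ :* s) :* (con 1ℚ :+ con ½ :* s) :- (con 1ℚ :+ s)) refl s)
    (square-nonNeg (½ * s)))
  approx-suc (suc j) s b = *-mono (approx-nonNeg (suc j) (½ * s) (base-suc j (½ * s) b)) (approx-nonNeg j (½ * s) b) ih ih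
    where ih = approx-suc j (½ * s) b

  -- The inequality (1 + s)(1 + t) ≤ (1 + (s + t)/2)² of arithmetic and geometric means, raised to
  -- the power 2ʲ. The level grows by one because the right side has exponent 2·2ʲ.
  approx-* : ∀ j s t → 0ℚ ≤ base j s → 0ℚ ≤ base j t → approx j s * approx j t ≤ approx (suc j) (s + t)
  approx-* zero s t b c = 0≤⇒≤ (subst (0ℚ ≤_)
    (solve 2 (λ s t → (con ½ :* (s :- t)) :* (con ½ :* (s :- t))
                 := (con 1ℚ :+ con ½ :* (s :+ t)) :* (con 1ℚ :+ con ½ :* (s :+ t)) :- (con 1ℚ :+ s) :* (con 1ℚ :+ t)) refl s t)
    (square-nonNeg (½ * (s - t))))
  approx-* (suc j) s t b c = begin
    (A * A) * (B * B)                     ≡⟨ solve 2 (λ a b → (a :* a) :* (b :* b) := (a :* b) :* (a :* b)) refl A B ⟩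
    (A * B) * (A * B)                     ≤⟨ *-mono (ℚ.≤-trans 0≤AB ih) 0≤AB ih ih ⟩
    C (½ * s + ½ * t) * C (½ * s + ½ * t) ≡⟨ cong (λ u → C u * C u) (ℚ.*-distribˡ-+ ½ s t) ⟨
    C (½ * (s + t)) * C (½ * (s + t))     ∎
    where
    A = approx j (½ * s)
    B = approx j (½ * t)
    C = approx (suc j)
    0≤AB = *-nonNeg (approx-nonNeg j (½ * s) b) (approx-nonNeg j (½ * t) c)
    ih = approx-* j (½ * s) (½ * t) b c

  approx<1 : ∀ j s → 0ℚ ≤ base j s → s < 0ℚ → approx j s < 1ℚ
  approx<1 zero    s b s<0 = subst (1ℚ + s <_) (ℚ.+-identityʳ 1ℚ) (ℚ.+-monoʳ-< 1ℚ s<0)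
  approx<1 (suc j) s b s<0 = ℚ.≤-<-trans
    (subst (A * A ≤_) (ℚ.*-identityʳ A) (*-monoˡ (approx-nonNeg j (½ * s) b) (ℚ.<⇒≤ ih))) ih
    where
    A = approx j (½ * s)
    ih = approx<1 j (½ * s) b (subst (½ * s <_) (ℚ.*-zeroʳ ½) (ℚ.*-monoʳ-<-pos ½ s<0))

  infix 4 _≤exp_
  -- A rational certificate for p ≤ exp s, so that no real exponential has to be built. `dom` keeps
  -- the level in the range where raising it only increases the approximation, which lets two
  -- certificates be brought to a common level.
  record _≤exp_ (p s : ℚ) : Set where
    constructor ≤approx
    field
      level : ℕ
      dom   : 0ℚ ≤ base level s
      bound : p ≤ approx level s

  approx-mono : ∀ i j s → 0ℚ ≤ base j s → 0ℚ ≤ base (i ℕ.+ j) s × approx j s ≤ approx (i ℕ.+ j) s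
  approx-mono zero    j s b = b , ℚ.≤-refl
  approx-mono (suc i) j s b with approx-mono i j s b
  ... | b′ , le = base-suc (i ℕ.+ j) s b′ , ℚ.≤-trans le (approx-suc (i ℕ.+ j) s b′)

  raise : ∀ i {p s} (e : p ≤exp s) → let j = i ℕ.+ _≤exp_.level e in 0ℚ ≤ base j s × p ≤ approx j s
  raise i {p} {s} (≤approx j b le) with approx-mono i j s b
  ... | b′ , le′ = b′ , ℚ.≤-trans le le′

  1+-≤exp : ∀ {d} → 0ℚ ≤ 1ℚ + d → 1ℚ + d ≤exp d
  1+-≤exp 0≤1+d = ≤approx 0 0≤1+d ℚ.≤-refl

  *-≤exp : ∀ {p q s t} → 0ℚ ≤ q → p ≤exp s → q ≤exp t → p * q ≤exp s + t
  *-≤exp {p} {q} {s} {t} 0≤q e f = combine (raise j e)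
      (subst (λ l → 0ℚ ≤ base l t × q ≤ approx l t) (ℕ.+-comm i j) (raise i f))
    where
    i = _≤exp_.level e
    j = _≤exp_.level f
    k = j ℕ.+ i
    combine : 0ℚ ≤ base k s × p ≤ approx k s → 0ℚ ≤ base k t × q ≤ approx k t → p * q ≤exp s + t
    combine (b , le) (c , le′) = ≤approx (suc k) (base-+ k s t b c)
      (ℚ.≤-trans (*-mono (approx-nonNeg k s b) 0≤q le le′) (approx-* k s t b c))

  ^-nonNeg : ∀ {p} n → 0ℚ ≤ p → 0ℚ ≤ p ^ n
  ^-nonNeg zero    0≤p = ℚ.nonNegative⁻¹ 1ℚ
  ^-nonNeg (suc n) 0≤p = *-nonNeg 0≤p (^-nonNeg n 0≤p)

  ^-≤exp : ∀ n {p s} → 0ℚ ≤ p → p ≤exp s → p ^ n ≤exp ι n * s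
  ^-≤exp zero {p} {s} 0≤p e = subst (1ℚ ≤exp_) (sym (ℚ.*-zeroˡ s)) (1+-≤exp (ℚ.nonNegative⁻¹ 1ℚ))
  ^-≤exp (suc n) {p} {s} 0≤p e = subst (p ^ suc n ≤exp_)
    (trans (solve 2 (λ a s → s :+ a :* s := (con 1ℚ :+ a) :* s) refl (ι n) s) (cong (_* s) (sym (ι-homo-+ 1 n))))
    (*-≤exp (^-nonNeg n 0≤p) e (^-≤exp n 0≤p e))

  ≤exp-neg⇒<1 : ∀ {p s} → p ≤exp s → s < 0ℚ → p < 1ℚ
  ≤exp-neg⇒<1 {p} {s} (≤approx j b le) s<0 = ℚ.≤-<-trans le (approx<1 j s b s<0)

  -- With step h, y is the telescoping product of the factors 1 + h/(1 + ih), whose deviations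
  -- from 1 are the terms of the left Riemann sum.
  ≤exp-leftSum : ∀ N .{{_ : NonZero N}} {y} → 0ℚ < y → y ≤exp leftSum N y
  ≤exp-leftSum N {y} 0<y = subst (_≤exp leftSum N y) end (partial N ℕ.≤-refl)
    where
    h = (y - 1ℚ) * inv (ι N)
    end : 1ℚ + ι N * h ≡ y
    end = trans (solve 3 (λ n y w → con 1ℚ :+ n :* ((y :- con 1ℚ) :* w) := con 1ℚ :+ (y :- con 1ℚ) :* (n :* w)) refl (ι N) y (inv (ι N)))
            (trans (cong (λ t → 1ℚ + (y - 1ℚ) * t) (inv-inverse (ι-pos N))) (solve 1 (λ y → con 1ℚ :+ (y :- con 1ℚ) :* con 1ℚ := y) refl y))
    0<1⊓y : 0ℚ < 1ℚ ⊓ y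
    0<1⊓y with ℚ.⊓-sel 1ℚ y
    ... | inj₁ e = subst (0ℚ <_) (sym e) (ℚ.positive⁻¹ 1ℚ)
    ... | inj₂ e = subst (0ℚ <_) (sym e) 0<y
    node>0 : ∀ i → i ℕ.≤ N → 0ℚ < 1ℚ + ι i * h
    node>0 i i≤N = ℚ.<-≤-trans 0<1⊓y (base≥ N i i≤N (ℚ.p⊓q≤p 1ℚ y) (ℚ.p⊓q≤q 1ℚ y))
    ι-suc* : ∀ k → 1ℚ + ι (suc k) * h ≡ (1ℚ + ι k * h) + h
    ι-suc* k = trans (cong (λ t → 1ℚ + t * h) (ι-homo-+ 1 k)) (solve 2 (λ a h → con 1ℚ :+ (con 1ℚ :+ a) :* h := (con 1ℚ :+ a :* h) :+ h) refl (ι k) h)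
    partial : ∀ k → k ℕ.≤ N → 1ℚ + ι k * h ≤exp sumBelow k (λ i → h * inv (1ℚ + ι i * h))
    partial zero    _   = subst (_≤exp 0ℚ) (solve 1 (λ h → con 1ℚ :+ con 0ℚ := con 1ℚ :+ con 0ℚ :* h) refl h) (1+-≤exp (ℚ.nonNegative⁻¹ 1ℚ))
    partial (suc k) k<N = subst (_≤exp sumBelow (suc k) (λ i → h * inv (1ℚ + ι i * h))) (sym split)
      (*-≤exp 0≤f (partial k (ℕ.<⇒≤ k<N)) (1+-≤exp 0≤f))
      where
      x = 1ℚ + ι k * h
      0<x = node>0 k (ℕ.<⇒≤ k<N)
      x*f : x * (1ℚ + h * inv x) ≡ x + h
      x*f = trans (solve 3 (λ x h i → x :* (con 1ℚ :+ h :* i) := x :+ h :* (x :* i)) refl x h (inv x))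
              (trans (cong (λ t → x + h * t) (inv-inverse 0<x)) (cong (x +_) (ℚ.*-identityʳ h)))
      split : 1ℚ + ι (suc k) * h ≡ x * (1ℚ + h * inv x)
      split = trans (ι-suc* k) (sym x*f)
      -- The step h is negative when y < 1, so the factor is shown to be nonnegative as the quotient
      -- of two consecutive positive nodes.
      f≡ : 1ℚ + h * inv x ≡ (1ℚ + ι (suc k) * h) * inv x
      f≡ = begin-equality
        1ℚ + h * inv x                  ≡⟨ cong (_+ h * inv x) (inv-inverse 0<x) ⟨
        x * inv x + h * inv x           ≡⟨ ℚ.*-distribʳ-+ (inv x) x h ⟨
        (x + h) * inv x                 ≡⟨ cong (_* inv x) (ι-suc* k) ⟨
        (1ℚ + ι (suc k) * h) * inv x    ∎
      0≤f : 0ℚ ≤ 1ℚ + h * inv x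
      0≤f = subst (0ℚ ≤_) (sym f≡) (*-nonNeg (ℚ.<⇒≤ (node>0 (suc k) k<N)) (ℚ.<⇒≤ (inv-pos 0<x)))

  -- If the Riemann sum s were below t * z, then y(1 - z)^t would be at most exp (s - t * z), hence
  -- below 1.
  leftSum-lower : ∀ N .{{_ : NonZero N}} {y z} t → 0ℚ < y → z ≤ 1ℚ → 1ℚ ≤ y * (1ℚ - z) ^ t → ι t * z ≤ leftSum N y
  leftSum-lower N {y} {z} t 0<y z≤1 1≤ = ℚ.≮⇒≥ λ s<tz →
    <⇒≱ (≤exp-neg⇒<1 e (subst₂ _<_ refl (solve 2 (λ t z → t :* z :+ t :* :- z := con 0ℚ) refl (ι t) z) (ℚ.+-monoˡ-< (ι t * - z) s<tz))) 1≤
    where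
    0≤1-z = ≤⇒0≤ z≤1
    e : y * (1ℚ - z) ^ t ≤exp leftSum N y + ι t * - z
    e = *-≤exp (^-nonNeg t 0≤1-z) (≤exp-leftSum N 0<y) (^-≤exp t 0≤1-z (1+-≤exp 0≤1-z))

  ι-homo-^ : ∀ m n → ι (m ℕ.^ n) ≡ ι m ^ n
  ι-homo-^ m zero    = refl
  ι-homo-^ m (suc n) = trans (ι-homo-* m (m ℕ.^ n)) (cong (ι m *_) (ι-homo-^ m n))

  ι-cancel-< : ∀ {m n} → ι m < ι n → m ℕ.< n
  ι-cancel-< lt = ℕ.≰⇒> λ n≤m → <⇒≱ lt (ι-mono n≤m)

  ^-pos : ∀ {p} n → 0ℚ < p → 0ℚ < p ^ n
  ^-pos zero    0<p = ℚ.positive⁻¹ 1ℚ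
  ^-pos (suc n) 0<p = *-pos 0<p (^-pos n 0<p)

  *-cancelˡ-≤ : ∀ {p q r} → 0ℚ < r → r * p ≤ r * q → p ≤ q
  *-cancelˡ-≤ {r = r} 0<r = ℚ.*-cancelˡ-≤-pos r {{positive 0<r}}

  -- Clearing denominators turns a lower bound for powers of 1 + 1/q into a comparison of natural
  -- numbers, which can be decided by evaluation.
  compound-bound : ∀ K → let q = suc K in 8 ℕ.* q ℕ.^ K ℕ.≤ 3 ℕ.* suc q ℕ.^ K →
                   ι 8 ≤ ι 3 * (1ℚ + inv (ι q)) ^ K
  compound-bound K h = *-cancelˡ-≤ (^-pos K (ι-pos q)) (begin
    ι q ^ K * ι 8                 ≡⟨ ℚ.*-comm (ι q ^ K) (ι 8) ⟩
    ι 8 * ι q ^ K                 ≡⟨ cong (ι 8 *_) (ι-homo-^ q K) ⟨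
    ι 8 * ι (q ℕ.^ K)             ≡⟨ ι-homo-* 8 (q ℕ.^ K) ⟨
    ι (8 ℕ.* q ℕ.^ K)             ≤⟨ ι-mono h ⟩
    ι (3 ℕ.* suc q ℕ.^ K)         ≡⟨ ι-homo-* 3 (suc q ℕ.^ K) ⟩
    ι 3 * ι (suc q ℕ.^ K)         ≡⟨ cong (ι 3 *_) (ι-homo-^ (suc q) K) ⟩
    ι 3 * ι (suc q) ^ K           ≡⟨ cong (λ t → ι 3 * t ^ K) q*[1+1/q] ⟨
    ι 3 * (ι q * (1ℚ + w)) ^ K    ≡⟨ cong (ι 3 *_) (^-distrib-* (ι q) (1ℚ + w) K) ⟩
    ι 3 * (ι q ^ K * (1ℚ + w) ^ K) ≡⟨ solve 3 (λ a b c → a :* (b :* c) := b :* (a :* c)) refl (ι 3) (ι q ^ K) ((1ℚ + w) ^ K) ⟩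
    ι q ^ K * (ι 3 * (1ℚ + w) ^ K) ∎)
    where
    q = suc K
    w = inv (ι q)
    q*[1+1/q] : ι q * (1ℚ + w) ≡ ι (suc q)
    q*[1+1/q] = trans (ℚ.*-distribˡ-+ (ι q) 1ℚ w) (trans (cong₂ _+_ (ℚ.*-identityʳ (ι q)) (inv-inverse (ι-pos q)))
                  (trans (ℚ.+-comm (ι q) 1ℚ) (sym (ι-homo-+ 1 q))))

  -- n·exp(-n/a) ≤ 2/e for a = (p+1)/α, from n ≥ 2a log a: the factors a, n/2a, (1 - 1/(p+1))^(m+1)
  -- and (1 + 1/(K+1))^K ≥ 8/3 have total deviation below 0 from 1, so their product is below 1.
  survival-bound : ∀ {α} p m n K N .{{_ : NonZero N}} → 3 ℕ.≤ p → 0ℚ < α → α ≤ 1ℚ → α * ι n ≤ ι (suc m) →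
    8 ℕ.* suc K ℕ.^ K ℕ.≤ 3 ℕ.* suc (suc K) ℕ.^ K →
    let a = ι (suc p) * inv α in
    (1ℚ + 1ℚ) * a * leftSum N a ≤ ι n + inv (ι (suc K)) →
    n ℕ.* p ℕ.^ m ℕ.< suc p ℕ.^ m
  survival-bound {α} p m n K N 3≤p 0<α α≤1 αn≤m c≥8/3 large = ι-cancel-< (begin-strict
      ι (n ℕ.* p ℕ.^ m)       ≡⟨ trans (ι-homo-* n (p ℕ.^ m)) (cong (ι n *_) (ι-homo-^ p m)) ⟩
      ι n * ι p ^ m           ≡⟨ cong (λ t → ι n * t ^ m) Q*X ⟨
      ι n * (Q * X) ^ m       ≡⟨ cong (ι n *_) (^-distrib-* Q X m) ⟩
      ι n * (Q ^ m * X ^ m)   ≡⟨ solve 3 (λ n a b → n :* (a :* b) := a :* (n :* b)) refl (ι n) (Q ^ m) (X ^ m) ⟩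
      Q ^ m * (ι n * X ^ m)   <⟨ ℚ.*-monoʳ-<-pos (Q ^ m) {{positive (^-pos m 0<Q)}} small ⟩
      Q ^ m * 1ℚ              ≡⟨ trans (ℚ.*-identityʳ (Q ^ m)) (sym (ι-homo-^ (suc p) m)) ⟩
      ι (suc p ℕ.^ m)         ∎)
    where
    Q = ι (suc p)
    w = inv Q
    A = inv α
    a = Q * A
    s = leftSum N a
    δ = inv (ι (suc K))
    X = 1ℚ - w
    C = (1ℚ + δ) ^ K
    0<Q = ι-pos (suc p)
    0<w = inv-pos 0<Q
    0<δ = inv-pos (ι-pos (suc K))
    Qw≡1 = inv-inverse 0<Q
    αA≡1 = inv-inverse 0<α
    0<a = *-pos 0<Q (inv-pos 0<α)
    4w≤1 : ι 4 * w ≤ 1ℚ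
    4w≤1 = subst (ι 4 * w ≤_) Qw≡1 (*-mono (ℚ.<⇒≤ 0<Q) (ℚ.<⇒≤ 0<w) (ι-mono {4} {suc p} (ℕ.s≤s 3≤p)) ℚ.≤-refl)
    w≤1 : w ≤ 1ℚ
    w≤1 = subst (w ≤_) Qw≡1 (subst (_≤ Q * w) (ℚ.*-identityˡ w) (*-mono (ℚ.<⇒≤ 0<Q) (ℚ.<⇒≤ 0<w) (ι-mono {1} {suc p} (ℕ.s≤s ℕ.z≤n)) ℚ.≤-refl))
    0≤X = ≤⇒0≤ w≤1
    Q*X : Q * X ≡ ι p
    Q*X = trans (solve 2 (λ q w → q :* (con 1ℚ :- w) := q :- q :* w) refl Q w) (trans (cong₂ _-_ (ι-homo-+ 1 p) Qw≡1) (solve 1 (λ p → (con 1ℚ :+ p) :- con 1ℚ := p) refl (ι p)))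
    -- u = n/2a, so a * u = n/2; the bound u ≤ exp (u - 1) stands in for a logarithm of u.
    u = ½ * ι n * w * α
    0≤u : 0ℚ ≤ u
    0≤u = *-nonNeg (*-nonNeg (*-nonNeg (ℚ.nonNegative⁻¹ ½) (ι-nonNeg n)) (ℚ.<⇒≤ 0<w)) (ℚ.<⇒≤ 0<α)
    1+[u-1] : 1ℚ + (u - 1ℚ) ≡ u
    1+[u-1] = solve 1 (λ u → con 1ℚ :+ (u :- con 1ℚ) := u) refl u
    0≤1+δ = +-nonNeg (ℚ.nonNegative⁻¹ 1ℚ) (ℚ.<⇒≤ 0<δ)
    product : a * u * X ^ suc m * C ≤exp s + (u - 1ℚ) + ι (suc m) * - w + ι K * δ
    product = *-≤exp (^-nonNeg K 0≤1+δ)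
      (*-≤exp (^-nonNeg (suc m) 0≤X)
        (*-≤exp 0≤u (≤exp-leftSum N 0<a)
          (subst (_≤exp u - 1ℚ) 1+[u-1] (1+-≤exp (subst (0ℚ ≤_) (sym 1+[u-1]) 0≤u))))
        (^-≤exp (suc m) 0≤X (1+-≤exp 0≤X)))
      (^-≤exp K 0≤1+δ (1+-≤exp 0≤1+δ))
    ½wα = ½ * (w * α)
    s≤ : s ≤ ½wα * (ι n + δ)
    s≤ = begin
      s                            ≡⟨ ℚ.*-identityˡ s ⟨
      1ℚ * 1ℚ * s                  ≡⟨ cong₂ (λ x y → x * y * s) Qw≡1 αA≡1 ⟨
      Q * w * (α * A) * s          ≡⟨ solve 5 (λ Q w α A s → Q :* w :* (α :* A) :* s := con ½ :* (w :* α) :* ((con 1ℚ :+ con 1ℚ) :* (Q :* A) :* s)) refl Q w α A s ⟩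
      ½wα * ((1ℚ + 1ℚ) * a * s)    ≤⟨ *-monoˡ (*-nonNeg (ℚ.nonNegative⁻¹ ½) (*-nonNeg (ℚ.<⇒≤ 0<w) (ℚ.<⇒≤ 0<α))) large ⟩
      ½wα * (ι n + δ)              ∎
    ½wα<1 : ½wα < 1ℚ
    ½wα<1 = ℚ.≤-<-trans (*-monoˡ {r = ½} (ℚ.nonNegative⁻¹ ½) (*-mono (ℚ.nonNegative⁻¹ 1ℚ) (ℚ.<⇒≤ 0<α) w≤1 α≤1)) (ℚ.+-monoʳ-< ½ (ℚ.positive⁻¹ ½))
    -- The deviation is at most w(αn - (m + 1)) + δ(wα/2 - 1). The -1 belonging to u cancels against
    -- K * δ = 1 - δ, and the remaining -δ outweighs the tolerance δ of `large`, which enters with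
    -- the factor wα/2 < 1.
    deviation<0 : s + (u - 1ℚ) + ι (suc m) * - w + ι K * δ < 0ℚ
    deviation<0 = begin-strict
      s + (u - 1ℚ) + ι (suc m) * - w + ι K * δ
        ≡⟨ cong (λ t → s + (u - 1ℚ) + ι (suc m) * - w + t) Kδ ⟩
      s + (u - 1ℚ) + ι (suc m) * - w + (1ℚ - δ)
        ≡⟨ solve 6 (λ s n w α m δ →
             s :+ (con ½ :* n :* w :* α :- con 1ℚ) :+ m :* :- w :+ (con 1ℚ :- δ)
             := s :+ (con ½ :* (w :* α) :* n :- w :* m :- δ)) refl s (ι n) w α (ι (suc m)) δ ⟩
      s + (½wα * ι n - w * ι (suc m) - δ)
        ≤⟨ ℚ.+-monoˡ-≤ (½wα * ι n - w * ι (suc m) - δ) s≤ ⟩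
      ½wα * (ι n + δ) + (½wα * ι n - w * ι (suc m) - δ)
        ≡⟨ solve 5 (λ n w α m δ →
             con ½ :* (w :* α) :* (n :+ δ) :+ (con ½ :* (w :* α) :* n :- w :* m :- δ)
             := w :* (α :* n) :+ (con ½ :* (w :* α) :* δ :- w :* m :- δ)) refl (ι n) w α (ι (suc m)) δ ⟩
      w * (α * ι n) + (½wα * δ - w * ι (suc m) - δ)
        ≤⟨ ℚ.+-monoˡ-≤ (½wα * δ - w * ι (suc m) - δ) (*-monoˡ (ℚ.<⇒≤ 0<w) αn≤m) ⟩
      w * ι (suc m) + (½wα * δ - w * ι (suc m) - δ)
        ≡⟨ solve 3 (λ x y δ → x :+ (y :* δ :- x :- δ) := y :* δ :- con 1ℚ :* δ) refl (w * ι (suc m)) ½wα δ ⟩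
      ½wα * δ - 1ℚ * δ
        <⟨ ℚ.+-monoˡ-< (- (1ℚ * δ)) (ℚ.*-monoˡ-<-pos δ {{positive 0<δ}} ½wα<1) ⟩
      1ℚ * δ - 1ℚ * δ
        ≡⟨ ℚ.+-inverseʳ (1ℚ * δ) ⟩
      0ℚ ∎
      where
      Kδ : ι K * δ ≡ 1ℚ - δ
      Kδ = trans (solve 2 (λ k d → k :* d := (con 1ℚ :+ k) :* d :- d) refl (ι K) δ)
             (cong (_- δ) (trans (cong (_* δ) (sym (ι-homo-+ 1 K))) (inv-inverse (ι-pos (suc K)))))
    -- X ≥ 3/4 because p ≥ 3, and C ≥ 8/3. The resulting 2 cancels the ½ in a * u, and the X used
    -- here lowers the exponent from m + 1 to m.
    2≤XC : 1ℚ + 1ℚ ≤ X * C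
    2≤XC = *-cancelˡ-≤ (ι-pos 12) (begin
      ι 12 * (1ℚ + 1ℚ)        ≡⟨⟩
      ι 3 * ι 8               ≤⟨ *-mono {ι 3} {ι 4 * X} {ι 8} {ι 3 * C} (*-nonNeg (ι-nonNeg 4) 0≤X) (ι-nonNeg 8) 3≤4X (compound-bound K c≥8/3) ⟩
      (ι 4 * X) * (ι 3 * C)   ≡⟨ solve 2 (λ x c → (con (ι 4) :* x) :* (con (ι 3) :* c) := con (ι 12) :* (x :* c)) refl X C ⟩
      ι 12 * (X * C)          ∎)
      where
      3≤4X : ι 3 ≤ ι 4 * X
      3≤4X = 0≤⇒≤ (subst (0ℚ ≤_) (solve 1 (λ w → con 1ℚ :- con (ι 4) :* w := con (ι 4) :* (con 1ℚ :- w) :- con (ι 3)) refl w) (≤⇒0≤ 4w≤1))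
    small : ι n * X ^ m < 1ℚ
    small = begin-strict
      ι n * X ^ m                              ≡⟨ solve 2 (λ n x → n :* x := con ½ :* (n :* x) :* (con 1ℚ :+ con 1ℚ)) refl (ι n) (X ^ m) ⟩
      ½ * (ι n * X ^ m) * (1ℚ + 1ℚ)            ≤⟨ *-monoˡ (*-nonNeg (ℚ.nonNegative⁻¹ ½) (*-nonNeg (ι-nonNeg n) (^-nonNeg m 0≤X))) 2≤XC ⟩
      ½ * (ι n * X ^ m) * (X * C)              ≡⟨ solve 4 (λ n y x c → con ½ :* (n :* y) :* (x :* c) := con 1ℚ :* con 1ℚ :* (con ½ :* n) :* (x :* y) :* c) refl (ι n) (X ^ m) X C ⟩
      1ℚ * 1ℚ * (½ * ι n) * (X * X ^ m) * C    ≡⟨ cong₂ (λ x y → x * y * (½ * ι n) * (X * X ^ m) * C) Qw≡1 αA≡1 ⟨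
      Q * w * (α * A) * (½ * ι n) * (X * X ^ m) * C ≡⟨ cong (λ t → t * (X * X ^ m) * C) (solve 5 (λ Q w α A n → Q :* w :* (α :* A) :* (con ½ :* n) := Q :* A :* (con ½ :* n :* w :* α)) refl Q w α A (ι n)) ⟩
      a * u * X ^ suc m * C                    <⟨ ≤exp-neg⇒<1 product deviation<0 ⟩
      1ℚ                                       ∎

-- From the parameters n, ε, α to integer thresholds

-- E j = j!·Σ_{i ≤ j} 1/i!, the size needed, in units of the additive loss, when j colours are still unused.
E : ℕ → ℕ
E zero    = 1
E (suc j) = suc j ℕ.* E j ℕ.+ 1

E-nonZero : ∀ j → NonZero (E j)
E-nonZero zero    = _
E-nonZero (suc j) = ℕ.>-nonZero (ℕ.m≤n+m 1 (suc j ℕ.* E j))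

4≤E : ∀ {j} → 2 ℕ.≤ j → 4 ℕ.≤ E j
4≤E {suc (suc zero)}    _ = ℕ.m≤m+n 4 1
4≤E {suc (suc (suc j))} _ = ℕ.≤-trans (4≤E {suc (suc j)} (ℕ.s≤s (ℕ.s≤s ℕ.z≤n)))
  (ℕ.≤-trans (ℕ.m≤n*m (E (suc (suc j))) (suc (suc (suc j)))) (ℕ.m≤m+n _ 1))
4≤E {suc zero} (ℕ.s≤s ())

divide-up : ∀ n d .{{_ : NonZero n}} .{{_ : NonZero d}} → ∃[ q ] q ℕ.* d ℕ.< n × n ℕ.≤ suc q ℕ.* d
divide-up (suc n) d = n ℕ./ d , ℕ.s≤s (ℕ.m/n*n≤m n d) , (begin-strict
    n                              ≡⟨ ℕ.m≡m%n+[m/n]*n n d ⟩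
    n ℕ.% d ℕ.+ n ℕ./ d ℕ.* d      <⟨ ℕ.+-monoˡ-< (n ℕ./ d ℕ.* d) (ℕ.m%n<n n d) ⟩
    d ℕ.+ n ℕ./ d ℕ.* d            ∎)
  where open ℕ.≤-Reasoning

module Thresholds where
  open import Data.Rational.Base hiding (NonZero)
  open import Data.Rational.Solver using (module +-*-Solver)
  open Rationals
  open Exponential
  open ℚ.≤-Reasoning
  open +-*-Solver

  E≡r!*expSum : ∀ r → ι (E r) ≡ ι (r !) * expSum (suc r)
  E≡r!*expSum zero    = refl
  E≡r!*expSum (suc r) = begin-equality
    ι (suc r ℕ.* E r ℕ.+ 1)                              ≡⟨ ι-homo-+ (suc r ℕ.* E r) 1 ⟩
    ι (suc r ℕ.* E r) + 1ℚ                               ≡⟨ cong (_+ 1ℚ) (ι-homo-* (suc r) (E r)) ⟩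
    ι (suc r) * ι (E r) + 1ℚ                             ≡⟨ cong₂ (λ x y → ι (suc r) * x + y) (E≡r!*expSum r) (sym (inv-inverse (!-pos (suc r)))) ⟩
    ι (suc r) * (ι (r !) * S) + ι (suc r !) * i          ≡⟨ cong (_+ ι (suc r !) * i) (trans (sym (ℚ.*-assoc (ι (suc r)) (ι (r !)) S)) (cong (_* S) (sym (ι-homo-* (suc r) (r !))))) ⟩
    ι (suc r !) * S + ι (suc r !) * i                    ≡⟨ ℚ.*-distribˡ-+ (ι (suc r !)) S i ⟨
    ι (suc r !) * (S + i)                                ∎
    where
    S = expSum (suc r)
    i = inv (ι (suc r !))

  -- E r + r!/(r+1)! is r! times the partial sum of e with one term more than in E r. So from index
  -- r + 1 on, n/(e·r!) lies below n/E r by at least this positive amount, which serves as the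
  -- tolerance for the minimum degree.
  slack : ℕ → ℕ → ℚ
  slack n r = ι n * (inv (ι (E r)) - inv (ι (E r) + ι (r !) * inv (ι (suc r !))))

  private
    excess : ℕ → ℚ
    excess r = ι (r !) * inv (ι (suc r !))
    excess>0 : ∀ r → 0ℚ < excess r
    excess>0 r = *-pos (!-pos r) (inv-pos (!-pos (suc r)))
    E>0 : ∀ r → 0ℚ < ι (E r)
    E>0 r = ι-pos (E r) {{E-nonZero r}}

  slack>0 : ∀ n r .{{_ : NonZero n}} → 0ℚ < slack n r
  slack>0 n r = *-pos (ι-pos n) (subst (0ℚ <_) (sym (trans (inv-sub (E>0 r) 0<E+x) (cong (_* (inv (ι (E r)) * inv (ι (E r) + excess r))) (solve 2 (λ a b → (a :+ b) :- a := b) refl (ι (E r)) (excess r)))))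
      (*-pos (excess>0 r) (*-pos (inv-pos (E>0 r)) (inv-pos 0<E+x))))
    where
    0<E+x : 0ℚ < ι (E r) + excess r
    0<E+x = ℚ.+-mono-< (E>0 r) (excess>0 r)

  E+excess≤ : ∀ r {i} → suc r ℕ.≤ i → ι (E r) + excess r ≤ expSum (suc i) * ι (r !)
  E+excess≤ r {i} r<i = begin
    ι (E r) + excess r                                        ≡⟨ cong (_+ excess r) (E≡r!*expSum r) ⟩
    ι (r !) * expSum (suc r) + ι (r !) * inv (ι (suc r !))    ≡⟨ ℚ.*-distribˡ-+ (ι (r !)) (expSum (suc r)) (inv (ι (suc r !))) ⟨
    ι (r !) * expSum (suc (suc r))                            ≤⟨ *-monoˡ {expSum (suc (suc r))} {expSum (suc i)} {ι (r !)} (ι-nonNeg (r !)) mono ⟩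
    ι (r !) * expSum (suc i)                                  ≡⟨ ℚ.*-comm (ι (r !)) (expSum (suc i)) ⟩
    expSum (suc i) * ι (r !)                                  ∎
    where
    mono : expSum (suc (suc r)) ≤ expSum (suc i)
    mono = subst (λ l → expSum (suc (suc r)) ≤ expSum l) (ℕ.m∸n+n≡m (ℕ.s≤s r<i)) (expSum-mono (suc i ℕ.∸ suc (suc r)) (suc (suc r)))

  -- n/(e·r!) is at most q minus the slack, while εn is at least n - d minus the slack. The slack
  -- cancels in the difference, so an approximate degree bound gives an exact inequality.
  αn≤ : ∀ r n d q i {ε} .{{_ : NonZero n}} → suc r ℕ.≤ i → d ℕ.≤ n → n ℕ.≤ q ℕ.* E r →
        (1ℚ - ε) * ι n ≤ ι d + slack n r →
        (ι 1 * inv (expSum (suc i) * ι (r !)) - ε) * ι n ≤ ι (q ℕ.∸ (n ℕ.∸ d))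
  αn≤ r n d q i {ε} r<i d≤n n≤qE deg = 0≤⇒≤ (subst (0ℚ ≤_) rearrange (≤⇒0≤ total))
    where
    b = n ℕ.∸ d
    m = q ℕ.∸ b
    x = ι (E r) + excess r
    w = inv (expSum (suc i) * ι (r !))
    0<x : 0ℚ < x
    0<x = ℚ.+-mono-< (E>0 r) (excess>0 r)
    n≡ : ι n ≡ ι b + ι d
    n≡ = trans (cong ι (sym (ℕ.m∸n+n≡m d≤n))) (ι-homo-+ b d)
    q≤ : ι q ≤ ι b + ι m
    q≤ = ℚ.≤-trans (ι-mono (ℕ.m≤n+m∸n q b)) (ℚ.≤-reflexive (ι-homo-+ b m))
    n/E≤q : ι n * inv (ι (E r)) ≤ ι q
    n/E≤q = begin
      ι n * inv (ι (E r))               ≤⟨ *-mono (*-nonNeg (ι-nonNeg q) (ι-nonNeg (E r))) (ℚ.<⇒≤ (inv-pos (E>0 r))) (ℚ.≤-trans (ι-mono n≤qE) (ℚ.≤-reflexive (ι-homo-* q (E r)))) ℚ.≤-refl ⟩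
      ι q * ι (E r) * inv (ι (E r))     ≡⟨ ℚ.*-assoc (ι q) (ι (E r)) (inv (ι (E r))) ⟩
      ι q * (ι (E r) * inv (ι (E r)))   ≡⟨ cong (ι q *_) (inv-inverse (E>0 r)) ⟩
      ι q * 1ℚ                          ≡⟨ ℚ.*-identityʳ (ι q) ⟩
      ι q                               ∎
    total : ι n * w + ((1ℚ - ε) * ι n) ≤ ι b + ι m + ι d
    total = begin
      ι n * w + (1ℚ - ε) * ι n
        ≤⟨ ℚ.+-mono-≤ (*-monoˡ (ι-nonNeg n) (inv-anti 0<x (E+excess≤ r r<i))) deg ⟩
      ι n * inv x + (ι d + slack n r)
        ≡⟨ solve 4 (λ n y d z → n :* y :+ (d :+ n :* (z :- y)) := n :* z :+ d) refl (ι n) (inv x) (ι d) (inv (ι (E r))) ⟩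
      ι n * inv (ι (E r)) + ι d
        ≤⟨ ℚ.+-monoˡ-≤ (ι d) (ℚ.≤-trans n/E≤q q≤) ⟩
      ι b + ι m + ι d ∎
    rearrange : ι b + ι m + ι d - (ι n * w + ((1ℚ - ε) * ι n)) ≡ ι m - (ι 1 * w - ε) * ι n
    rearrange = trans (solve 6 (λ b m d n w ε → b :+ m :+ d :- (n :* w :+ (con 1ℚ :- ε) :* n) := (b :+ d) :+ (m :- n :- (w :- ε) :* n)) refl (ι b) (ι m) (ι d) (ι n) w ε)
      (trans (cong (_+ (ι m - ι n - (w - ε) * ι n)) (sym n≡))
        (solve 4 (λ m n w ε → n :+ (m :- n :- (w :- ε) :* n) := m :- (con 1ℚ :* w :- ε) :* n) refl (ι m) (ι n) w ε))

  α≤¼ : ∀ r i {ε} → 2 ℕ.≤ r → suc r ℕ.≤ i → 0ℚ ≤ ε → ι 1 * inv (expSum (suc i) * ι (r !)) - ε ≤ inv (ι 4)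
  α≤¼ r i {ε} 2≤r r<i 0≤ε = begin
    ι 1 * w - ε         ≤⟨ ℚ.+-monoʳ-≤ (ι 1 * w) (ℚ.neg-antimono-≤ 0≤ε) ⟩
    ι 1 * w + - 0ℚ      ≡⟨ solve 1 (λ w → con 1ℚ :* w :+ :- con 0ℚ := w) refl w ⟩
    w                   ≤⟨ inv-anti (ι-pos 4) (ℚ.≤-trans (ι-mono (4≤E 2≤r)) (ℚ.≤-trans (p≤p+q (ℚ.<⇒≤ (excess>0 r))) (E+excess≤ r r<i))) ⟩
    inv (ι 4)           ∎
    where w = inv (expSum (suc i) * ι (r !))

  -- 1 - m/l is the factor by which one greedy step shrinks the undominated set.
  greedy-steps-bound : ∀ {α} N .{{_ : NonZero N}} n l m t → 0ℚ < α → α ≤ inv (ι 4) → α * ι n ≤ ι m →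
    m ℕ.≤ l → 2 ℕ.≤ l → l ℕ.≤ n → l ℕ.^ t ℕ.≤ n ℕ.* (l ℕ.∸ m) ℕ.^ t →
    ι (2 ℕ.+ t) ≤ ι 2 * inv α * leftSum N (ι n)
  greedy-steps-bound {α} N n l m t 0<α α≤¼ αn≤m m≤l 2≤l l≤n steps = begin
      ι (2 ℕ.+ t)                          ≡⟨ ℚ.*-identityʳ (ι (2 ℕ.+ t)) ⟨
      ι (2 ℕ.+ t) * 1ℚ                     ≡⟨ cong₂ _*_ (ι-homo-+ 2 t) (sym (inv-inverse 0<α)) ⟩
      (ι 2 + ι t) * (α * A)                ≡⟨ solve 3 (λ t α A → (con (ι 2) :+ t) :* (α :* A) := A :* (con (ι 2) :* α :+ t :* α)) refl (ι t) α A ⟩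
      A * (ι 2 * α + ι t * α)              ≤⟨ *-monoˡ (ℚ.<⇒≤ (inv-pos 0<α)) (ℚ.+-mono-≤ 2α≤S tα≤S) ⟩
      A * (S + S)                          ≡⟨ solve 2 (λ A S → A :* (S :+ S) := con (ι 2) :* A :* S) refl A S ⟩
      ι 2 * A * S                          ∎
    where
    A = inv α
    S = leftSum N (ι n)
    instance
      l≢0 : NonZero l
      l≢0 = ℕ.>-nonZero (ℕ.≤-trans (ℕ.s≤s ℕ.z≤n) 2≤l)
      n≢0 : NonZero n
      n≢0 = ℕ.>-nonZero (ℕ.≤-trans (ℕ.s≤s ℕ.z≤n) (ℕ.≤-trans 2≤l l≤n))
    0<l = ι-pos l
    y = inv (ι l)
    z = ι m * y
    0≤y = ℚ.<⇒≤ (inv-pos 0<l)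
    z≤1 : z ≤ 1ℚ
    z≤1 = subst (z ≤_) (inv-inverse 0<l) (*-mono (ι-nonNeg l) 0≤y (ι-mono m≤l) ℚ.≤-refl)
    l[1-z] : ι l * (1ℚ - z) ≡ ι (l ℕ.∸ m)
    l[1-z] = begin-equality
      ι l * (1ℚ - ι m * y)                   ≡⟨ solve 3 (λ l m y → l :* (con 1ℚ :- m :* y) := l :- m :* (l :* y)) refl (ι l) (ι m) y ⟩
      ι l - ι m * (ι l * y)                  ≡⟨ cong (λ u → ι l - ι m * u) (inv-inverse 0<l) ⟩
      ι l - ι m * 1ℚ                         ≡⟨ cong (λ u → ι u - ι m * 1ℚ) (ℕ.m∸n+n≡m m≤l) ⟨
      ι (l ℕ.∸ m ℕ.+ m) - ι m * 1ℚ           ≡⟨ cong (_- ι m * 1ℚ) (ι-homo-+ (l ℕ.∸ m) m) ⟩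
      ι (l ℕ.∸ m) + ι m - ι m * 1ℚ           ≡⟨ solve 2 (λ a m → a :+ m :- m :* con 1ℚ := a) refl (ι (l ℕ.∸ m)) (ι m) ⟩
      ι (l ℕ.∸ m)                            ∎
    1≤ : 1ℚ ≤ ι n * (1ℚ - z) ^ t
    1≤ = *-cancelˡ-≤ (^-pos t 0<l) (begin
      ι l ^ t * 1ℚ                           ≡⟨ trans (ℚ.*-identityʳ (ι l ^ t)) (sym (ι-homo-^ l t)) ⟩
      ι (l ℕ.^ t)                            ≤⟨ ι-mono steps ⟩
      ι (n ℕ.* (l ℕ.∸ m) ℕ.^ t)              ≡⟨ trans (ι-homo-* n ((l ℕ.∸ m) ℕ.^ t)) (cong (ι n *_) (ι-homo-^ (l ℕ.∸ m) t)) ⟩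
      ι n * ι (l ℕ.∸ m) ^ t                  ≡⟨ cong (λ u → ι n * u ^ t) l[1-z] ⟨
      ι n * (ι l * (1ℚ - z)) ^ t             ≡⟨ cong (ι n *_) (^-distrib-* (ι l) (1ℚ - z) t) ⟩
      ι n * (ι l ^ t * (1ℚ - z) ^ t)         ≡⟨ solve 3 (λ n a b → n :* (a :* b) := a :* (n :* b)) refl (ι n) (ι l ^ t) ((1ℚ - z) ^ t) ⟩
      ι l ^ t * (ι n * (1ℚ - z) ^ t)         ∎)
    α≤z : α ≤ z
    α≤z = begin
      α                   ≡⟨ ℚ.*-identityʳ α ⟨
      α * 1ℚ              ≡⟨ cong (α *_) (inv-inverse 0<l) ⟨
      α * (ι l * y)       ≡⟨ ℚ.*-assoc α (ι l) y ⟨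
      α * ι l * y         ≤⟨ *-mono (ι-nonNeg m) 0≤y (ℚ.≤-trans (*-monoˡ (ℚ.<⇒≤ 0<α) (ι-mono l≤n)) αn≤m) ℚ.≤-refl ⟩
      ι m * y             ∎
    tα≤S : ι t * α ≤ S
    tα≤S = ℚ.≤-trans (*-monoˡ (ι-nonNeg t) α≤z) (leftSum-lower N t (ι-pos n) z≤1 1≤)
    1≤n/2 : 1ℚ ≤ ι n * (1ℚ - ½) ^ 1
    1≤n/2 = *-mono {ι 2} {ι n} {½} {½} (ι-nonNeg n) (ℚ.nonNegative⁻¹ ½) (ι-mono (ℕ.≤-trans 2≤l l≤n)) ℚ.≤-refl
    -- The sum S is spent twice, which gives the factor 2 in (2/α) log n: once for the t steps, once
    -- for the two further vertices. For the latter 2α ≤ 1/2, and n ≥ 2 gives S ≥ 1/2 by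
    -- `leftSum-lower` with t = 1 and z = ½.
    2α≤S : ι 2 * α ≤ S
    2α≤S = ℚ.≤-trans (*-monoˡ {α} {inv (ι 4)} {ι 2} (ι-nonNeg 2) α≤¼) (leftSum-lower N 1 (ι-pos n) (ℚ.<⇒≤ (ℚ.+-monoʳ-< ½ (ℚ.positive⁻¹ ½))) 1≤n/2)

-- Sizes and averages over Boolean subsets

module Counting where
  open import Algebra.Properties.CommutativeMonoid.Sum ℕ.+-0-commutativeMonoid public
    using (sum; sum-cong-≗; ∑-distrib-+; ∑-comm)
  open import Algebra.Properties.Semiring.Sum ℕ.+-*-semiring public
    using (*-distribˡ-sum; *-distribʳ-sum)
  open import Data.Nat.Base
  open ℕ.≤-Reasoning

  ⟦_⟧ : Bool → ℕ
  ⟦ true  ⟧ = 1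
  ⟦ false ⟧ = 0

  size : ∀ {n} → (Fin n → Bool) → ℕ
  size A = sum (λ u → ⟦ A u ⟧)

  ⟦∧⟧ : ∀ a b → ⟦ a ∧ b ⟧ ≡ ⟦ a ⟧ * ⟦ b ⟧
  ⟦∧⟧ true  b = sym (ℕ.*-identityˡ ⟦ b ⟧)
  ⟦∧⟧ false b = refl

  ⟦⟧-split : ∀ a b → ⟦ a ∧ not b ⟧ + ⟦ a ∧ b ⟧ ≡ ⟦ a ⟧
  ⟦⟧-split true  true  = refl
  ⟦⟧-split true  false = refl
  ⟦⟧-split false b     = refl

  sum-mono : ∀ {n} {f g : Fin n → ℕ} → (∀ i → f i ≤ g i) → sum f ≤ sum g
  sum-mono {zero}  h = z≤n
  sum-mono {suc n} h = ℕ.+-mono-≤ (h zero) (sum-mono (h ∘ suc))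

  term≤sum : ∀ {n} (f : Fin n → ℕ) i → f i ≤ sum f
  term≤sum f zero    = ℕ.m≤m+n (f zero) _
  term≤sum f (suc i) = ℕ.≤-trans (term≤sum (f ∘ suc) i) (ℕ.m≤n+m _ (f zero))

  sum-const : ∀ n c → sum {n} (λ _ → c) ≡ n * c
  sum-const zero    c = refl
  sum-const (suc n) c = cong (c +_) (sum-const n c)

  size-⊤ : ∀ n → size {n} (λ _ → true) ≡ n
  size-⊤ n = trans (sum-const n 1) (ℕ.*-identityʳ n)

  size≤n : ∀ {n} (A : Fin n → Bool) → size A ≤ n
  size≤n {n} A = ℕ.≤-trans (sum-mono (λ i → ⟦⟧≤1 (A i))) (ℕ.≤-reflexive (size-⊤ n))
    where
    ⟦⟧≤1 : ∀ b → ⟦ b ⟧ ≤ 1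
    ⟦⟧≤1 true  = ℕ.≤-refl
    ⟦⟧≤1 false = z≤n

  size-mono : ∀ {n} {A B : Fin n → Bool} → (∀ u → A u ≡ true → B u ≡ true) → size A ≤ size B
  size-mono {A = A} {B} h = sum-mono (λ u → le u (A u) refl)
    where
    le : ∀ u a → A u ≡ a → ⟦ A u ⟧ ≤ ⟦ B u ⟧
    le u true  e rewrite h u e | e = ℕ.≤-refl
    le u false e rewrite e = z≤n

  member⇒size : ∀ {n} (A : Fin n → Bool) u → A u ≡ true → 1 ≤ size A
  member⇒size A u e = ℕ.≤-trans (ℕ.≤-reflexive (cong ⟦_⟧ (sym e))) (term≤sum (λ i → ⟦ A i ⟧) u)

  size⇒member : ∀ {n} (A : Fin n → Bool) → 1 ≤ size A → ∃[ u ] A u ≡ true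
  size⇒member {suc n} A 1≤ with A zero in e
  ... | true  = zero , e
  ... | false with size⇒member (A ∘ suc) 1≤
  ...   | u , Au = suc u , Au

  empty-weighted : ∀ {n} (A : Fin n → Bool) (f : Fin n → ℕ) → size A ≡ 0 → sum (λ u → ⟦ A u ⟧ * f u) ≡ 0
  empty-weighted {zero}  A f e = refl
  empty-weighted {suc n} A f e with A zero
  ... | false = empty-weighted (A ∘ suc) (f ∘ suc) e

  average : ∀ {n} (A : Fin n → Bool) (f : Fin n → ℕ) → 1 ≤ size A →
            ∃[ u ] A u ≡ true × sum (λ u → ⟦ A u ⟧ * f u) ≤ size A * f u
  average {suc n} A f 1≤ with A zero in e₀
  ... | false with average (A ∘ suc) (f ∘ suc) 1≤
  ...   | u , Au , le = suc u , Au , le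
  average {suc n} A f 1≤ | true with size (A ∘ suc) in e
  ... | zero = zero , e₀ , ℕ.≤-reflexive (trans (cong (f zero + 0 +_) (empty-weighted (A ∘ suc) (f ∘ suc) e)) (ℕ.+-identityʳ (f zero + 0)))
  ... | suc s with average (A ∘ suc) (f ∘ suc) (ℕ.≤-trans (s≤s z≤n) (ℕ.≤-reflexive (sym e)))
  ...   | u , Au , le with ℕ.≤-total (f zero) (f (suc u))
  ...     | inj₁ f₀≤ = suc u , Au , ℕ.+-mono-≤ (ℕ.≤-trans (ℕ.≤-reflexive (ℕ.*-identityˡ (f zero))) f₀≤) (subst (λ s → sum (λ u → ⟦ A (suc u) ⟧ * f (suc u)) ≤ s * f (suc u)) e le)
  ...     | inj₂ ≤f₀ = zero , e₀ , ℕ.+-mono-≤ (ℕ.≤-reflexive (ℕ.*-identityˡ (f zero))) (ℕ.≤-trans (subst (λ s → sum (λ u → ⟦ A (suc u) ⟧ * f (suc u)) ≤ s * f (suc u)) e le) (ℕ.*-monoʳ-≤ (suc s) ≤f₀))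

  size-remove : ∀ {n} (A B : Fin n → Bool) → size (λ u → A u ∧ not (B u)) + size (λ u → A u ∧ B u) ≡ size A
  size-remove A B = trans (sym (∑-distrib-+ (λ u → ⟦ A u ∧ not (B u) ⟧) (λ u → ⟦ A u ∧ B u ⟧))) (sum-cong-≗ (λ u → ⟦⟧-split (A u) (B u)))

  ∧-true : ∀ {a b} → a ∧ b ≡ true → a ≡ true × b ≡ true
  ∧-true {true} {true} _ = refl , refl

  size-point : ∀ {n} (A : Fin n → Bool) x → A x ≡ true → size (λ u → A u ∧ does (x Fin.≟ u)) ≡ 1
  size-point {suc n} A zero Ax rewrite Ax = cong (1 +_) (trans (sum-cong-≗ (λ u → cong ⟦_⟧ (Bool.∧-zeroʳ (A (suc u))))) (trans (sum-const n 0) (ℕ.*-zeroʳ n)))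
  size-point {suc n} A (suc x) Ax rewrite Bool.∧-zeroʳ (A zero) = size-point (A ∘ suc) x Ax

-- Stars in distinct colours on a common set without poor vertices

module Stars {n r : ℕ} (col : Fin n → Fin n → Maybe (Fin r)) where
  open Counting
  open import Data.Nat.Base
  open ℕ.≤-Reasoning

  none : Maybe (Fin r) → ℕ
  none nothing  = 1
  none (just _) = 0

  is : Maybe (Fin r) → Fin r → Bool
  is nothing  c = false
  is (just d) c = does (d Fin.≟ c)

  is⇒≡ : ∀ {x c} → is x c ≡ true → x ≡ just c
  is⇒≡ {just d} {c} e with d Fin.≟ c
  ... | yes refl = refl

  is-refl : ∀ c → is (just c) c ≡ true
  is-refl c with c Fin.≟ c
  ... | yes _ = refl
  ... | no c≢c = contradiction refl c≢c

  hit : ∀ {k} → (Fin k → Fin r) → (Fin n → Bool) → Fin n → Fin n → Fin k → Bool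
  hit hue A v u i = A u ∧ is (col v u) (hue i)

  hits : ∀ {k} → (Fin k → Fin r) → (Fin n → Bool) → Fin n → Fin n → Bool
  hits hue A v u = does (Fin.any? (λ i → hit hue A v u i Bool.≟ true))

  hits-elim : ∀ {k} {hue : Fin k → Fin r} {A v u} → hits hue A v u ≡ true → ∃[ i ] hit hue A v u i ≡ true
  hits-elim {hue = hue} {A} {v} {u} e with Fin.any? (λ i → hit hue A v u i Bool.≟ true)
  ... | yes p = p

  module _ (b m : ℕ) where

    record StarSystem : Set where
      field
        {k j}         : ℕ
        k+j≡r         : k + j ≡ r
        hue           : Fin k → Fin r
        hue-injective : Injective _≡_ _≡_ hue
        centre        : Fin k → Fin n
        A             : Fin n → Bool
        star          : ∀ i {u} → A u ≡ true → col (centre i) u ≡ just (hue i)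
        large         : b + m < size A
        rich          : ∀ v → suc m ≤ size (hits hue A v)

    record Stage (j : ℕ) : Set where
      field
        {k}           : ℕ
        k+j≡r         : k + j ≡ r
        hue           : Fin k → Fin r
        hue-injective : Injective _≡_ _≡_ hue
        centre        : Fin k → Fin n
        unused        : Fin r → Bool
        unused-size   : size unused ≡ j
        unused⇒≢      : ∀ {c} → unused c ≡ true → ∀ i → hue i ≢ c
        used⇒∃        : ∀ {c} → unused c ≡ false → ∃[ i ] hue i ≡ c
        A             : Fin n → Bool
        star          : ∀ i {u} → A u ≡ true → col (centre i) u ≡ just (hue i)
        large         : (b + m) * E j < size A

    module _ (none≤b : ∀ v → sum (λ u → none (col v u)) ≤ b) where

      module Extend {j} (S : Stage j) (v : Fin n) where
        open Stage S

        fresh : Fin r → Fin n → Bool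
        fresh c u = A u ∧ is (col v u) c

        split : ∀ u → ⟦ A u ⟧ ≤ none (col v u) + ⟦ hits hue A v u ⟧ + sum (λ c → ⟦ unused c ⟧ * ⟦ fresh c u ⟧)
        split u with A u in eA | col v u in ec
        ... | false | _ = z≤n
        ... | true  | nothing = s≤s z≤n
        ... | true  | just d with unused d in ed
        ...   | true  = ℕ.m≤n⇒m≤o+n ⟦ hits′ ⟧
                  (ℕ.≤-trans (ℕ.≤-reflexive (sym (cong₂ (λ x y → ⟦ x ⟧ * ⟦ y ⟧) ed (is-refl d)))) (term≤sum (λ c → ⟦ unused c ⟧ * ⟦ is (just d) c ⟧) d))
          where hits′ = does (Fin.any? (λ i → is (just d) (hue i) Bool.≟ true))
        ...   | false with used⇒∃ ed
        ...     | i , refl with Fin.any? (λ i′ → is (just (hue i)) (hue i′) Bool.≟ true)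
        ...       | yes _ = s≤s z≤n
        ...       | no ¬p = contradiction (i , is-refl (hue i)) ¬p

        total : size A ≤ b + size (hits hue A v) + sum (λ c → ⟦ unused c ⟧ * size (fresh c))
        total = begin
          size A
            ≤⟨ sum-mono split ⟩
          sum (λ u → none (col v u) + ⟦ hits hue A v u ⟧ + sum (λ c → ⟦ unused c ⟧ * ⟦ fresh c u ⟧))
            ≡⟨ trans (∑-distrib-+ (λ u → none (col v u) + ⟦ hits hue A v u ⟧) _) (cong₂ _+_ (∑-distrib-+ (λ u → none (col v u)) _) swap) ⟩
          sum (λ u → none (col v u)) + size (hits hue A v) + sum (λ c → ⟦ unused c ⟧ * size (fresh c))
            ≤⟨ ℕ.+-monoˡ-≤ _ (ℕ.+-monoˡ-≤ _ (none≤b v)) ⟩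
          b + size (hits hue A v) + sum (λ c → ⟦ unused c ⟧ * size (fresh c)) ∎
          where
          swap : sum (λ u → sum (λ c → ⟦ unused c ⟧ * ⟦ fresh c u ⟧)) ≡ sum (λ c → ⟦ unused c ⟧ * size (fresh c))
          swap = trans (∑-comm (λ u c → ⟦ unused c ⟧ * ⟦ fresh c u ⟧)) (sum-cong-≗ (λ c → sym (*-distribˡ-sum ⟦ unused c ⟧ (λ u → ⟦ fresh c u ⟧))))

      -- With j = 0 every edge from v to A has a used colour, so a poor v would force |A| ≤ b + m,
      -- against `large`. This is what stops the growth at r stars.
      extend : ∀ {j} (S : Stage j) v → size (hits (Stage.hue S) (Stage.A S) v) ≤ m →
               ∃[ i ] j ≡ suc i × Stage i
      extend {zero} S v poor = contradiction (begin-strict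
          size A         ≤⟨ total ⟩
          b + size (hits hue A v) + sum (λ c → ⟦ unused c ⟧ * size (fresh c))
            ≤⟨ ℕ.+-mono-≤ (ℕ.+-monoʳ-≤ b poor) (ℕ.≤-reflexive (empty-weighted unused (size ∘ fresh) unused-size)) ⟩
          b + m + 0      ≡⟨ trans (ℕ.+-identityʳ (b + m)) (sym (ℕ.*-identityʳ (b + m))) ⟩
          (b + m) * 1    <⟨ large ⟩
          size A         ∎) (ℕ.<-irrefl refl)
        where
        open Stage S
        open Extend S v
      extend {suc j} S v poor = j , refl , record
          { k+j≡r = trans (sym (ℕ.+-suc k j)) k+j≡r
          ; hue = hue′
          ; hue-injective = hue′-injective
          ; centre = λ { zero → v ; (suc i) → centre i }
          ; unused = unused′
          ; unused-size = ℕ.suc-injective (trans (trans (ℕ.+-comm 1 (size unused′)) (trans (cong (size unused′ +_) (sym (size-point unused c c-unused))) (size-remove unused (λ d → does (c Fin.≟ d))))) unused-size)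
          ; unused⇒≢ = λ {d} e → unused′⇒≢ d e
          ; used⇒∃ = λ {d} e → used′⇒∃ d e
          ; A = fresh c
          ; star = λ { zero e → is⇒≡ (proj₂ (∧-true {A _} e)) ; (suc i) e → star i (proj₁ (∧-true {A _} e)) }
          ; large = ℕ.*-cancelˡ-< (suc j) _ _ (ℕ.+-cancelˡ-< (b + m) _ _ (begin-strict
              b + m + suc j * ((b + m) * E j)   ≡⟨ expand (b + m) (suc j) (E j) ⟩
              (b + m) * (suc j * E j + 1)       <⟨ large ⟩
              size A                            ≤⟨ total ⟩
              b + size (hits hue A v) + sum (λ c → ⟦ unused c ⟧ * size (fresh c)) ≤⟨ ℕ.+-mono-≤ (ℕ.+-monoʳ-≤ b poor) heavy ⟩
              b + m + suc j * size (fresh c)    ∎))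
          }
        where
        open Stage S
        open Extend S v
        expand : ∀ s j e → s + j * (s * e) ≡ s * (j * e + 1)
        expand = solve-∀
        choice = average unused (size ∘ fresh) (ℕ.≤-trans (s≤s z≤n) (ℕ.≤-reflexive (sym unused-size)))
        c = proj₁ choice
        c-unused = proj₁ (proj₂ choice)
        unused′ : Fin r → Bool
        unused′ d = unused d ∧ not (does (c Fin.≟ d))
        heavy : sum (λ c → ⟦ unused c ⟧ * size (fresh c)) ≤ suc j * size (fresh c)
        heavy = subst (λ s → sum (λ c → ⟦ unused c ⟧ * size (fresh c)) ≤ s * size (fresh c)) unused-size (proj₂ (proj₂ choice))
        hue′ : Fin (suc k) → Fin r
        hue′ zero    = c
        hue′ (suc i) = hue i
        hue′-injective : Injective _≡_ _≡_ hue′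
        hue′-injective {zero}  {zero}   e = refl
        hue′-injective {zero}  {suc i}  e = contradiction (sym e) (unused⇒≢ c-unused i)
        hue′-injective {suc i} {zero}   e = contradiction e (unused⇒≢ c-unused i)
        hue′-injective {suc i} {suc i′} e = cong suc (hue-injective e)
        unused′⇒≢ : ∀ d → unused′ d ≡ true → ∀ i → hue′ i ≢ d
        unused′⇒≢ d e zero    c≡d with c Fin.≟ d
        ... | yes _  = contradiction (trans (sym (Bool.∧-zeroʳ (unused d))) e) λ ()
        ... | no c≢d = c≢d c≡d
        unused′⇒≢ d e (suc i) = unused⇒≢ (proj₁ (∧-true {unused d} e)) i
        used′⇒∃ : ∀ d → unused′ d ≡ false → ∃[ i ] hue′ i ≡ d
        used′⇒∃ d e with c Fin.≟ d
        ... | yes c≡d = zero , c≡d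
        ... | no _ with used⇒∃ {d} (trans (sym (Bool.∧-identityʳ (unused d))) e)
        ...   | i , hi = suc i , hi

      run : ∀ {j} → Stage j → StarSystem
      run {j} S with Fin.all? (λ v → suc m ℕ.≤? size (hits (Stage.hue S) (Stage.A S) v))
      ... | yes rich = record
        { Stage S hiding (unused; unused-size; unused⇒≢; used⇒∃; large)
        ; large = ℕ.≤-<-trans (ℕ.m≤m*n (b + m) (E j) {{E-nonZero j}}) (Stage.large S)
        ; rich = rich }
      ... | no ¬rich with Fin.¬∀⟶∃¬ n _ (λ v → suc m ℕ.≤? size (hits (Stage.hue S) (Stage.A S) v)) ¬rich
      ...   | v , poor with extend S v (ℕ.≤-pred (ℕ.≰⇒> poor))
      ...     | i , refl , S′ = run S′

      star-system : (b + m) * E r < n → StarSystem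
      star-system lt = run {r} record
        { k+j≡r = refl ; hue = λ () ; hue-injective = λ { {()} } ; centre = λ ()
        ; unused = λ _ → true ; unused-size = size-⊤ r ; unused⇒≢ = λ _ () ; used⇒∃ = λ ()
        ; A = λ _ → true ; star = λ () ; large = subst ((b + m) * E r <_) (sym (size-⊤ n)) lt }

open Counting

-- Dominating sets: greedy, and by conditional expectations

module Domination {n : ℕ} where
  open Counting
  open import Data.Nat.Base
  open ℕ.≤-Reasoning

  -- Greedy domination: each new vertex dominates at least the fraction m / size A of what is left.
  module Greedy (A : Fin n → Bool) (H : Fin n → Fin n → Bool) (m : ℕ) (1≤m : 1 ≤ m) (m≤A : m ≤ size A)
                (rich : ∀ v → m ≤ sum (λ u → ⟦ A u ⟧ * ⟦ H v u ⟧)) where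

    l = size A

    -- `progress` is |U|(1 - m/l)^steps ≥ 1 with denominators cleared: something was still
    -- undominated after `steps` choices. The choice that finishes is not among them, hence
    -- `suc steps` in `S-size`.
    record Dominating (U : Fin n → Bool) : Set where
      field
        S         : Fin n → Bool
        steps     : ℕ
        S-size    : size S ≤ suc steps
        dominates : ∀ v → U v ≡ true → ∃[ u ] S u ≡ true × H v u ≡ true
        progress  : l ^ steps ≤ size U * (l ∸ m) ^ steps

    double-count : ∀ U → size U * m ≤ sum (λ u → ⟦ A u ⟧ * size (λ v → U v ∧ H v u))
    double-count U = begin
      size U * m                                             ≡⟨ *-distribʳ-sum m (λ v → ⟦ U v ⟧) ⟩
      sum (λ v → ⟦ U v ⟧ * m)                                ≤⟨ sum-mono (λ v → ℕ.*-monoʳ-≤ ⟦ U v ⟧ (rich v)) ⟩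
      sum (λ v → ⟦ U v ⟧ * sum (λ u → ⟦ A u ⟧ * ⟦ H v u ⟧))  ≡⟨ sum-cong-≗ (λ v → *-distribˡ-sum ⟦ U v ⟧ (λ u → ⟦ A u ⟧ * ⟦ H v u ⟧)) ⟩
      sum (λ v → sum (λ u → ⟦ U v ⟧ * (⟦ A u ⟧ * ⟦ H v u ⟧))) ≡⟨ ∑-comm (λ v u → ⟦ U v ⟧ * (⟦ A u ⟧ * ⟦ H v u ⟧)) ⟩
      sum (λ u → sum (λ v → ⟦ U v ⟧ * (⟦ A u ⟧ * ⟦ H v u ⟧))) ≡⟨ sum-cong-≗ (λ u → sum-cong-≗ (λ v → trans (swap ⟦ U v ⟧ ⟦ A u ⟧ ⟦ H v u ⟧) (cong (⟦ A u ⟧ *_) (sym (⟦∧⟧ (U v) (H v u)))))) ⟩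
      sum (λ u → sum (λ v → ⟦ A u ⟧ * ⟦ U v ∧ H v u ⟧))      ≡⟨ sum-cong-≗ (λ u → *-distribˡ-sum ⟦ A u ⟧ (λ v → ⟦ U v ∧ H v u ⟧)) ⟨
      sum (λ u → ⟦ A u ⟧ * size (λ v → U v ∧ H v u))         ∎
      where
      swap : ∀ a b c → a * (b * c) ≡ b * (a * c)
      swap = solve-∀

    dominate : ∀ fuel U → size U ≤ fuel → 1 ≤ size U → Dominating U
    dominate zero U U≤0 1≤U = contradiction (ℕ.≤-trans 1≤U U≤0) λ ()
    dominate (suc fuel) U U≤ 1≤U = continue (size U′) refl
      where
      choice = average A (λ u → size (λ v → U v ∧ H v u)) (ℕ.≤-trans 1≤m m≤A)
      u = proj₁ choice
      C = size (λ v → U v ∧ H v u)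
      U′ : Fin n → Bool
      U′ v = U v ∧ not (H v u)
      U′+C : size U′ + C ≡ size U
      U′+C = size-remove U (λ v → H v u)
      Um≤lC : size U * m ≤ l * C
      Um≤lC = ℕ.≤-trans (double-count U) (proj₂ (proj₂ choice))
      1≤C : 1 ≤ C
      1≤C = ℕ.n≢0⇒n>0 λ C≡0 → ℕ.<⇒≱ (ℕ.*-mono-≤ 1≤U 1≤m) (ℕ.≤-trans Um≤lC (ℕ.≤-reflexive (trans (cong (l *_) C≡0) (ℕ.*-zeroʳ l))))
      shrink : l * size U′ ≤ size U * (l ∸ m)
      shrink = begin
        l * size U′                 ≤⟨ ℕ.m+n≤o⇒m≤o∸n (l * size U′) (begin
          l * size U′ + size U * m    ≤⟨ ℕ.+-monoʳ-≤ (l * size U′) Um≤lC ⟩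
          l * size U′ + l * C         ≡⟨ ℕ.*-distribˡ-+ l (size U′) C ⟨
          l * (size U′ + C)           ≡⟨ cong (l *_) U′+C ⟩
          l * size U                  ≡⟨ ℕ.*-comm l (size U) ⟩
          size U * l                  ∎) ⟩
        size U * l ∸ size U * m     ≡⟨ ℕ.*-distribˡ-∸ (size U) l m ⟨
        size U * (l ∸ m)            ∎
      continue : ∀ s → size U′ ≡ s → Dominating U
      continue zero U′≡0 = record
        { S = λ w → does (u Fin.≟ w) ; steps = 0
        ; S-size = ℕ.≤-reflexive (size-point (λ _ → true) u refl)
        ; dominates = λ v Uv → u , point-refl , hit v Uv (H v u) refl
        ; progress = ℕ.≤-trans 1≤U (ℕ.≤-reflexive (sym (ℕ.*-identityʳ (size U)))) }
        where
        point-refl : does (u Fin.≟ u) ≡ true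
        point-refl with u Fin.≟ u
        ... | yes _ = refl
        ... | no u≢u = contradiction refl u≢u
        hit : ∀ v → U v ≡ true → ∀ h → H v u ≡ h → H v u ≡ true
        hit v Uv true  e = e
        hit v Uv false e = contradiction (subst (1 ≤_) U′≡0 (member⇒size U′ v (cong₂ (λ x y → x ∧ not y) Uv e))) λ ()
      continue (suc s) U′≡ = record
        { S = S′ ; steps = suc steps
        ; S-size = ℕ.≤-trans (sum-mono (λ w → le w (u Fin.≟ w))) (ℕ.≤-trans (ℕ.≤-reflexive (∑-distrib-+ (λ w → ⟦ does (u Fin.≟ w) ⟧) (λ w → ⟦ S w ⟧)))
            (ℕ.+-mono-≤ (ℕ.≤-reflexive (size-point (λ _ → true) u refl)) S-size))
        ; dominates = λ v Uv → dom v Uv (H v u) refl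
        ; progress = begin
            l * l ^ steps                          ≤⟨ ℕ.*-monoʳ-≤ l progress ⟩
            l * (size U′ * (l ∸ m) ^ steps)        ≡⟨ ℕ.*-assoc l (size U′) _ ⟨
            l * size U′ * (l ∸ m) ^ steps          ≤⟨ ℕ.*-monoˡ-≤ ((l ∸ m) ^ steps) shrink ⟩
            size U * (l ∸ m) * (l ∸ m) ^ steps     ≡⟨ ℕ.*-assoc (size U) (l ∸ m) _ ⟩
            size U * (l ∸ m) ^ suc steps           ∎ }
        where
        rest = dominate fuel U′
          (ℕ.≤-pred (ℕ.≤-trans (ℕ.≤-trans (ℕ.≤-reflexive (ℕ.+-comm 1 (size U′))) (ℕ.≤-trans (ℕ.+-monoʳ-≤ (size U′) 1≤C) (ℕ.≤-reflexive U′+C))) U≤))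
          (subst (1 ≤_) (sym U′≡) (s≤s z≤n))
        open Dominating rest
        S′ : Fin n → Bool
        S′ w = if does (u Fin.≟ w) then true else S w
        le : ∀ w (d : Dec (u ≡ w)) → ⟦ if does d then true else S w ⟧ ≤ ⟦ does d ⟧ + ⟦ S w ⟧
        le w (yes _) = s≤s z≤n
        le w (no _)  = ℕ.≤-refl
        S⊆S′ : ∀ w → S w ≡ true → S′ w ≡ true
        S⊆S′ w Sw with u Fin.≟ w
        ... | yes _ = refl
        ... | no _  = Sw
        u∈S′ : S′ u ≡ true
        u∈S′ with u Fin.≟ u
        ... | yes _ = refl
        ... | no u≢u = contradiction refl u≢u
        dom : ∀ v → U v ≡ true → ∀ h → H v u ≡ h → ∃[ w ] S′ w ≡ true × H v w ≡ true
        dom v Uv true  e = u , u∈S′ , e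
        dom v Uv false e with dominates v (cong₂ (λ x y → x ∧ not y) Uv e)
        ... | w , Sw , Hw = w , S⊆S′ w Sw , Hw

  -- Conditional expectations for the random choice that selects one vertex of each consecutive
  -- pair together with an index below k: a vertex survives a pair containing a and b with
  -- probability 1 - (h a + h b)/2k, which is at most the product of its two weights over q².
  module Paired {k : ℕ} (1≤k : 1 ≤ k) (p q : ℕ) (q≡1+p : q ≡ 1 + p) (2k≤q : 2 * k ≤ q) (1≤p : 1 ≤ p)
                (hit : Fin n → Fin n → Fin k → Bool) (H : Fin n → Fin n → Bool)
                (H-elim : ∀ {v u} → H v u ≡ true → ∃[ i ] hit v u i ≡ true) where

    private
      p≤q : p ≤ q
      p≤q = ℕ.≤-trans (ℕ.n≤1+n p) (ℕ.≤-reflexive (sym q≡1+p))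
      instance
        q≢0 : NonZero q
        q≢0 = ℕ.>-nonZero (ℕ.≤-trans 1≤p p≤q)

    weight : Bool → ℕ
    weight true  = p
    weight false = q

    -- Divided by q^(length us), this is a pessimistic estimator: it bounds the probability that no
    -- choice from the pairs of `us` dominates v. `Φ` correspondingly bounds the expected number of
    -- missed vertices of U.
    φ : Fin n → List (Fin n) → ℕ
    φ v []       = 1
    φ v (u ∷ us) = weight (H v u) * φ v us

    Φ : (Fin n → Bool) → List (Fin n) → ℕ
    Φ U us = sum (λ v → ⟦ U v ⟧ * φ v us)

    record Selection (U : Fin n → Bool) (us : List (Fin n)) : Set where
      field
        f         : Fin n → Maybe (Fin k)
        f-dom     : ∀ {u i} → f u ≡ just i → u ∈ₗ us
        f-size    : 2 * size (is-just ∘ f) ≤ length us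
        dominates : ∀ v → U v ≡ true → ∃[ u ] ∃[ i ] f u ≡ just i × hit v u i ≡ true

    skip : ∀ {U us} → (∀ v → U v ≢ true) → Selection U us
    skip {us = us} none = record
      { f = λ _ → nothing ; f-dom = λ ()
      ; f-size = ℕ.≤-trans (ℕ.≤-reflexive (cong (2 *_) (trans (sum-const n 0) (ℕ.*-zeroʳ n)))) z≤n
      ; dominates = λ v Uv → contradiction Uv (none v) }

    -- Divided by q², this reads 1 - (a + b)/q ≤ product of the two weights over q². As p = q - 1,
    -- it is an equality unless a and b both hit, when (q - 1)² exceeds q² - 2q by 1.
    2-step : ∀ a b y → q * (q * y) ≤ weight a * (weight b * y) + q * (⟦ a ⟧ * y + ⟦ b ⟧ * y)
    2-step true true y = ℕ.≤-trans (ℕ.m≤m+n (q * (q * y)) y) (ℕ.≤-reflexive (lemma p q y q≡1+p))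
      where
      expand : ∀ p y → (1 + p) * ((1 + p) * y) + y ≡ p * (p * y) + (1 + p) * (1 * y + 1 * y)
      expand = solve-∀
      lemma : ∀ p q y → q ≡ 1 + p → q * (q * y) + y ≡ p * (p * y) + q * (1 * y + 1 * y)
      lemma p _ y refl = expand p y
    2-step true false y = ℕ.≤-reflexive (lemma p q y q≡1+p)
      where
      expand : ∀ p y → (1 + p) * ((1 + p) * y) ≡ p * ((1 + p) * y) + (1 + p) * (1 * y + 0)
      expand = solve-∀
      lemma : ∀ p q y → q ≡ 1 + p → q * (q * y) ≡ p * (q * y) + q * (1 * y + 0)
      lemma p _ y refl = expand p y
    2-step false true y = ℕ.≤-reflexive (lemma p q y q≡1+p)
      where
      expand : ∀ p y → (1 + p) * ((1 + p) * y) ≡ (1 + p) * (p * y) + (1 + p) * (1 * y)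
      expand = solve-∀
      lemma : ∀ p q y → q ≡ 1 + p → q * (q * y) ≡ q * (p * y) + q * (1 * y)
      lemma p _ y refl = expand p y
    2-step false false y = ℕ.m≤m+n (q * (q * y)) _

    Gain : (Fin n → Bool) → List (Fin n) → Fin n → ℕ
    Gain U us x = sum (λ v → ⟦ U v ⟧ * (⟦ H v x ⟧ * φ v us))

    Gainᵢ : (Fin n → Bool) → List (Fin n) → Fin n → Fin k → ℕ
    Gainᵢ U us x i = sum (λ v → ⟦ U v ∧ hit v x i ⟧ * φ v us)

    gain≤ : ∀ U us x → ∃[ i ] Gain U us x ≤ k * Gainᵢ U us x i
    gain≤ U us x with average (λ _ → true) (Gainᵢ U us x) (subst (1 ≤_) (sym (size-⊤ k)) 1≤k)
    ... | i , _ , le = i , (begin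
        Gain U us x
          ≤⟨ sum-mono pointwise ⟩
        sum (λ v → sum (λ i → ⟦ U v ∧ hit v x i ⟧ * φ v us))
          ≡⟨ ∑-comm (λ v i → ⟦ U v ∧ hit v x i ⟧ * φ v us) ⟩
        sum (Gainᵢ U us x)
          ≡⟨ sum-cong-≗ (λ i → ℕ.*-identityˡ (Gainᵢ U us x i)) ⟨
        sum (λ i → 1 * Gainᵢ U us x i)
          ≤⟨ le ⟩
        size {k} (λ _ → true) * Gainᵢ U us x i
          ≡⟨ cong (_* Gainᵢ U us x i) (size-⊤ k) ⟩
        k * Gainᵢ U us x i ∎)
      where
      pointwise : ∀ v → ⟦ U v ⟧ * (⟦ H v x ⟧ * φ v us) ≤ sum (λ i → ⟦ U v ∧ hit v x i ⟧ * φ v us)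
      pointwise v with U v | H v x in e
      ... | false | _     = z≤n
      ... | true  | false = z≤n
      ... | true  | true with H-elim e
      ...   | i , hi = ℕ.≤-trans (ℕ.≤-reflexive (trans (ℕ.*-identityˡ (1 * φ v us)) (cong (λ b → ⟦ b ⟧ * φ v us) (sym hi)))) (term≤sum (λ i → ⟦ hit v x i ⟧ * φ v us) i)

    remaining : (Fin n → Bool) → Fin n → Fin k → Fin n → Bool
    remaining U x i v = U v ∧ not (hit v x i)

    Φ-remaining : ∀ U us x i → Φ (remaining U x i) us + Gainᵢ U us x i ≡ Φ U us
    Φ-remaining U us x i = trans (sym (∑-distrib-+ (λ v → ⟦ remaining U x i v ⟧ * φ v us) _))
      (sum-cong-≗ (λ v → trans (sym (ℕ.*-distribʳ-+ (φ v us) ⟦ remaining U x i v ⟧ _)) (cong (_* φ v us) (⟦⟧-split (U v) (hit v x i)))))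

    -- The better of a and b, with its best index, removes at least the average over all 2k choices,
    -- hence at least 1/q of the two gains. By `2-step` the estimator then does not increase.
    pair-step : ∀ U a b us → ∃[ x ] ∃[ i ] (x ≡ a ⊎ x ≡ b) × q * (q * Φ (remaining U x i) us) ≤ Φ U (a ∷ b ∷ us)
    pair-step U a b us = pick (ℕ.≤-total (Gain U us b) (Gain U us a))
      where
      base gain : Fin n → ℕ
      base v = ⟦ U v ⟧ * φ v (a ∷ b ∷ us)
      gain v = ⟦ U v ⟧ * (⟦ H v a ⟧ * φ v us) + ⟦ U v ⟧ * (⟦ H v b ⟧ * φ v us)
      lemma₁ : ∀ q u y → q * (q * (u * y)) ≡ u * (q * (q * y))
      lemma₁ = solve-∀
      lemma₂ : ∀ u z q a b → u * (z + q * (a + b)) ≡ u * z + q * (u * a + u * b)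
      lemma₂ = solve-∀
      pointwise : ∀ v → q * (q * (⟦ U v ⟧ * φ v us)) ≤ base v + q * gain v
      pointwise v = ℕ.≤-trans (ℕ.≤-reflexive (lemma₁ q ⟦ U v ⟧ (φ v us)))
        (ℕ.≤-trans (ℕ.*-monoʳ-≤ ⟦ U v ⟧ (2-step (H v a) (H v b) (φ v us)))
          (ℕ.≤-reflexive (lemma₂ ⟦ U v ⟧ (φ v (a ∷ b ∷ us)) q (⟦ H v a ⟧ * φ v us) (⟦ H v b ⟧ * φ v us))))
      sum-gain : sum (λ v → q * gain v) ≡ q * (Gain U us a + Gain U us b)
      sum-gain = trans (sym (*-distribˡ-sum q gain))
        (cong (q *_) (∑-distrib-+ (λ v → ⟦ U v ⟧ * (⟦ H v a ⟧ * φ v us)) (λ v → ⟦ U v ⟧ * (⟦ H v b ⟧ * φ v us))))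
      Σ-step : q * (q * Φ U us) ≤ Φ U (a ∷ b ∷ us) + q * (Gain U us a + Gain U us b)
      Σ-step = begin
        q * (q * Φ U us)                                    ≡⟨ cong (q *_) (*-distribˡ-sum q (λ v → ⟦ U v ⟧ * φ v us)) ⟩
        q * sum (λ v → q * (⟦ U v ⟧ * φ v us))              ≡⟨ *-distribˡ-sum q (λ v → q * (⟦ U v ⟧ * φ v us)) ⟩
        sum (λ v → q * (q * (⟦ U v ⟧ * φ v us)))            ≤⟨ sum-mono pointwise ⟩
        sum (λ v → base v + q * gain v)                     ≡⟨ ∑-distrib-+ base (λ v → q * gain v) ⟩
        sum base + sum (λ v → q * gain v)                   ≡⟨ cong (sum base +_) sum-gain ⟩
        Φ U (a ∷ b ∷ us) + q * (Gain U us a + Gain U us b)  ∎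
      finish : ∀ x → Gain U us a + Gain U us b ≤ 2 * Gain U us x →
               ∃[ i ] q * (q * Φ (remaining U x i) us) ≤ Φ U (a ∷ b ∷ us)
      finish x le with gain≤ U us x
      ... | i , le′ = i , ℕ.+-cancelʳ-≤ (q * (q * G)) (q * (q * Φ (remaining U x i) us)) (Φ U (a ∷ b ∷ us)) (begin
          q * (q * Φ (remaining U x i) us) + q * (q * G)   ≡⟨ lemma q (Φ (remaining U x i) us) G ⟩
          q * (q * (Φ (remaining U x i) us + G))           ≡⟨ cong (λ t → q * (q * t)) (Φ-remaining U us x i) ⟩
          q * (q * Φ U us)                                 ≤⟨ Σ-step ⟩
          Φ U (a ∷ b ∷ us) + q * (Gain U us a + Gain U us b) ≤⟨ ℕ.+-monoʳ-≤ (Φ U (a ∷ b ∷ us)) (ℕ.*-monoʳ-≤ q gains) ⟩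
          Φ U (a ∷ b ∷ us) + q * (q * G)                   ∎)
        where
        G = Gainᵢ U us x i
        lemma : ∀ q y g → q * (q * y) + q * (q * g) ≡ q * (q * (y + g))
        lemma = solve-∀
        gains : Gain U us a + Gain U us b ≤ q * G
        gains = begin
          Gain U us a + Gain U us b  ≤⟨ le ⟩
          2 * Gain U us x            ≤⟨ ℕ.*-monoʳ-≤ 2 le′ ⟩
          2 * (k * G)                ≡⟨ ℕ.*-assoc 2 k G ⟨
          2 * k * G                  ≤⟨ ℕ.*-monoˡ-≤ G 2k≤q ⟩
          q * G                      ∎
      pick : Gain U us b ≤ Gain U us a ⊎ Gain U us a ≤ Gain U us b →
             ∃[ x ] ∃[ i ] (x ≡ a ⊎ x ≡ b) × q * (q * Φ (remaining U x i) us) ≤ Φ U (a ∷ b ∷ us)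
      pick (inj₁ b≤a) with finish a (ℕ.+-monoʳ-≤ (Gain U us a) (ℕ.≤-trans b≤a (ℕ.≤-reflexive (sym (ℕ.+-identityʳ _)))))
      ... | i , le = a , i , inj₁ refl , le
      pick (inj₂ a≤b) with finish b (ℕ.+-mono-≤ a≤b (ℕ.≤-reflexive (sym (ℕ.+-identityʳ _))))
      ... | i , le = b , i , inj₂ refl , le

    extend : ∀ {U a b us x i} → x ≡ a ⊎ x ≡ b → ¬ x ∈ₗ us → Selection (remaining U x i) us → Selection U (a ∷ b ∷ us)
    extend {U} {a} {b} {us} {x} {i} x≡ x∉us rest = record
        { f = f′ ; f-dom = λ {u} → f′-dom u
        ; f-size = ℕ.≤-trans (ℕ.*-monoʳ-≤ 2 f′-size) (ℕ.≤-trans (ℕ.≤-reflexive (ℕ.*-distribˡ-+ 2 1 (size (is-just ∘ f)))) (ℕ.+-monoʳ-≤ 2 f-size))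
        ; dominates = λ v Uv → dom v Uv (hit v x i) refl }
      where
      open Selection rest
      x∈ : x ∈ₗ a ∷ b ∷ us
      x∈ = [ here , there ∘ here ]′ x≡
      f′ : Fin n → Maybe (Fin k)
      f′ u = if does (x Fin.≟ u) then just i else f u
      f′-dom : ∀ u {i′} → f′ u ≡ just i′ → u ∈ₗ a ∷ b ∷ us
      f′-dom u e with x Fin.≟ u
      ... | yes refl = x∈
      ... | no _     = there (there (f-dom e))
      f′-size : size (is-just ∘ f′) ≤ 1 + size (is-just ∘ f)
      f′-size = ℕ.≤-trans (sum-mono (λ u → bound u (x Fin.≟ u))) (ℕ.≤-reflexive (trans (∑-distrib-+ (λ u → ⟦ does (x Fin.≟ u) ⟧) (λ u → ⟦ is-just (f u) ⟧)) (cong (_+ size (is-just ∘ f)) (size-point (λ _ → true) x refl))))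
        where
        bound : ∀ u (d : Dec (x ≡ u)) → ⟦ is-just (if does d then just i else f u) ⟧ ≤ ⟦ does d ⟧ + ⟦ is-just (f u) ⟧
        bound u (yes _) = s≤s z≤n
        bound u (no _)  = ℕ.≤-refl
      f′-x : f′ x ≡ just i
      f′-x with x Fin.≟ x
      ... | yes _ = refl
      ... | no x≢x = contradiction refl x≢x
      f⊆f′ : ∀ u {i′} → f u ≡ just i′ → f′ u ≡ just i′
      f⊆f′ u e with x Fin.≟ u
      ... | yes refl = contradiction (f-dom e) x∉us
      ... | no _     = e
      dom : ∀ v → U v ≡ true → ∀ h → hit v x i ≡ h → ∃[ u ] ∃[ i ] f′ u ≡ just i × hit v u i ≡ true
      dom v Uv true  e = x , i , f′-x , e
      dom v Uv false e with dominates v (cong₂ (λ x y → x ∧ not y) Uv e)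
      ... | u , i′ , fu , h = u , i′ , f⊆f′ u fu , h

    -- The invariant keeps the estimator below p/q rather than below 1. A last vertex without a
    -- partner makes no choice, but its weight may already be counted as p; the extra factor absorbs
    -- this. At the end a surviving vertex alone would violate the bound.
    select : ∀ us → Unique us → ∀ U → Φ U us * q < p * q ^ length us → Selection U us
    select [] _ U small = skip λ v Uv → ℕ.<⇒≱ small (begin
        p * 1         ≤⟨ ℕ.≤-trans (ℕ.≤-reflexive (ℕ.*-identityʳ p)) p≤q ⟩
        q             ≡⟨ ℕ.*-identityˡ q ⟨
        1 * q         ≤⟨ ℕ.*-monoˡ-≤ q (ℕ.≤-trans (ℕ.≤-reflexive (cong (λ b → ⟦ b ⟧ * 1) (sym Uv))) (term≤sum (λ v → ⟦ U v ⟧ * 1) v)) ⟩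
        Φ U [] * q    ∎)
    select (a ∷ []) _ U small = skip λ v Uv → ℕ.<⇒≱ small (begin
        p * (q * 1)       ≡⟨ cong (p *_) (ℕ.*-identityʳ q) ⟩
        p * q             ≤⟨ ℕ.*-monoˡ-≤ q (ℕ.≤-trans (weight≥p (H v a)) (ℕ.≤-trans (ℕ.≤-reflexive (one Uv (weight (H v a)))) (term≤sum (λ v → ⟦ U v ⟧ * φ v (a ∷ [])) v))) ⟩
        Φ U (a ∷ []) * q  ∎)
      where
      weight≥p : ∀ h → p ≤ weight h
      weight≥p true  = ℕ.≤-refl
      weight≥p false = p≤q
      one : ∀ {v} → U v ≡ true → ∀ w → w ≡ ⟦ U v ⟧ * (w * 1)
      one Uv w rewrite Uv = sym (trans (ℕ.*-identityˡ (w * 1)) (ℕ.*-identityʳ w))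
    select (a ∷ b ∷ us) (a∉ ∷ b∉ ∷ unique) U small = continue (pair-step U a b us)
      where
      continue : ∃[ x ] ∃[ i ] (x ≡ a ⊎ x ≡ b) × q * (q * Φ (remaining U x i) us) ≤ Φ U (a ∷ b ∷ us) → Selection U (a ∷ b ∷ us)
      continue (x , i , x≡ , le) = extend x≡
          (λ x∈ → [ (λ e → All.lookup (All.tail a∉) x∈ (sym e)) , (λ e → All.lookup b∉ x∈ (sym e)) ]′ x≡)
          (select us unique (remaining U x i) small′)
        where
        small′ : Φ (remaining U x i) us * q < p * q ^ length us
        small′ = ℕ.*-cancelˡ-< (q * q) (Φ (remaining U x i) us * q) (p * q ^ length us) (begin-strict
          q * q * (Φ (remaining U x i) us * q)      ≡⟨ lemma₁ q (Φ (remaining U x i) us) ⟩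
          q * (q * Φ (remaining U x i) us) * q      ≤⟨ ℕ.*-monoˡ-≤ q le ⟩
          Φ U (a ∷ b ∷ us) * q                      <⟨ small ⟩
          p * (q * (q * q ^ length us))             ≡⟨ lemma₂ p q (q ^ length us) ⟩
          q * q * (p * q ^ length us)               ∎)
          where
          lemma₁ : ∀ q y → q * q * (y * q) ≡ q * (q * y) * q
          lemma₁ = solve-∀
          lemma₂ : ∀ p q y → p * (q * (q * y)) ≡ q * q * (p * y)
          lemma₂ = solve-∀

    elements : (Fin n → Bool) → List (Fin n)
    elements A = List.filter (λ u → A u Bool.≟ true) (List.allFin n)

    count : Fin n → List (Fin n) → ℕ
    count v []       = 0
    count v (u ∷ us) = ⟦ H v u ⟧ + count v us

    count-elements : ∀ A v → count v (elements A) ≡ size (λ u → A u ∧ H v u)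
    count-elements A v = go (λ i → i)
      where
      go : ∀ {m} (g : Fin m → Fin n) → count v (List.filter (λ u → A u Bool.≟ true) (List.tabulate g)) ≡ size (λ j → A (g j) ∧ H v (g j))
      go {zero}  g = refl
      go {suc m} g with A (g zero)
      ... | true  = cong (⟦ H v (g zero) ⟧ +_) (go (g ∘ suc))
      ... | false = go (g ∘ suc)

    length-elements : ∀ A → length (elements A) ≡ size A
    length-elements A = go (λ i → i)
      where
      go : ∀ {m} (g : Fin m → Fin n) → length (List.filter (λ u → A u Bool.≟ true) (List.tabulate g)) ≡ size (A ∘ g)
      go {zero}  g = refl
      go {suc m} g with A (g zero)
      ... | true  = cong suc (go (g ∘ suc))
      ... | false = go (g ∘ suc)

    φ-bound : ∀ v us m → m ≤ count v us → φ v us * q ^ m ≤ p ^ m * q ^ length us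
    φ-bound v [] zero _ = ℕ.≤-refl
    φ-bound v (u ∷ us) m m≤ with H v u
    ... | false = begin
        q * φ v us * q ^ m              ≡⟨ ℕ.*-assoc q (φ v us) (q ^ m) ⟩
        q * (φ v us * q ^ m)            ≤⟨ ℕ.*-monoʳ-≤ q (φ-bound v us m m≤) ⟩
        q * (p ^ m * q ^ length us)     ≡⟨ lemma q (p ^ m) (q ^ length us) ⟩
        p ^ m * (q * q ^ length us)     ∎
      where
      lemma : ∀ a b c → a * (b * c) ≡ b * (a * c)
      lemma = solve-∀
    φ-bound v (u ∷ us) zero m≤ | true = begin
        p * φ v us * 1                  ≡⟨ ℕ.*-assoc p (φ v us) 1 ⟩
        p * (φ v us * 1)                ≤⟨ ℕ.*-mono-≤ p≤q (φ-bound v us zero z≤n) ⟩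
        q * (1 * q ^ length us)         ≡⟨ lemma q (q ^ length us) ⟩
        1 * (q * q ^ length us)         ∎
      where
      lemma : ∀ a c → a * (1 * c) ≡ 1 * (a * c)
      lemma = solve-∀
    φ-bound v (u ∷ us) (suc m) m≤ | true = begin
        p * φ v us * (q * q ^ m)        ≡⟨ lemma₁ p (φ v us) q (q ^ m) ⟩
        p * q * (φ v us * q ^ m)        ≤⟨ ℕ.*-monoʳ-≤ (p * q) (φ-bound v us m (ℕ.≤-pred m≤)) ⟩
        p * q * (p ^ m * q ^ length us) ≡⟨ lemma₂ p q (p ^ m) (q ^ length us) ⟩
        p * p ^ m * (q * q ^ length us) ∎
      where
      lemma₁ : ∀ p y q z → p * y * (q * z) ≡ p * q * (y * z)
      lemma₁ = solve-∀
      lemma₂ : ∀ p q y z → p * q * (y * z) ≡ p * y * (q * z)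
      lemma₂ = solve-∀

    -- Each vertex has at least m + 1 factors p/q, so the estimator starts at no more than
    -- n(p/q)^(m+1). One of these factors is the p/q demanded by `select`, which is why `few` has
    -- the exponent m.
    selection : ∀ A m → (∀ v → suc m ≤ size (λ u → A u ∧ H v u)) → n * p ^ m < q ^ m →
                Selection (λ _ → true) (elements A)
    selection A m rich few = select us (Unique.filter⁺ _ (Unique.allFin⁺ n)) (λ _ → true) (ℕ.*-cancelʳ-< (q ^ m) (Φ (λ _ → true) us * q) (p * q ^ length us) (begin-strict
        Φ (λ _ → true) us * q * q ^ m                ≡⟨ ℕ.*-assoc (Φ (λ _ → true) us) q (q ^ m) ⟩
        Φ (λ _ → true) us * q ^ suc m                ≡⟨ *-distribʳ-sum (q ^ suc m) (λ v → 1 * φ v us) ⟩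
        sum (λ v → 1 * φ v us * q ^ suc m)           ≤⟨ sum-mono (λ v → ℕ.≤-trans (ℕ.≤-reflexive (cong (_* q ^ suc m) (ℕ.*-identityˡ (φ v us)))) (φ-bound v us (suc m) (subst (suc m ≤_) (sym (count-elements A v)) (rich v)))) ⟩
        sum {n} (λ v → p ^ suc m * q ^ length us)    ≡⟨ sum-const n (p ^ suc m * q ^ length us) ⟩
        n * (p ^ suc m * q ^ length us)              ≡⟨ lemma₁ n p (p ^ m) (q ^ length us) ⟩
        n * p ^ m * (p * q ^ length us)              <⟨ ℕ.*-monoˡ-< (p * q ^ length us) {{pq≢0}} few ⟩
        q ^ m * (p * q ^ length us)                  ≡⟨ ℕ.*-comm (q ^ m) _ ⟩
        p * q ^ length us * q ^ m                    ∎))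
      where
      us = elements A
      pq≢0 : NonZero (p * q ^ length us)
      pq≢0 = ℕ.m*n≢0 p (q ^ length us) {{ℕ.>-nonZero 1≤p}} {{ℕ.m^n≢0 q (length us)}}
      lemma₁ : ∀ n p y z → n * (p * y * z) ≡ n * y * (p * z)
      lemma₁ = solve-∀

-- Trees and tree partitions given by parent functions

count-tabulate : ∀ {a p} {A : Set a} {P : Pred A p} (P? : Decidable₁ P) {m} (g : Fin m → A) →
                 Vec.count P? (Vec.tabulate g) ≡ size (λ i → does (P? (g i)))
count-tabulate P? {zero}  g = refl
count-tabulate P? {suc m} g with does (P? (g zero))
... | true  = cong suc (count-tabulate P? (g ∘ suc))
... | false = count-tabulate P? (g ∘ suc)

∣tabulate∣ : ∀ {n} (A : Fin n → Bool) → ∣ Vec.tabulate A ∣ ≡ size A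
∣tabulate∣ A = trans (count-tabulate (Bool._≟ true) A) (sum-cong-≗ (λ i → cong ⟦_⟧ (does-≟ (A i))))
  where
  does-≟ : ∀ b → does (b Bool.≟ true) ≡ b
  does-≟ true  = refl
  does-≟ false = refl

∈-tabulate⁺ : ∀ {n} (A : Fin n → Bool) {u} → A u ≡ true → u ∈ Vec.tabulate A
∈-tabulate⁺ A {u} e = Vec.lookup⇒[]= u (Vec.tabulate A) (trans (Vec.lookup∘tabulate A u) e)

∈-tabulate⁻ : ∀ {n} (A : Fin n → Bool) {u} → u ∈ Vec.tabulate A → A u ≡ true
∈-tabulate⁻ A {u} u∈ = trans (sym (Vec.lookup∘tabulate A u)) (Vec.[]=⇒lookup u∈)

∈-⋃-tabulate : ∀ {n k} (P : Fin k → Subset n) i {u} → u ∈ P i → u ∈ ⋃ (List.tabulate P)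
∈-⋃-tabulate P zero    u∈ = Subset.x∈p∪q⁺ (inj₁ u∈)
∈-⋃-tabulate P (suc i) u∈ = Subset.x∈p∪q⁺ (inj₂ (∈-⋃-tabulate (P ∘ suc) i u∈))

module ParentTree {n r} (G : Graph n) (c : EdgeColouring G r) (hue : Fin r)
  (V : Fin n → Bool) (root : Fin n) (parent : Fin n → Fin n) (depth : Fin n → ℕ) (root∈V : V root ≡ true)
  (step : ∀ v → V v ≡ true → v ≢ root → V (parent v) ≡ true × depth (parent v) ℕ.< depth v
                                        × Σ[ e ∈ Adj G v (parent v) ] colour c e ≡ hue) where

  open import Relation.Binary.Construct.Closure.ReflexiveTransitive using (Star; ε; _◅_; _◅◅_; reverse)

  _⊣_ : Fin n → Fin n → Set
  u ⊣ v = (V u ≡ true × u ≢ root) × parent u ≡ v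

  Edge : Fin n → Fin n → Set
  Edge u v = u ⊣ v ⊎ v ⊣ u

  _⊣?_ : Decidable _⊣_
  u ⊣? v = (V u Bool.≟ true ×-dec ¬? (u Fin.≟ root)) ×-dec parent u Fin.≟ v

  edge? : Decidable Edge
  edge? u v = u ⊣? v ⊎-dec v ⊣? u

  ⊣-depth : ∀ {u v} → u ⊣ v → depth v ℕ.< depth u
  ⊣-depth {u} ((Vu , u≢) , refl) = proj₁ (proj₂ (step u Vu u≢))

  ⊣-adj : ∀ {u v} → u ⊣ v → Σ[ e ∈ Adj G u v ] colour c e ≡ hue
  ⊣-adj {u} ((Vu , u≢) , refl) = proj₂ (proj₂ (step u Vu u≢))

  ⊣-functional : ∀ {u v w} → u ⊣ v → u ⊣ w → v ≡ w
  ⊣-functional (_ , e) (_ , e′) = trans (sym e) e′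

  tree : Subgraph G
  tree = record
    { vertices = Vec.tabulate V
    ; Edge     = Edge
    ; edge?    = edge?
    ; edge-sym = [ inj₂ , inj₁ ]′
    ; edge⇒adj = [ proj₁ ∘ ⊣-adj , adj-sym G ∘ proj₁ ∘ ⊣-adj ]′
    ; edge⇒∈   = λ { (inj₁ ((Vu , _) , _)) → ∈-tabulate⁺ V Vu
                   ; {v = v} (inj₂ ((Vv , v≢) , refl)) → ∈-tabulate⁺ V (proj₁ (step v Vv v≢)) }
    }

  monochromatic : ∀ {u v} (uv : Edge u v) → colour c (Subgraph.edge⇒adj tree uv) ≡ hue
  monochromatic (inj₁ u⊣v) = proj₂ (⊣-adj u⊣v)
  monochromatic (inj₂ v⊣u) = trans (colour-sym c _ _) (proj₂ (⊣-adj v⊣u))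

  to-root : ∀ h v → depth v ℕ.≤ h → V v ≡ true → Star Edge v root
  to-root h v v≤h Vv with v Fin.≟ root
  ... | yes refl = ε
  to-root zero v v≤h Vv | no v≢ = contradiction (ℕ.≤-trans (⊣-depth ((Vv , v≢) , refl)) v≤h) λ ()
  to-root (suc h) v v≤h Vv | no v≢ = inj₁ v⊣p ◅ to-root h (parent v) (ℕ.≤-pred (ℕ.≤-trans (⊣-depth v⊣p) v≤h)) (proj₁ (step v Vv v≢))
    where
    v⊣p : v ⊣ parent v
    v⊣p = (Vv , v≢) , refl

  -- A path without repetition that has gone down once keeps going down.
  descend : ∀ u v vs w → let rest = v ∷ vs ∷ʳ w in Unique (u ∷ rest) → Linked Edge (u ∷ rest) → v ⊣ u →
            depth u ℕ.< depth w × ∃[ p ] p ∈ₗ rest × w ⊣ p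
  descend u v [] w ((_ ∷ u≢w ∷ []) ∷ _) (_ ∷ inj₁ v⊣w ∷ [-]) v⊣u = contradiction (⊣-functional v⊣u v⊣w) u≢w
  descend u v [] w _ (_ ∷ inj₂ w⊣v ∷ [-]) v⊣u = ℕ.<-trans (⊣-depth v⊣u) (⊣-depth w⊣v) , v , here refl , w⊣v
  descend u v (x ∷ vs) w ((_ ∷ u≢x ∷ _) ∷ _) (_ ∷ inj₁ v⊣x ∷ _) v⊣u = contradiction (⊣-functional v⊣u v⊣x) u≢x
  descend u v (x ∷ vs) w (_ ∷ unique) (_ ∷ inj₂ x⊣v ∷ linked) v⊣u with descend v x vs w unique (inj₂ x⊣v ∷ linked) x⊣v
  ... | v<w , p , p∈ , w⊣p = ℕ.<-trans (⊣-depth v⊣u) v<w , p , there p∈ , w⊣p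

  -- Either the path climbs to its end, or it turns away from the root somewhere, and `descend`
  -- applies from there on.
  ascend : ∀ v vs w → let path = v ∷ vs ∷ʳ w in Unique path → Linked Edge path →
           depth w ℕ.< depth v ⊎ (∃[ p ] p ∈ₗ path × w ⊣ p)
  ascend v [] w _ (inj₁ v⊣w ∷ [-]) = inj₁ (⊣-depth v⊣w)
  ascend v [] w _ (inj₂ w⊣v ∷ [-]) = inj₂ (v , here refl , w⊣v)
  ascend v (x ∷ vs) w unique (inj₂ x⊣v ∷ linked) with descend v x vs w unique (inj₂ x⊣v ∷ linked) x⊣v
  ... | _ , p , p∈ , w⊣p = inj₂ (p , there p∈ , w⊣p)
  ascend v (x ∷ vs) w (_ ∷ unique) (inj₁ v⊣x ∷ linked) with ascend x vs w unique linked
  ... | inj₁ w<x = inj₁ (ℕ.<-trans w<x (⊣-depth v⊣x))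
  ... | inj₂ (p , p∈ , w⊣p) = inj₂ (p , there p∈ , w⊣p)

  last∈ : ∀ vs (w : Fin n) → w ∈ₗ vs ∷ʳ w
  last∈ []       w = here refl
  last∈ (v ∷ vs) w = there (last∈ vs w)

  -- A vertex has one parent, so a path may turn from climbing to descending but never back. If the
  -- edge closing the cycle agreed with this, either the depths would decrease all the way round, or
  -- two occurrences of the same parent would repeat a vertex.
  acyclic : Subgraph.Acyclic tree
  acyclic u v vs w (u≢ ∷ unique) (inj₂ v⊣u ∷ linked) wu with descend u v vs w (u≢ ∷ unique) (inj₂ v⊣u ∷ linked) v⊣u | wu
  ... | _ , p , p∈ , w⊣p | inj₁ w⊣u = All.lookup u≢ p∈ (⊣-functional w⊣u w⊣p)
  ... | u<w , _          | inj₂ u⊣w = ℕ.<-asym u<w (⊣-depth u⊣w)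
  acyclic u v vs w (u≢ ∷ unique) (inj₁ u⊣v ∷ linked) (inj₂ u⊣w) with unique
  ... | v≢ ∷ _ = All.lookup v≢ (last∈ vs w) (⊣-functional u⊣v u⊣w)
  acyclic u v vs w (u≢ ∷ unique) (inj₁ u⊣v ∷ linked) (inj₁ w⊣u) with ascend v vs w unique linked
  ... | inj₁ w<v = ℕ.<-asym (ℕ.<-trans w<v (⊣-depth u⊣v)) (⊣-depth w⊣u)
  ... | inj₂ (p , p∈ , w⊣p) = All.lookup u≢ p∈ (⊣-functional w⊣u w⊣p)

  isTree : Subgraph.IsTree tree
  isTree = (root , ∈-tabulate⁺ V root∈V) ,
    (λ {u} {v} u∈ v∈ → to-root (depth u) u ℕ.≤-refl (∈-tabulate⁻ V u∈) ◅◅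
       reverse [ inj₂ , inj₁ ]′ (to-root (depth v) v ℕ.≤-refl (∈-tabulate⁻ V v∈))) ,
    acyclic

  leaf : ∀ {v} → V v ≡ true → v ≢ root → (∀ {u} → ¬ u ⊣ v) → Subgraph.IsLeaf tree v
  leaf {v} Vv v≢ childless = ∈-tabulate⁺ V Vv , trans (count-tabulate (edge? v) id)
    (trans (sum-cong-≗ (λ u → cong ⟦_⟧ (does-⇔ (mk⇔ only-parent (λ e → inj₁ ((Vv , v≢) , e))) (edge? v u) (parent v Fin.≟ u))))
      (size-point (λ _ → true) (parent v) refl))
    where
    only-parent : ∀ {u} → Edge v u → parent v ≡ u
    only-parent (inj₁ (_ , e)) = e
    only-parent (inj₂ u⊣v) = contradiction u⊣v childless

-- `owner` distributes the vertices outside L among the trees, which makes the trees cover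
-- everything and meet only in L. As `step` forbids parents in L, the vertices of L are childless in
-- every tree.
module ParentForest {n r k} (G : Graph n) (c : EdgeColouring G r)
  (hue : Fin k → Fin r) (hue-injective : Injective _≡_ _≡_ hue)
  (L : Fin n → Bool) (owner : Fin n → Fin k) (root : Fin k → Fin n)
  (root∉L : ∀ i → L (root i) ≡ false) (owner-root : ∀ i → owner (root i) ≡ i)
  (parent : Fin k → Fin n → Fin n) (depth : Fin k → Fin n → ℕ)
  (step : ∀ i v → L v ≡ true ⊎ owner v ≡ i → v ≢ root i →
          (L (parent i v) ≡ false × owner (parent i v) ≡ i) × depth i (parent i v) ℕ.< depth i v
          × Σ[ e ∈ Adj G v (parent i v) ] colour c e ≡ hue i) where

  V : Fin k → Fin n → Bool
  V i v = L v ∨ does (owner v Fin.≟ i)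

  V⁻ : ∀ {i v} → V i v ≡ true → L v ≡ true ⊎ owner v ≡ i
  V⁻ {i} {v} Vv with L v | owner v Fin.≟ i
  ... | true  | _     = inj₁ refl
  ... | false | yes e = inj₂ e

  L⇒V : ∀ {i v} → L v ≡ true → V i v ≡ true
  L⇒V {i} {v} Lv rewrite Lv = refl

  owner⇒V : ∀ {i v} → owner v ≡ i → V i v ≡ true
  owner⇒V {i} {v} e with owner v Fin.≟ i
  ... | yes _ = Bool.∨-zeroʳ (L v)
  ... | no ≢i = contradiction e ≢i

  V-step : ∀ i v → V i v ≡ true → v ≢ root i → V i (parent i v) ≡ true × depth i (parent i v) ℕ.< depth i v
                                               × Σ[ e ∈ Adj G v (parent i v) ] colour c e ≡ hue i
  V-step i v Vv v≢ with step i v (V⁻ Vv) v≢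
  ... | (_ , own) , d , e = owner⇒V own , d , e

  module T i = ParentTree G c (hue i) (V i) (root i) (parent i) (depth i) (owner⇒V (owner-root i)) (V-step i)

  partition : AbsorbingTreePartition G c k (size L) n
  partition = record
    { T = T.tree
    ; T-tree = T.isTree
    ; L = Vec.tabulate L
    ; L-size = ∣tabulate∣ L
    ; T-cover = trans (cong ∣_∣ (Subset.⊆-antisym Subset.⊆⊤ (λ {v} _ → ∈-⋃-tabulate (λ i → Vec.tabulate (V i)) (owner v) (∈-tabulate⁺ (V (owner v)) (owner⇒V refl))))) (Subset.∣⊤∣≡n n)
    ; hue = hue
    ; hue-injective = hue-injective
    ; T-monochromatic = λ i → T.monochromatic i
    ; L-leaves = λ i {v} v∈ → let Lv = ∈-tabulate⁻ L v∈ in T.leaf i (L⇒V Lv)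
        (λ { refl → contradiction (trans (sym (root∉L i)) Lv) λ () })
        (λ { {u} ((Vu , u≢) , refl) → contradiction (trans (sym (proj₁ (proj₁ (step i u (V⁻ Vu) u≢)))) Lv) λ () })
    ; T-meet = λ {i} {j} i≢j → Subset.⊆-antisym (meet⊆ i j i≢j)
        (λ v∈ → Subset.x∈p∩q⁺ (∈-tabulate⁺ (V i) (L⇒V (∈-tabulate⁻ L v∈)) , ∈-tabulate⁺ (V j) (L⇒V (∈-tabulate⁻ L v∈))))
    }
    where
    meet⊆ : ∀ i j → i ≢ j → ∀ {v} → v ∈ Vec.tabulate (V i) ∩ Vec.tabulate (V j) → v ∈ Vec.tabulate L
    meet⊆ i j i≢j v∈ with Subset.x∈p∩q⁻ (Vec.tabulate (V i)) (Vec.tabulate (V j)) v∈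
    ... | v∈i , v∈j with V⁻ (∈-tabulate⁻ (V i) v∈i) | V⁻ (∈-tabulate⁻ (V j) v∈j)
    ...   | inj₁ Lv | _       = ∈-tabulate⁺ L Lv
    ...   | inj₂ _  | inj₁ Lv = ∈-tabulate⁺ L Lv
    ...   | inj₂ e  | inj₂ e′ = contradiction (trans (sym e) e′) i≢j

-- Absorbing tree partitions from stars and selected vertices

module Coloured {n r} (G : Graph n) (c : EdgeColouring G r) where

  col : Fin n → Fin n → Maybe (Fin r)
  col u v with adj? G u v
  ... | yes e = just (colour c e)
  ... | no _  = nothing

  col⁻ : ∀ {u v d} → col u v ≡ just d → Σ[ e ∈ Adj G u v ] colour c e ≡ d
  col⁻ {u} {v} eq with adj? G u v
  ... | yes e = e , Maybe.just-injective eq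

  col-sym : ∀ {u v d} → col u v ≡ just d → Σ[ e ∈ Adj G v u ] colour c e ≡ d
  col-sym eq with col⁻ eq
  ... | e , refl = adj-sym G e , colour-sym c (adj-sym G e) e

  ≢-coloured : ∀ {u v d} → col u v ≡ just d → v ≢ u
  ≢-coloured eq refl = adj-irrefl G refl (proj₁ (col⁻ eq))

  open Stars col public

  none≤ : ∀ v → sum (λ u → none (col v u)) ℕ.≤ n ℕ.∸ minDegree G
  none≤ v = ℕ.m+n≤o⇒m≤o∸n _ (begin
      sum (λ u → none (col v u)) ℕ.+ minDegree G      ≤⟨ ℕ.+-monoʳ-≤ _ (All.lookup (Extrema.min≤xs n _) (List∈.∈-map⁺ (degree G) (List∈.∈-allFin v))) ⟩
      sum (λ u → none (col v u)) ℕ.+ degree G v       ≡⟨ cong (sum (λ u → none (col v u)) ℕ.+_) (count-tabulate (adj? G v) id) ⟩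
      sum (λ u → none (col v u)) ℕ.+ size (λ u → does (adj? G v u)) ≡⟨ ∑-distrib-+ (λ u → none (col v u)) (λ u → ⟦ does (adj? G v u) ⟧) ⟨
      sum (λ u → none (col v u) ℕ.+ ⟦ does (adj? G v u) ⟧) ≡⟨ sum-cong-≗ one ⟩
      sum {n} (λ _ → 1)                               ≡⟨ size-⊤ n ⟩
      n                                               ∎)
    where
    open ℕ.≤-Reasoning
    one : ∀ u → none (col v u) ℕ.+ ⟦ does (adj? G v u) ⟧ ≡ 1
    one u with adj? G v u
    ... | yes _ = refl
    ... | no _  = refl

  minDegree≤n : minDegree G ℕ.≤ n
  minDegree≤n = Extrema.min≤⊤ n (List.map (degree G) (List.allFin n))

  -- A common leaf must hang in all k trees. Vertices of A do so directly below the k centres; a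
  -- leaf outside A has a single supporting vertex and so is possible only for k = 1. This is the
  -- alternative in `L-absorbed`.
  module Absorb {k} (hue : Fin k → Fin r) (hue-injective : Injective _≡_ _≡_ hue) (centre : Fin k → Fin n)
    (A : Fin n → Bool) (star : ∀ i {u} → A u ≡ true → col (centre i) u ≡ just (hue i)) (nonempty : 1 ℕ.≤ size A)
    (f : Fin n → Maybe (Fin k)) (f⇒A : ∀ {u i} → f u ≡ just i → A u ≡ true)
    (dominated : ∀ v → ∃[ u ] ∃[ i ] f u ≡ just i × hit hue A v u i ≡ true)
    (L : Fin n → Bool)
    (L-unselected : ∀ {u} → L u ≡ true → f u ≡ nothing)
    (L-nocentre : ∀ {i u} → L u ≡ true → u ≢ centre i)
    (L-absorbed : ∀ {u} → L u ≡ true → A u ≡ true ⊎ (∀ (i j : Fin k) → i ≡ j))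
    where

    centre-injective : ∀ {i j} → centre i ≡ centre j → i ≡ j
    centre-injective {i} {j} e with size⇒member A nonempty
    ... | u , Au = hue-injective (Maybe.just-injective (trans (sym (star i Au)) (trans (cong (λ x → col x u) e) (star j Au))))

    false⇐ : ∀ b → (b ≡ true → ⊥) → b ≡ false
    false⇐ true  h = ⊥-elim (h refl)
    false⇐ false h = refl

    support : Fin n → Fin n
    support v = proj₁ (dominated v)

    -- Centres are tested first, because the vertex dominating a centre may carry the index of
    -- another tree.
    owner : Fin n → Fin k
    owner v with Fin.any? (λ i → centre i Fin.≟ v)
    ... | yes (i , _) = i
    ... | no _        = maybe′ id (proj₁ (proj₂ (dominated v))) (f v)

    owner-centre : ∀ i → owner (centre i) ≡ i
    owner-centre i with Fin.any? (λ j → centre j Fin.≟ centre i)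
    ... | yes (j , e) = centre-injective e
    ... | no ¬p       = contradiction (i , refl) ¬p

    owner-selected : ∀ {u i} → f u ≡ just i → owner u ≡ i
    owner-selected {u} {i} e with Fin.any? (λ j → centre j Fin.≟ u)
    ... | yes (j , e′) = contradiction (sym e′) (≢-coloured (star j (f⇒A e)))
    ... | no _ rewrite e = refl

    owner-outside : ∀ {v} → A v ≡ false → (∀ i → v ≢ centre i) → owner v ≡ proj₁ (proj₂ (dominated v))
    owner-outside {v} ¬Av v≢ with Fin.any? (λ j → centre j Fin.≟ v)
    ... | yes (j , e) = contradiction (sym e) (v≢ j)
    ... | no _ with f v in e
    ...   | nothing = refl
    ...   | just i  = contradiction (trans (sym ¬Av) (f⇒A e)) λ ()

    parent : Fin k → Fin n → Fin n
    parent i v = if A v then centre i else support v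

    -- Three levels suffice: the centre, vertices of A below it, and the remaining vertices below
    -- selected vertices of A.
    depth : Fin k → Fin n → ℕ
    depth i v = if does (v Fin.≟ centre i) then 0 else if A v then 1 else 2

    depth-centre : ∀ i → depth i (centre i) ≡ 0
    depth-centre i with centre i Fin.≟ centre i
    ... | yes _ = refl
    ... | no ¬p = contradiction refl ¬p

    depth-other : ∀ i {v} b → A v ≡ b → v ≢ centre i → depth i v ≡ (if b then 1 else 2)
    depth-other i {v} b refl v≢ with v Fin.≟ centre i
    ... | yes e = contradiction e v≢
    ... | no _  = refl

    step : ∀ i v → L v ≡ true ⊎ owner v ≡ i → v ≢ centre i →
           (L (parent i v) ≡ false × owner (parent i v) ≡ i) × depth i (parent i v) ℕ.< depth i v
           × Σ[ e ∈ Adj G v (parent i v) ] colour c e ≡ hue i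
    step i v v∈ v≢ = go (A v) refl
      where
      go : ∀ b → A v ≡ b → let p = if b then centre i else support v in
           (L p ≡ false × owner p ≡ i) × depth i p ℕ.< depth i v × Σ[ e ∈ Adj G v p ] colour c e ≡ hue i
      go true  Av = (false⇐ (L (centre i)) (λ Lc → L-nocentre Lc refl) , owner-centre i)
        , subst₂ ℕ._<_ (sym (depth-centre i)) (sym (depth-other i true Av v≢)) (ℕ.s≤s ℕ.z≤n)
        , col-sym (star i Av)
      go false ¬Av with dominated v | owner-outside ¬Av
      ... | u , j , fu , h | own = (false⇐ (L u) (λ Lu → contradiction (trans (sym (L-unselected Lu)) fu) λ ()) , trans (owner-selected fu) j≡i)
        , subst₂ ℕ._<_ (sym (depth-other i true Au (≢-coloured (star i Au)))) (sym (depth-other i false ¬Av v≢)) (ℕ.s≤s (ℕ.s≤s ℕ.z≤n))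
        , col⁻ (trans (is⇒≡ (proj₂ (∧-true {A u} h))) (cong (just ∘ hue) j≡i))
        where
        Au : A u ≡ true
        Au = f⇒A fu
        j≡i : j ≡ i
        -- If v were some `centre i′`, its owner i′ would be i and v would be the root, which is
        -- excluded. Hence v is owned by the index of its dominating vertex.
        owned : owner v ≡ i → j ≡ i
        owned e = trans (sym (own λ i′ v≡ → v≢ (trans v≡ (cong centre (trans (sym (owner-centre i′)) (trans (cong owner (sym v≡)) e)))))) e
        j≡i = [ [ (λ Av → contradiction (trans (sym ¬Av) Av) λ ()) , (λ all≡ → all≡ j i) ]′ ∘ L-absorbed , owned ]′ v∈

    partition : AbsorbingTreePartition G c k (size L) n
    partition = ParentForest.partition G c hue hue-injective L owner centre
      (λ i → false⇐ (L (centre i)) (λ Lc → L-nocentre Lc refl)) owner-centre parent depth step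

-- The two outcomes in integer form

module Outcome {n r} .{{_ : NonZero n}} (G : Graph n) (c : EdgeColouring G r)
               (m p : ℕ) (suc[p]≡2r : suc p ≡ 2 ℕ.* r) (few : n ℕ.* p ℕ.^ m ℕ.< suc p ℕ.^ m) where
  open Coloured G c

  b : ℕ
  b = n ℕ.∸ minDegree G

  -- Here a is the size of A, and 2 + t accounts for the centre and the at most t + 1 dominating
  -- vertices, the only possible non-leaves.
  SpanningTree : Set₁
  SpanningTree = ∃[ l ] ∃[ a ] ∃[ t ] AbsorbingTreePartition G c 1 l n × n ℕ.≤ l ℕ.+ (2 ℕ.+ t)
    × suc m ℕ.≤ a × a ℕ.≤ n × a ℕ.^ t ℕ.≤ n ℕ.* (a ℕ.∸ suc m) ℕ.^ t

  TreePartition : Set₁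
  TreePartition = ∃[ k ] ∃[ l ] 2 ℕ.≤ k × k ℕ.≤ r × AbsorbingTreePartition G c k l n × suc m ℕ.≤ 2 ℕ.* l

  private
    1≤n : 1 ℕ.≤ n
    1≤n = ℕ.>-nonZero⁻¹ n

  1≤m : 1 ℕ.≤ m
  1≤m = go m few
    where
    go : ∀ m → n ℕ.* p ℕ.^ m ℕ.< suc p ℕ.^ m → 1 ℕ.≤ m
    go zero    lt = contradiction (ℕ.≤-trans 1≤n (ℕ.≤-reflexive (sym (ℕ.*-identityʳ n)))) (ℕ.<⇒≱ lt)
    go (suc m) _  = ℕ.s≤s ℕ.z≤n

  hits⇒A : ∀ {k} {hue : Fin k → Fin r} {A v u} → hits hue A v u ≡ true → A u ≡ true
  hits⇒A {hue = hue} {A} {v} {u} h with hits-elim {hue = hue} {A} {v} {u} h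
  ... | i , hi = proj₁ (∧-true {A u} hi)

  rich∧ : ∀ {k} {hue : Fin k → Fin r} {A} → (∀ v → suc m ℕ.≤ size (hits hue A v)) →
          ∀ v → suc m ℕ.≤ size (λ u → A u ∧ hits hue A v u)
  rich∧ {hue = hue} {A} rich v = ℕ.≤-trans (rich v) (size-mono {B = λ u → A u ∧ hits hue A v u} (λ u h → cong₂ _∧_ (hits⇒A {hue = hue} {A} {v} h) h))

  spanning-tree : (hue : Fin 1 → Fin r) → Injective _≡_ _≡_ hue → (centre : Fin 1 → Fin n) (A : Fin n → Bool) →
    (∀ i {u} → A u ≡ true → col (centre i) u ≡ just (hue i)) → b ℕ.+ m ℕ.< size A →
    (∀ v → suc m ℕ.≤ size (hits hue A v)) → SpanningTree
  spanning-tree hue hue-injective centre A star large rich =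
      size L , size A , steps , partition , cover , m<A , size≤n A ,
      subst (λ x → size A ℕ.^ steps ℕ.≤ x ℕ.* (size A ℕ.∸ suc m) ℕ.^ steps) (size-⊤ n) progress
    where
    m<A : suc m ℕ.≤ size A
    m<A = ℕ.≤-trans (ℕ.s≤s (ℕ.m≤n+m m b)) large
    open Domination.Greedy A (hits hue A) (suc m) (ℕ.s≤s ℕ.z≤n) m<A
      (λ v → ℕ.≤-trans (rich∧ {hue = hue} {A} rich v) (ℕ.≤-reflexive (sum-cong-≗ (λ u → ⟦∧⟧ (A u) (hits hue A v u)))))
    open Dominating (dominate n (λ _ → true) (size≤n _) (subst (1 ℕ.≤_) (sym (size-⊤ n)) 1≤n))
    f : Fin n → Maybe (Fin 1)
    f u = if A u ∧ S u then just zero else nothing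
    L : Fin n → Bool
    L u = not (A u ∧ S u) ∧ not (does (centre zero Fin.≟ u))
    f⇒A : ∀ {u i} → f u ≡ just i → A u ≡ true
    f⇒A {u} e with A u
    ... | true = refl
    f≡just : ∀ {u} → A u ≡ true → S u ≡ true → f u ≡ just zero
    f≡just Au Su rewrite Au | Su = refl
    dominated : ∀ v → ∃[ u ] ∃[ i ] f u ≡ just i × hit hue A v u i ≡ true
    dominated v with dominates v refl
    ... | u , Su , Hu with hits-elim {hue = hue} {A} {v} {u} Hu
    ...   | zero , h = u , zero , f≡just (proj₁ (∧-true {A u} h)) Su , h
    single : (i j : Fin 1) → i ≡ j
    single zero zero = refl
    L-unselected : ∀ {u} → L u ≡ true → f u ≡ nothing
    L-unselected {u} Lu with A u ∧ S u
    ... | false = refl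
    L-nocentre : ∀ {i u} → L u ≡ true → u ≢ centre i
    L-nocentre {zero} {u} Lu e with centre zero Fin.≟ u
    ... | yes _ = contradiction (trans (sym (Bool.∧-zeroʳ (not (A u ∧ S u)))) Lu) λ ()
    ... | no ¬p = ¬p (sym e)
    open Absorb hue hue-injective centre A star (ℕ.≤-trans (ℕ.s≤s ℕ.z≤n) m<A) f f⇒A dominated L L-unselected L-nocentre
      (λ _ → inj₂ single)
    cover : n ℕ.≤ size L ℕ.+ (2 ℕ.+ steps)
    cover = begin
      n                                      ≡⟨ size-⊤ n ⟨
      size {n} (λ _ → true)                  ≤⟨ sum-mono (λ u → one (A u) (S u) (does (centre zero Fin.≟ u))) ⟩
      sum (λ u → ⟦ L u ⟧ ℕ.+ (⟦ does (centre zero Fin.≟ u) ⟧ ℕ.+ ⟦ S u ⟧)) ≡⟨ ∑-distrib-+ (λ u → ⟦ L u ⟧) (λ u → ⟦ does (centre zero Fin.≟ u) ⟧ ℕ.+ ⟦ S u ⟧) ⟩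
      size L ℕ.+ sum (λ u → ⟦ does (centre zero Fin.≟ u) ⟧ ℕ.+ ⟦ S u ⟧)    ≡⟨ cong (size L ℕ.+_) (∑-distrib-+ (λ u → ⟦ does (centre zero Fin.≟ u) ⟧) (λ u → ⟦ S u ⟧)) ⟩
      size L ℕ.+ (size (λ u → does (centre zero Fin.≟ u)) ℕ.+ size S)      ≤⟨ ℕ.+-monoʳ-≤ (size L) (ℕ.+-mono-≤ (ℕ.≤-reflexive (size-point (λ _ → true) (centre zero) refl)) S-size) ⟩
      size L ℕ.+ (2 ℕ.+ steps)               ∎
      where
      open ℕ.≤-Reasoning
      one : ∀ a s x → 1 ℕ.≤ ⟦ not (a ∧ s) ∧ not x ⟧ ℕ.+ (⟦ x ⟧ ℕ.+ ⟦ s ⟧)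
      one a     true  true  = ℕ.m≤n⇒m≤o+n ⟦ not (a ∧ true) ∧ false ⟧ (ℕ.s≤s ℕ.z≤n)
      one a     true  false = ℕ.m≤n⇒m≤o+n ⟦ not (a ∧ true) ∧ true ⟧ ℕ.≤-refl
      one a     false true  = ℕ.m≤n⇒m≤o+n ⟦ not (a ∧ false) ∧ false ⟧ ℕ.≤-refl
      one true  false false = ℕ.≤-refl
      one false false false = ℕ.≤-refl

  tree-partition : ∀ {k} → 2 ℕ.≤ k → k ℕ.≤ r →
    (hue : Fin k → Fin r) → Injective _≡_ _≡_ hue → (centre : Fin k → Fin n) (A : Fin n → Bool) →
    (∀ i {u} → A u ≡ true → col (centre i) u ≡ just (hue i)) → b ℕ.+ m ℕ.< size A →
    (∀ v → suc m ℕ.≤ size (hits hue A v)) → TreePartition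
  tree-partition {k} 2≤k k≤r hue hue-injective centre A star large rich =
      k , size L , 2≤k , k≤r , partition , ℕ.≤-trans m<A half
    where
    m<A : suc m ℕ.≤ size A
    m<A = ℕ.≤-trans (ℕ.s≤s (ℕ.m≤n+m m b)) large
    2k≤q : 2 ℕ.* k ℕ.≤ suc p
    2k≤q = ℕ.≤-trans (ℕ.*-monoʳ-≤ 2 k≤r) (ℕ.≤-reflexive (sym suc[p]≡2r))
    1≤p : 1 ℕ.≤ p
    1≤p = ℕ.≤-pred (ℕ.≤-trans (ℕ.≤-trans 2≤k (ℕ.m≤n*m k 2)) 2k≤q)
    module P = Domination.Paired (ℕ.≤-trans (ℕ.n≤1+n 1) 2≤k) p (suc p) refl 2k≤q 1≤p (hit hue A) (hits hue A)
      (λ {v} {u} → hits-elim {hue = hue} {A} {v} {u})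
    open P.Selection (P.selection A m (rich∧ {hue = hue} {A} rich) few)
    L : Fin n → Bool
    L u = A u ∧ not (is-just (f u))
    f⇒A : ∀ {u i} → f u ≡ just i → A u ≡ true
    f⇒A e = proj₂ (List∈.∈-filter⁻ (λ u → A u Bool.≟ true) {xs = List.allFin n} (f-dom e))
    L-unselected : ∀ {u} → L u ≡ true → f u ≡ nothing
    L-unselected {u} Lu with f u
    ... | nothing = refl
    ... | just _  = contradiction (trans (sym (Bool.∧-zeroʳ (A u))) Lu) λ ()
    L⇒A : ∀ {u} → L u ≡ true → A u ≡ true
    L⇒A {u} Lu = proj₁ (∧-true {A u} Lu)
    open Absorb hue hue-injective centre A star (ℕ.≤-trans (ℕ.s≤s ℕ.z≤n) m<A) f f⇒A (λ v → dominates v refl) L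
      (λ {u} → L-unselected {u}) (λ {i} {u} Lu → ≢-coloured (star i (L⇒A {u} Lu))) (λ {u} Lu → inj₁ (L⇒A {u} Lu))
    half : size A ℕ.≤ 2 ℕ.* size L
    half = ℕ.+-cancelʳ-≤ (size A) _ _ (begin
      size A ℕ.+ size A                                 ≡⟨ cong (size A ℕ.+_) (ℕ.+-identityʳ (size A)) ⟨
      2 ℕ.* size A                                      ≡⟨ cong (2 ℕ.*_) (size-remove A (is-just ∘ f)) ⟨
      2 ℕ.* (size L ℕ.+ size (λ u → A u ∧ is-just (f u))) ≤⟨ ℕ.*-monoʳ-≤ 2 (ℕ.+-monoʳ-≤ (size L) (size-mono {B = is-just ∘ f} (λ u e → proj₂ (∧-true {A u} e)))) ⟩
      2 ℕ.* (size L ℕ.+ size (is-just ∘ f))             ≡⟨ ℕ.*-distribˡ-+ 2 (size L) (size (is-just ∘ f)) ⟩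
      2 ℕ.* size L ℕ.+ 2 ℕ.* size (is-just ∘ f)         ≤⟨ ℕ.+-monoʳ-≤ (2 ℕ.* size L) (ℕ.≤-trans f-size (ℕ.≤-reflexive (P.length-elements A))) ⟩
      2 ℕ.* size L ℕ.+ size A                           ∎)
      where open ℕ.≤-Reasoning

  outcome : (b ℕ.+ m) ℕ.* E r ℕ.< n → SpanningTree ⊎ TreePartition
  outcome lt with star-system b m none≤ lt
  -- Without stars no colour is used, so every vertex is poor; the size bound on A merely supplies
  -- one.
  ... | record { k = zero ; hue = hue ; A = A ; large = large ; rich = rich } = contradiction (ℕ.≤-trans (ℕ.s≤s ℕ.z≤n) (rich v)) impossible
    where
    v : Fin n
    v = proj₁ (size⇒member A (ℕ.≤-trans (ℕ.s≤s ℕ.z≤n) large))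
    impossible : ¬ 1 ℕ.≤ size (hits hue A v)
    impossible 1≤ with size⇒member (hits hue A v) 1≤
    ... | u , Hu with hits-elim {hue = hue} {A} {v} {u} Hu
    ...   | () , _
  ... | record { k = suc zero ; hue = hue ; hue-injective = inj ; centre = x ; A = A ; star = star ; large = large ; rich = rich } =
    inj₁ (spanning-tree hue inj x A star large rich)
  ... | record { k = suc (suc k) ; k+j≡r = k+j≡r ; hue = hue ; hue-injective = inj ; centre = x ; A = A ; star = star ; large = large ; rich = rich } =
    inj₂ (tree-partition (ℕ.s≤s (ℕ.s≤s ℕ.z≤n)) (ℕ.m+n≤o⇒m≤o _ (ℕ.≤-reflexive k+j≡r)) hue inj x A star large rich)

-- Return to the real parameters at late indices

-- The powers (1 + 1/(K + 1))^K tend to e > 8/3, and K = 100 is a round value that is large enough.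
-- The same K fixes the tolerance 1/101 at which n ≥ n₀ is read.
8/3≤[102/101]^100 : 8 ℕ.* 101 ℕ.^ 100 ℕ.≤ 3 ℕ.* 102 ℕ.^ 100
8/3≤[102/101]^100 = ℕ.≤ᵇ⇒≤ (8 ℕ.* 101 ℕ.^ 100) (3 ℕ.* 102 ℕ.^ 100) _

module Estimates where
  open import Data.Nat.Base as ℕ using (ℕ; zero; suc; NonZero; _!)
  open import Data.Rational.Base hiding (NonZero)
  open import Data.Rational.Solver using (module +-*-Solver)
  open Rationals
  open Exponential
  open Thresholds
  open ℚ.≤-Reasoning
  open +-*-Solver

  -- With p + 1 = 2r and a = 2r/α, the second term of n₀ is 2a log a, the form expected by
  -- `survival-bound`.
  second-term : ∀ X {A y} r p N → suc p ≡ 2 ℕ.* r →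
    X ⊔ (ι 4 * ι r * A) * leftSum N (ι 2 * ι r * A) ≤ y →
    (1ℚ + 1ℚ) * (ι (suc p) * A) * leftSum N (ι (suc p) * A) ≤ y
  second-term X {A} {y} r p N e le = begin
    (1ℚ + 1ℚ) * (ι (suc p) * A) * leftSum N (ι (suc p) * A)   ≡⟨ cong (λ t → (1ℚ + 1ℚ) * (t * A) * leftSum N (t * A)) (trans (cong ι e) (ι-homo-* 2 r)) ⟩
    (1ℚ + 1ℚ) * (ι 2 * ι r * A) * leftSum N (ι 2 * ι r * A)   ≡⟨ cong (_* leftSum N (ι 2 * ι r * A)) (solve 2 (λ r A → (con 1ℚ :+ con 1ℚ) :* (con (ι 2) :* r :* A) := con (ι 4) :* r :* A) refl (ι r) A) ⟩
    ι 4 * ι r * A * leftSum N (ι 2 * ι r * A)                 ≤⟨ ℚ.≤-trans (ℚ.p≤q⊔p X _) le ⟩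
    y                                                         ∎

  many-leaves : ∀ {x δ} n l t → 0ℚ < δ → n ℕ.≤ l ℕ.+ t → ι t ≤ x → ι n - x ≤ ι l + δ
  many-leaves {x} {δ} n l t 0<δ n≤ t≤x = begin
    ι n - x              ≤⟨ ℚ.+-mono-≤ (ℚ.≤-trans (ι-mono n≤) (ℚ.≤-reflexive (ι-homo-+ l t))) (ℚ.neg-antimono-≤ t≤x) ⟩
    ι l + ι t - ι t      ≡⟨ solve 2 (λ l t → l :+ t :- t := l) refl (ι l) (ι t) ⟩
    ι l                  ≤⟨ p≤p+q (ℚ.<⇒≤ 0<δ) ⟩
    ι l + δ              ∎

  half-leaves : ∀ {x δ m} l → 0ℚ < δ → x ≤ ι m → m ℕ.≤ 2 ℕ.* l → x * inv (ι 2) ≤ ι l + δ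
  half-leaves {x} {δ} {m} l 0<δ x≤m m≤2l = begin
    x * inv (ι 2)               ≤⟨ ℚ.*-monoʳ-≤-nonNeg (inv (ι 2)) (ℚ.≤-trans x≤m (ℚ.≤-trans (ι-mono m≤2l) (ℚ.≤-reflexive (ι-homo-* 2 l)))) ⟩
    ι 2 * ι l * inv (ι 2)       ≡⟨ solve 1 (λ l → con (ι 2) :* l :* con (inv (ι 2)) := l) refl (ι l) ⟩
    ι l                         ≤⟨ p≤p+q (ℚ.<⇒≤ 0<δ) ⟩
    ι l + δ                     ∎

  -- Positivity of αn rules out b > q, so the truncated subtractions are true ones.
  divide-up-∸ : ∀ {x b q} → 0ℚ < x → x ≤ ι (suc q ℕ.∸ b) → suc q ℕ.∸ b ≡ suc (q ℕ.∸ b) × b ℕ.+ (q ℕ.∸ b) ≡ q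
  divide-up-∸ {x} {b} {q} 0<x x≤ with b ℕ.≤? q
  ... | yes b≤q = ℕ.+-∸-assoc 1 b≤q , ℕ.m+[n∸m]≡n b≤q
  ... | no  b≰q = contradiction (subst (λ t → x ≤ ι t) (ℕ.m≤n⇒m∸n≡0 (ℕ.≰⇒> b≰q)) x≤) (<⇒≱ 0<x)

module Dichotomy {r n : ℕ} .{{_ : NonZero n}} (2≤r : 2 ℕ.≤ r) (G : Graph n) (c : EdgeColouring G r) where
  open import Data.Rational.Base hiding (NonZero)
  open Rationals
  open Exponential
  open Thresholds
  open Estimates

  α : ℚ → ℕ → ℚ
  α ε i = ι 1 * inv (expSum (suc i) * ι (r !)) - ε

  -- The conclusion of the theorem with the reals unfolded into their sequences; the two agree by
  -- computation.
  Conclusion : (ℕ → ℚ) → Set₁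
  Conclusion ε =
    (∃[ l ] AbsorbingTreePartition G c 1 l n
      × (∀ δ → 0ℚ < δ → ∃[ N ] (∀ i → N ℕ.≤ i → ι n - ι 2 * inv (α (ε i) i) * leftSum (suc i) (ι n) ≤ ι l + δ)))
    ⊎
    (∃[ k ] ∃[ l ] 2 ℕ.≤ k × k ℕ.≤ r × AbsorbingTreePartition G c k l n
      × (∀ δ → 0ℚ < δ → ∃[ N ] (∀ i → N ℕ.≤ i → α (ε i) i * ι n * inv (ι 2) ≤ ι l + δ)))

  private
    instance
      E≢0 : NonZero (E r)
      E≢0 = E-nonZero r
    quotient = divide-up n (E r)
    q = proj₁ quotient
    b = n ℕ.∸ minDegree G
    -- The m of the overview is `suc m` here: `suc q` is n / E r rounded up, while q itself
    -- satisfies q * E r < n, the strict bound from which the stars start.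
    m = q ℕ.∸ b
    -- p/(p + 1) = 1 - 1/(2r), with 2r ≥ 2k for whatever number k of stars results.
    p = ℕ.pred (2 ℕ.* r)
    4≤2r : 4 ℕ.≤ 2 ℕ.* r
    4≤2r = ℕ.*-monoʳ-≤ 2 2≤r
    suc[p]≡2r : suc p ≡ 2 ℕ.* r
    suc[p]≡2r = ℕ.suc-pred (2 ℕ.* r) {{ℕ.>-nonZero (ℕ.≤-trans (ℕ.s≤s ℕ.z≤n) 4≤2r)}}
    3≤p : 3 ℕ.≤ p
    3≤p = ℕ.≤-pred (ℕ.≤-trans 4≤2r (ℕ.≤-reflexive (sym suc[p]≡2r)))

  Admissible : ℚ → ℕ → Set
  Admissible ε i = suc r ℕ.≤ i × 0ℚ ≤ ε × 0ℚ < α ε i × (1ℚ - ε) * ι n ≤ ι (minDegree G) + slack n r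

  αn≤q-b : ∀ {ε i} → Admissible ε i → α ε i * ι n ≤ ι (suc q ℕ.∸ b)
  αn≤q-b {i = i} (r<i , _ , _ , deg) = αn≤ r n (minDegree G) (suc q) i r<i (Coloured.minDegree≤n G c) (proj₂ (proj₂ quotient)) deg

  identities : ∀ {ε i} → Admissible ε i → suc q ℕ.∸ b ≡ suc m × b ℕ.+ m ≡ q
  identities ok@(_ , _ , 0<α , _) = divide-up-∸ {b = b} {q} (*-pos 0<α (ι-pos n)) (αn≤q-b ok)

  αn≤m : ∀ {ε i} → Admissible ε i → α ε i * ι n ≤ ι (suc m)
  αn≤m {ε} {i} ok = subst (λ t → α ε i * ι n ≤ ι t) (proj₁ (identities ok)) (αn≤q-b ok)

  -- The conclusion does not mention i, so it is needed at one late index only.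
  few : ∀ {ε i} → Admissible ε i → ∀ X →
        X ⊔ ι 4 * ι r * inv (α ε i) * leftSum (suc i) (ι 2 * ι r * inv (α ε i)) ≤ ι n + inv (ι 101) →
        n ℕ.* p ℕ.^ m ℕ.< suc p ℕ.^ m
  few {i = i} ok@(r<i , 0≤ε , 0<α , _) X large = survival-bound p m n 100 (suc i) 3≤p 0<α
    (ℚ.≤-trans (α≤¼ r i 2≤r r<i 0≤ε) (ℚ.<⇒≤ (ℚ.*<* (ℤ.+<+ (ℕ.s≤s (ℕ.s≤s ℕ.z≤n)))))) (αn≤m ok) 8/3≤[102/101]^100
    (second-term X r p (suc i) suc[p]≡2r large)

  dichotomy : ∀ ε N → (∀ i → N ℕ.≤ i → Admissible (ε i) i) → n ℕ.* p ℕ.^ m ℕ.< suc p ℕ.^ m → Conclusion ε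
  dichotomy ε N ok few = Sum.map
      (λ { (l , a , t , P , n≤ , m≤a , a≤n , steps) → l , P , λ δ 0<δ → N , λ i N≤i →
        many-leaves n l (2 ℕ.+ t) 0<δ n≤ (bound i (ok i N≤i) a t m≤a a≤n steps) })
      (λ { (k , l , 2≤k , k≤r , P , m≤2l) → k , l , 2≤k , k≤r , P , λ δ 0<δ → N , λ i N≤i →
        half-leaves l 0<δ (αn≤m (ok i N≤i)) m≤2l })
      (Outcome.outcome G c m p suc[p]≡2r few
        (subst (λ t → t ℕ.* E r ℕ.< n) (sym (proj₂ (identities (ok N ℕ.≤-refl)))) (proj₁ (proj₂ quotient))))
    where
    bound : ∀ i → Admissible (ε i) i → ∀ a t → suc m ℕ.≤ a → a ℕ.≤ n → a ℕ.^ t ℕ.≤ n ℕ.* (a ℕ.∸ suc m) ℕ.^ t →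
            ι (2 ℕ.+ t) ≤ ι 2 * inv (α (ε i) i) * leftSum (suc i) (ι n)
    bound i ok′@(r<i , 0≤ε , 0<α , _) a t m≤a = greedy-steps-bound (suc i) n a (suc m) t 0<α (α≤¼ r i 2≤r r<i 0≤ε) (αn≤m ok′)
      m≤a (ℕ.≤-trans (ℕ.s≤s (Outcome.1≤m G c m p suc[p]≡2r few)) m≤a)

open import Defs
open import Data.Nat.Properties using (≤-trans; n≤1+n; _!≢0)

theorem4p3 :
    (r : ℕ) (2≤r : 2 ℕ.≤ r) →
    let instance
          r≢0 : NonZero r
          r≢0 = ℕ.>-nonZero (≤-trans (n≤1+n 1) 2≤r)
          r!≢0 : NonZero (r !)
          r!≢0 = r !≢0
    in
    (ε : ℝ) → 0ℝ < ε → (ε<1/er! : ε < 1ℝ / (e * fromℕ (r !))) →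
    let α = 1ℝ / (e * fromℕ (r !)) - ε
        instance
          0<α : 0ℝ < α
          0<α = x<y⇒0<y-x ε<1/er!
        n₀ = (fromℕ 12 / (α * α) * log (fromℕ 6 / (α * α)))
             ⊔ (fromℕ 4 * fromℕ r / α * log (fromℕ 2 * fromℕ r / α))
    in
    (n : ℕ) .{{_ : NonZero n}} → n₀ ≤ fromℕ n →
    (G : Graph n) → (1ℝ - ε) * fromℕ n ≤ fromℕ (minDegree G) →
    (c : EdgeColouring G r) →
    (∃[ l ] AbsorbingTreePartition G c 1 l n
            × fromℕ n - fromℕ 2 / α * log (fromℕ n) ≤ fromℕ l)
    ⊎
    (∃[ k ] ∃[ l ] 2 ℕ.≤ k × k ℕ.≤ r × AbsorbingTreePartition G c k l n
            × α * fromℕ n / fromℕ 2 ≤ fromℕ l)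
theorem4p3 r 2≤r ε 0<ε ε<1/er! n n₀≤n G deg c =
    dichotomy (ℝ.seq ε) N ok (few (ok i (ℕ.m≤m⊔n N (proj₁ large))) (ℝ.seq first i) (proj₂ large i (ℕ.m≤n⊔m N (proj₁ large))))
  where
  open Dichotomy 2≤r G c
  instance
    r!≢0 : NonZero (r !)
    r!≢0 = r !≢0
    0<α = x<y⇒0<y-x ε<1/er!
  first = let α′ = 1ℝ / (e * fromℕ (r !)) - ε in fromℕ 12 / (α′ * α′) * log (fromℕ 6 / (α′ * α′))
  -- The degree hypothesis is read with the tolerance that `αn≤` cancels.
  late = deg (Thresholds.slack n r) (Thresholds.slack>0 n r)
  -- The tolerance is 1/(K + 1) for the K = 100 of `few`.
  large = n₀≤n (Rationals.inv (Rationals.ι 101)) (Rationals.inv-pos (Rationals.ι-pos 101))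
  -- From index r + 1 on, the approximations of e contain the term 1/(r+1)! on which `slack` rests.
  N₃ = _<_.from 0<ε ℕ.⊔ suc r
  N₂ = _<_.from 0<α ℕ.⊔ N₃
  N = proj₁ late ℕ.⊔ N₂
  i = N ℕ.⊔ proj₁ large
  ok : ∀ i → N ℕ.≤ i → Admissible (ℝ.seq ε i) i
  ok i N≤i =
      ℕ.m⊔n≤o⇒n≤o (_<_.from 0<ε) (suc r) N₃≤i ,
      ℚ.<⇒≤ (ℚ.<-≤-trans (_<_.gap>0 0<ε) (gap≤ 0<ε i (ℕ.m⊔n≤o⇒m≤o (_<_.from 0<ε) (suc r) N₃≤i))) ,
      ℚ.<-≤-trans (_<_.gap>0 0<α) (gap≤ 0<α i (ℕ.m⊔n≤o⇒m≤o (_<_.from 0<α) N₃ N₂≤i)) ,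
      proj₂ late i (ℕ.m⊔n≤o⇒m≤o (proj₁ late) N₂ N≤i)
    where
    N₂≤i = ℕ.m⊔n≤o⇒n≤o (proj₁ late) N₂ N≤i
    N₃≤i = ℕ.m⊔n≤o⇒n≤o (_<_.from 0<α) N₃ N₂≤i
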